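{- For all integers $m\ge2$, all $p\in(0,1)$ and all $\varepsilon>0$, there exists $C>0$ such that if $N\ge C p^{ -(2m-1)}(\log(p^{ -1}))^2$, then \[ t(K_m,p,N)=(1\pm\varepsilon)\,p^{\binom m2}(2N)^{\frac m2}, \] i.e. $(1-\varepsilon)p^{\binom m2}(2N)^{m/2}\le t(K_m,p,N)\le(1+\varepsilon)p^{\binom m2}(2N)^{m/2}$.
   Context: In the Subgraph Query Game with parameter $p\in(0,1)$, Builder plays alone on the random graph $G(\mathbb Z,p)$ with infinitely many vertices, whose edges are initially hidden. At each turn Builder queries (adaptively) one pair of vertices and is told whether it is an edge; equivalently, each queried edge is built successfully, independently, with probability $p$, and each pair may be queried at most once. For a graph $H$ with no isolated vertices, $t(H,p,N)$ is the maximum, over all Builder strategies, of the expected number of copies of $H$ built in $N$ turns. Copies are labeled: a copy of $H$ in a graph $G$ is an injective map $V(H)\to V(G)$ sending edges to edges (so each $K_m$ subgraph counts $m!$ times). $N$ is a positive integer and logarithms are natural. -}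

module Defs where

open import Algebra.Bundles using (CommutativeRing)
open import Data.Empty using (⊥-elim)
open import Data.Fin.Base using (Fin; zero; suc)
open import Data.Fin.Properties using (all?) renaming (_≟_ to _≟ᶠ_)
open import Data.Integer.Base using (ℤ; +_; +<+) renaming (_<_ to _<ᶻ_)
import Data.Integer.Properties as ℤ
open import Data.List.Base
  using (List; []; _∷_; _++_; map; filter; length; deduplicate; upTo; cartesianProductWith)
open import Data.List.Membership.Propositional using (_∈_; _∉_)
open import Data.List.Membership.Propositional.Properties
  using ( ∈-map⁺; ∈-upTo⁺; ∈-filter⁺; ∈-filter⁻; ∈-deduplicate⁺; ∈-++⁺ˡ; ∈-++⁺ʳ
        ; ∈-cartesianProductWith⁺)
open import Data.List.Properties
  using (length-filter; length-deduplicate; length-map; length-++)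
open import Data.List.Relation.Unary.All as All using (All; []; _∷_)
open import Data.List.Relation.Unary.Any using (here; there)
import Data.List.Relation.Unary.Unique.DecPropositional.Properties as UniqueDec
open import Data.List.Relation.Unary.Unique.Propositional using (Unique)
open import Data.List.Relation.Unary.AllPairs using ([]; _∷_)
open import Data.List.Relation.Unary.Unique.Propositional.Properties
  using () renaming (filter⁺ to unique-filter; cartesianProductWith⁺ to unique-product)
open import Data.Nat.Base as ℕ using (ℕ; zero; suc; z≤n; s≤s; _!)
import Data.Nat.Properties as ℕ
open import Data.Product.Base using (∃; _×_; _,_; proj₁; proj₂)
open import Data.Product.Properties using (≡-dec)
open import Data.Sum.Base using (_⊎_; inj₁; inj₂)
open import Data.Vec.Base as Vec using (Vec; []; _∷_; lookup)
open import Data.Vec.Properties using (∷-injective)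
open import Function.Base using (_∘_)
open import Level using (0ℓ)
open import Relation.Binary.Bundles using (DecTotalOrder)
open import Relation.Binary.Core using (Rel)
open import Relation.Binary.Definitions using (Decidable; Symmetric)
open import Relation.Binary.PropositionalEquality
  using (_≡_; _≢_; refl; cong; cong₂; subst) renaming (sym to ≡-sym; trans to ≡-trans)
open import Relation.Binary.Structures using (IsDecTotalOrder)
open import Relation.Nullary using (¬_; Dec; yes; no; ¬?)
open import Relation.Nullary.Decidable using (_×-dec_; _⊎-dec_; _→-dec_)

------------------------------------------------------------------------
-- The real numbers

record OrderedField : Set₁ where
  infix 4 _≤_
  infix 9 _⁻¹
  field
    commutativeRing : CommutativeRing 0ℓ 0ℓ
  open CommutativeRing commutativeRing public
    renaming (zero to *-zero; refl to ≈-refl; sym to ≈-sym; trans to ≈-trans)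
  field
    _≤_             : Rel Carrier 0ℓ
    isDecTotalOrder : IsDecTotalOrder _≈_ _≤_
    +-monoʳ-≤       : ∀ x {y z} → y ≤ z → x + y ≤ x + z
    *-nonNeg        : ∀ {x y} → 0# ≤ x → 0# ≤ y → 0# ≤ x * y
    0≉1             : 0# ≉ 1#
    _⁻¹             : Carrier → Carrier
    *-inverseʳ      : ∀ {x} → x ≉ 0# → x * x ⁻¹ ≈ 1#

  decTotalOrder : DecTotalOrder 0ℓ 0ℓ 0ℓ
  decTotalOrder = record { isDecTotalOrder = isDecTotalOrder }

  open import Relation.Binary.Properties.DecTotalOrder decTotalOrder public
    using (_<_; <-resp-≈; <⇒≱; ≰⇒>)

  IsUpperBound : (Carrier → Set) → Carrier → Set
  IsUpperBound P b = ∀ {x} → P x → x ≤ b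

  IsSupremum : (Carrier → Set) → Carrier → Set
  IsSupremum P s = IsUpperBound P s × (∀ {y} → y < s → ∃ λ x → P x × y < x)

-- These axioms determine ℝ up to unique isomorphism.  They are the classical
-- ones: the order is decidable, and a supremum s of P is an upper bound such
-- that every y < s lies strictly below some element of P (classically, the
-- same as being the least upper bound).

record CompleteOrderedField : Set₁ where
  field
    orderedField : OrderedField
  open OrderedField orderedField public
  field
    complete : (P : Carrier → Set) → ∃ P → ∃ (IsUpperBound P) → ∃ (IsSupremum P)

module Real (R : CompleteOrderedField) where
  open CompleteOrderedField R public
  open IsDecTotalOrder isDecTotalOrder public
    using (_≟_; _≤?_; total; antisym; ≤-respˡ-≈; ≤-respʳ-≈)
    renaming (refl to ≤-refl; reflexive to ≤-reflexive; trans to ≤-trans)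
  open import Algebra.Properties.Semiring.Exp semiring public using (_^_)
  open import Algebra.Properties.Semiring.Mult semiring
    using () renaming (_×_ to _·_)
  open import Algebra.Properties.Ring ring using (-‿distribʳ-*)

  ℝ : Set
  ℝ = Carrier

  ι : ℕ → ℝ
  ι n = n · 1#

  +-monoˡ-≤ : ∀ x {y z} → y ≤ z → y + x ≤ z + x
  +-monoˡ-≤ x y≤z = ≤-respˡ-≈ (+-comm _ _) (≤-respʳ-≈ (+-comm _ _) (+-monoʳ-≤ x y≤z))

  x≤y⇒0≤y-x : ∀ {x y} → x ≤ y → 0# ≤ y - x
  x≤y⇒0≤y-x {x} x≤y = ≤-respˡ-≈ (-‿inverseʳ x) (+-monoˡ-≤ (- x) x≤y)

  y-x+x≈y : ∀ x y → (y - x) + x ≈ y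
  y-x+x≈y x y = ≈-trans (+-assoc _ _ _) (≈-trans (+-congˡ (-‿inverseˡ x)) (+-identityʳ y))

  0≤y-x⇒x≤y : ∀ {x y} → 0# ≤ y - x → x ≤ y
  0≤y-x⇒x≤y {x} {y} 0≤ =
    ≤-respˡ-≈ (+-identityˡ x) (≤-respʳ-≈ (y-x+x≈y x y) (+-monoˡ-≤ x 0≤))

  *-monoˡ-≤ : ∀ {x y z} → 0# ≤ x → y ≤ z → x * y ≤ x * z
  *-monoˡ-≤ {x} {y} {z} 0≤x y≤z = 0≤y-x⇒x≤y
    (≤-respʳ-≈ (≈-trans (distribˡ x z (- y)) (+-congˡ (≈-sym (-‿distribʳ-* x y))))
      (*-nonNeg 0≤x (x≤y⇒0≤y-x y≤z)))

  x*x-nonNeg : ∀ x → 0# ≤ x * x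
  x*x-nonNeg x with total 0# x
  ... | inj₁ 0≤x = *-nonNeg 0≤x 0≤x
  ... | inj₂ x≤0 = ≤-respʳ-≈ eq (*-nonNeg 0≤-x 0≤-x)
    where
    open import Algebra.Properties.Ring ring using (-‿distribˡ-*; -‿involutive)
    0≤-x : 0# ≤ - x
    0≤-x = ≤-respʳ-≈ (+-identityˡ _) (x≤y⇒0≤y-x x≤0)
    eq : - x * - x ≈ x * x
    eq = ≈-trans (≈-sym (-‿distribˡ-* x (- x)))
           (≈-trans (-‿cong (≈-sym (-‿distribʳ-* x x))) (-‿involutive _))

  0≤1 : 0# ≤ 1#
  0≤1 = ≤-respʳ-≈ (*-identityˡ 1#) (x*x-nonNeg 1#)

  x≤1+x : ∀ x → x ≤ 1# + x
  x≤1+x x = ≤-respˡ-≈ (+-identityˡ x) (+-monoˡ-≤ x 0≤1)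

  0≤ι : ∀ n → 0# ≤ ι n
  0≤ι zero    = ≤-refl
  0≤ι (suc n) = ≤-trans (0≤ι n) (x≤1+x (ι n))

  -- Square root

  SqrtSet : ℝ → ℝ → Set
  SqrtSet x y = y * y ≤ x

  abstract
    sqrt-complete : ∀ x → 0# ≤ x → ∃ (IsSupremum (SqrtSet x))
    sqrt-complete x 0≤x = complete _ (0# , ≤-respˡ-≈ (≈-sym (zeroˡ 0#)) 0≤x) (1# + x , ub)
      where
      ub : IsUpperBound (SqrtSet x) (1# + x)
      ub {y} yy≤x with total y (1# + x)
      ... | inj₁ y≤ = y≤
      ... | inj₂ ≤y = ≤-trans (≤-trans y≤yy yy≤x) (x≤1+x x)
        where
        1≤y : 1# ≤ y
        1≤y = ≤-trans (≤-respˡ-≈ (+-identityʳ 1#) (+-monoʳ-≤ 1# 0≤x)) ≤y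
        y≤yy : y ≤ y * y
        y≤yy = ≤-respˡ-≈ (*-identityʳ y) (*-monoˡ-≤ (≤-trans 0≤1 1≤y) 1≤y)

  sqrt : (x : ℝ) → 0# ≤ x → ℝ
  sqrt x 0≤x = proj₁ (sqrt-complete x 0≤x)

  -- Natural logarithm on [1, ∞): the largest y ≥ 0 with exp y ≤ x.  As the terms
  -- of the exponential series are nonnegative for y ≥ 0, exp y ≤ x says that
  -- all its partial sums are at most x.

  expSum : ℝ → ℕ → ℝ
  expSum y zero    = 0#
  expSum y (suc n) = expSum y n + y ^ n * ι (n !) ⁻¹

  LogSet : ℝ → ℝ → Set
  LogSet x y = 0# ≤ y × (∀ n → expSum y n ≤ x)

  abstract
    log-complete : ∀ x → 1# ≤ x → ∃ (IsSupremum (LogSet x))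
    log-complete x 1≤x = complete _ (0# , ≤-refl , sums) (x , ub)
      where
      1⁻¹≈1 : ι 1 ⁻¹ ≈ 1#
      1⁻¹≈1 = ≈-trans (≈-sym (*-identityˡ _))
        (≈-trans (*-congʳ (≈-sym (+-identityʳ 1#)))
          (*-inverseʳ (λ eq → 0≉1 (≈-sym (≈-trans (≈-sym (+-identityʳ 1#)) eq)))))

      expSum-0 : ∀ n → expSum 0# (suc n) ≈ 1#
      expSum-0 zero    = ≈-trans (+-identityˡ _) (≈-trans (*-identityˡ _) 1⁻¹≈1)
      expSum-0 (suc n) = ≈-trans
        (+-cong (expSum-0 n) (≈-trans (*-congʳ (zeroˡ _)) (zeroˡ _))) (+-identityʳ 1#)

      sums : ∀ n → expSum 0# n ≤ x
      sums zero    = ≤-trans 0≤1 1≤x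
      sums (suc n) = ≤-respˡ-≈ (≈-sym (expSum-0 n)) 1≤x

      expSum-2 : ∀ y → expSum y 2 ≈ 1# + y
      expSum-2 y = +-cong
        (≈-trans (+-identityˡ _) (≈-trans (*-identityˡ _) 1⁻¹≈1))
        (≈-trans (*-cong (*-identityʳ y) 1⁻¹≈1) (*-identityʳ y))

      ub : IsUpperBound (LogSet x) x
      ub {y} (_ , h) = ≤-trans (x≤1+x y) (≤-respˡ-≈ (expSum-2 y) (h 2))

  log : (x : ℝ) → 1# ≤ x → ℝ
  log x 1≤x = proj₁ (log-complete x 1≤x)

  abstract
    1≤x⁻¹ : ∀ {x} → 0# < x → x < 1# → 1# ≤ x ⁻¹
    1≤x⁻¹ {x} (0≤x , 0≉x) x<1 with total 1# (x ⁻¹)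
    ... | inj₁ 1≤ = 1≤
    ... | inj₂ ≤1 = ⊥-elim (<⇒≱ x<1
      (≤-respˡ-≈ (*-inverseʳ (0≉x ∘ ≈-sym)) (≤-respʳ-≈ (*-identityʳ x) (*-monoˡ-≤ 0≤x ≤1))))

  -- A nonempty set all of whose elements occur (up to ≈) in a finite list has a
  -- greatest element.

  greatest : (P : ℝ → Set) (l : List ℝ) → (∀ {x} → P x → ∃ λ y → y ∈ l × x ≈ y) →
             ∃ P → ∃ λ x → P x × (∀ {y} → P y → y ≤ x)
  greatest P l fin inh = proj₁ above-b , proj₁ (proj₂ above-b) ,
    λ Py → ≤-trans (proj₁ (proj₂ sup) Py) s≤x
    where
    bound : (l : List ℝ) → ∃ λ b → ∀ {y} → y ∈ l → y ≤ b
    bound []      = 0# , λ ()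
    bound (z ∷ l) with bound l
    ... | b , h with total z b
    ... | inj₁ z≤b = b , λ { (here refl) → z≤b ; (there y∈) → h y∈ }
    ... | inj₂ b≤z = z , λ { (here refl) → ≤-refl ; (there y∈) → ≤-trans (h y∈) b≤z }

    sup : ∃ (IsSupremum P)
    sup = complete P inh
      (proj₁ (bound l) , λ Px → let (y , y∈ , x≈y) = fin Px in
        ≤-respˡ-≈ (≈-sym x≈y) (proj₂ (bound l) y∈))

    s = proj₁ sup

    s-1<s : s - 1# < s
    s-1<s = ≰⇒> λ s≤s-1 → <⇒≱ (0≤1 , 0≉1)
      (≤-respˡ-≈ lhs (≤-respʳ-≈ (-‿inverseˡ s)
        (+-monoʳ-≤ (- s) (≤-respʳ-≈ (y-x+x≈y 1# s) (+-monoˡ-≤ 1# s≤s-1)))))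
      where
      lhs : - s + (s + 1#) ≈ 1#
      lhs = ≈-trans (≈-sym (+-assoc _ _ _)) (≈-trans (+-congʳ (-‿inverseˡ s)) (+-identityˡ 1#))

    below : (l : List ℝ) → ∃ λ b → b < s × (∀ {y} → y ∈ l → y < s → y ≤ b)
    below []      = s - 1# , s-1<s , λ ()
    below (z ∷ l) with below l
    ... | b , b<s , h with s ≤? z | total z b
    ... | yes s≤z | _        = b , b<s ,
      λ { (here refl) z<s → ⊥-elim (<⇒≱ z<s s≤z) ; (there y∈) y<s → h y∈ y<s }
    ... | no s≰z  | inj₁ z≤b = b , b<s ,
      λ { (here refl) _ → z≤b ; (there y∈) y<s → h y∈ y<s }
    ... | no s≰z  | inj₂ b≤z = z , ≰⇒> s≰z ,
      λ { (here refl) _ → ≤-refl ; (there y∈) y<s → ≤-trans (h y∈ y<s) b≤z }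

    b = proj₁ (below l)

    above-b : ∃ λ x → P x × b < x
    above-b = proj₂ (proj₂ sup) (proj₁ (proj₂ (below l)))

    s≤x : s ≤ proj₁ above-b
    s≤x with above-b
    ... | x , Px , b<x with s ≤? x
    ... | yes s≤x = s≤x
    ... | no  s≰x with fin Px
    ... | y , y∈ , x≈y = ⊥-elim (<⇒≱ b<x
      (≤-respˡ-≈ (≈-sym x≈y) (proj₂ (proj₂ (below l)) y∈ (proj₂ <-resp-≈ x≈y (≰⇒> s≰x)))))

------------------------------------------------------------------------
-- Graphs and copies

-- Finite simple graphs without isolated vertices

record Graph : Set₁ where
  field
    order      : ℕ
    Adj        : Rel (Fin order) 0ℓ
    adj?       : Decidable Adj
    symmetric  : Symmetric Adj
    loopless   : ∀ v → ¬ Adj v v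
    noIsolated : ∀ v → ∃ (Adj v)

K : (m : ℕ) → 2 ℕ.≤ m → Graph
K m 2≤m = record
  { order      = m
  ; Adj        = _≢_
  ; adj?       = λ u v → ¬? (u ≟ᶠ v)
  ; symmetric  = λ u≢v v≡u → u≢v (≡-sym v≡u)
  ; loopless   = λ _ v≢v → v≢v refl
  ; noIsolated = other 2≤m
  }
  where
  other : ∀ {m} → 2 ℕ.≤ m → (v : Fin m) → ∃ λ w → v ≢ w
  other (s≤s (s≤s _)) zero    = suc zero , λ ()
  other (s≤s (s≤s _)) (suc _) = zero , λ ()

-- The vertices of the board are the integers.  An unordered pair of vertices
-- is represented by (u , v) with u < v, and the graph built so far by the list
-- of its edges.

Pair : Set
Pair = ℤ × ℤ

Joined : List Pair → ℤ → ℤ → Set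
Joined G a b = (a , b) ∈ G ⊎ (b , a) ∈ G

-- The vector f stands for the map sending the vertex i to lookup f i.

IsCopy : (H : Graph) → List Pair → Vec ℤ (Graph.order H) → Set
IsCopy H G f =
  (∀ i j → lookup f i ≡ lookup f j → i ≡ j) ×
  (∀ i j → Graph.Adj H i j → Joined G (lookup f i) (lookup f j))

_≟ᵖ_ : (e e′ : Pair) → Dec (e ≡ e′)
_≟ᵖ_ = ≡-dec ℤ._≟_ ℤ._≟_

joined? : ∀ G a b → Dec (Joined G a b)
joined? G a b = ((a , b) ∈? G) ⊎-dec ((b , a) ∈? G)
  where open import Data.List.Membership.DecPropositional _≟ᵖ_ using (_∈?_)

isCopy? : ∀ H G f → Dec (IsCopy H G f)
isCopy? H G f =
  all? (λ i → all? λ j → (lookup f i ℤ.≟ lookup f j) →-dec (i ≟ᶠ j)) ×-dec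
  all? (λ i → all? λ j → Graph.adj? H i j →-dec joined? G (lookup f i) (lookup f j))

tuples : {A : Set} → List A → (n : ℕ) → List (Vec A n)
tuples xs zero    = [] ∷ []
tuples xs (suc n) = cartesianProductWith _∷_ xs (tuples xs n)

support : List Pair → List ℤ
support G = deduplicate ℤ._≟_ (map proj₁ G ++ map proj₂ G)

-- A copy takes values in the support because H has no isolated vertices; see
-- ∈-copies⁺, ∈-copies⁻ and copies-unique below.

copies : (H : Graph) → List Pair → List (Vec ℤ (Graph.order H))
copies H G = filter (isCopy? H G) (tuples (support G) (Graph.order H))

#copies : Graph → List Pair → ℕ
#copies H G = length (copies H G)

∈-tuples : {A : Set} {xs : List A} → ∀ {n} (f : Vec A n) →
           (∀ i → lookup f i ∈ xs) → f ∈ tuples xs n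
∈-tuples []      h = here refl
∈-tuples (x ∷ f) h = ∈-cartesianProductWith⁺ _∷_ (h zero) (∈-tuples f (h ∘ suc))

∈-copies⁺ : ∀ H G {f} → IsCopy H G f → f ∈ copies H G
∈-copies⁺ H G {f} cp = ∈-filter⁺ (isCopy? H G) (∈-tuples f inSupport) cp
  where
  inSupport : ∀ i → lookup f i ∈ support G
  inSupport i with Graph.noIsolated H i
  ... | j , i~j with proj₂ cp i j i~j
  ... | inj₁ e∈ = ∈-deduplicate⁺ ℤ._≟_ (∈-++⁺ˡ (∈-map⁺ proj₁ e∈))
  ... | inj₂ e∈ = ∈-deduplicate⁺ ℤ._≟_ (∈-++⁺ʳ (map proj₁ G) (∈-map⁺ proj₂ e∈))

∈-copies⁻ : ∀ H G {f} → f ∈ copies H G → IsCopy H G f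
∈-copies⁻ H G f∈ =
  proj₂ (∈-filter⁻ (isCopy? H G) {xs = tuples (support G) (Graph.order H)} f∈)

copies-unique : ∀ H G → Unique (copies H G)
copies-unique H G = unique-filter (isCopy? H G) (tuples-unique (Graph.order H))
  where
  tuples-unique : ∀ n → Unique (tuples (support G) n)
  tuples-unique zero    = [] ∷ []
  tuples-unique (suc n) = unique-product _∷_ ∷-injective
    (UniqueDec.deduplicate-! ℤ._≟_ (map proj₁ G ++ map proj₂ G)) (tuples-unique n)

length-tuples : {A : Set} (xs : List A) → ∀ n → length (tuples xs n) ≡ length xs ℕ.^ n
length-tuples xs zero    = refl
length-tuples xs (suc n) =
  ≡-trans (length-product xs) (cong (length xs ℕ.*_) (length-tuples xs n))
  where
  length-product : ∀ ys → length (cartesianProductWith _∷_ ys (tuples xs n)) ≡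
                          length ys ℕ.* length (tuples xs n)
  length-product []       = refl
  length-product (y ∷ ys) = ≡-trans (length-++ (map (y ∷_) (tuples xs n)))
    (cong₂ ℕ._+_ (length-map (y ∷_) (tuples xs n)) (length-product ys))

#copies-bound : ∀ H G {N} → length G ℕ.≤ N → #copies H G ℕ.≤ (N ℕ.+ N) ℕ.^ Graph.order H
#copies-bound H G {N} ≤N = begin
  #copies H G
    ≤⟨ length-filter (isCopy? H G) (tuples (support G) (Graph.order H)) ⟩
  length (tuples (support G) (Graph.order H))
    ≡⟨ length-tuples (support G) (Graph.order H) ⟩
  length (support G) ℕ.^ Graph.order H
    ≤⟨ ℕ.^-monoˡ-≤ (Graph.order H) support≤ ⟩
  (N ℕ.+ N) ℕ.^ Graph.order H ∎
  where
  open ℕ.≤-Reasoning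
  support≤ : length (support G) ℕ.≤ N ℕ.+ N
  support≤ = begin
    length (support G)
      ≤⟨ length-deduplicate ℤ._≟_ (map proj₁ G ++ map proj₂ G) ⟩
    length (map proj₁ G ++ map proj₂ G)
      ≡⟨ length-++ (map proj₁ G) ⟩
    length (map proj₁ G) ℕ.+ length (map proj₂ G)
      ≡⟨ cong₂ ℕ._+_ (length-map proj₁ G) (length-map proj₂ G) ⟩
    length G ℕ.+ length G
      ≤⟨ ℕ.+-mono-≤ ≤N ≤N ⟩
    N ℕ.+ N ∎

------------------------------------------------------------------------
-- The Subgraph Query Game

-- Strategy asked n: Builder's adaptive strategies for the next n turns when the
-- pairs in asked have already been queried.  In query u v _ _ S₁ S₀,
-- Builder goes on with S₁ if uv turns out to be an edge and with S₀ otherwise.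

data Strategy (asked : List Pair) : ℕ → Set where
  done  : Strategy asked 0
  query : ∀ {n} (u v : ℤ) → u <ᶻ v → (u , v) ∉ asked →
          (S₁ S₀ : Strategy ((u , v) ∷ asked) n) → Strategy asked (suc n)

-- Builder can always query further edges of a star.

star : ∀ {asked} (k n : ℕ) → All (λ e → proj₂ e <ᶻ + suc k) asked → Strategy asked n
star k zero    _  = done
star k (suc n) lt = query (+ 0) (+ suc k) (+<+ (s≤s z≤n)) fresh next next
  where
  fresh = λ e∈ → ℤ.<-irrefl refl (All.lookup lt e∈)
  next  = star (suc k) n
    (+<+ (ℕ.n<1+n (suc k)) ∷ All.map (λ l → ℤ.<-trans l (+<+ (ℕ.n<1+n (suc k)))) lt)

module Game (R : CompleteOrderedField) where
  open Real R public

  -- Expected final number of copies of H when the graph built so far is G and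
  -- each queried pair is an edge with probability p, independently.

  expected : Graph → ℝ → List Pair → ∀ {asked n} → Strategy asked n → ℝ
  expected H p G done                     = ι (#copies H G)
  expected H p G (query u v _ _ S₁ S₀) =
    p * expected H p ((u , v) ∷ G) S₁ + (1# - p) * expected H p G S₀

  value : Graph → ℝ → ∀ {N} → Strategy [] N → ℝ
  value H p = expected H p []

  abstract
    optimal : ∀ H p N → ∃ λ (S : Strategy [] N) →
              ∀ (S′ : Strategy [] N) → value H p S′ ≤ value H p S
    optimal H p N with greatest IsValue (values N) isValue⇒∈ (_ , star 0 N [] , refl)
      where
      IsValue : ℝ → Set
      IsValue x = ∃ λ (S : Strategy [] N) → value H p S ≡ x

      values : ℕ → List ℝ
      values zero    = map ι (upTo (suc ((N ℕ.+ N) ℕ.^ Graph.order H)))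
      values (suc n) =
        cartesianProductWith (λ a b → p * a + (1# - p) * b) (values n) (values n)

      expected∈ : ∀ {asked n} G (S : Strategy asked n) → length G ℕ.+ n ℕ.≤ N →
                  expected H p G S ∈ values n
      expected∈ G done ≤N = ∈-map⁺ ι (∈-upTo⁺
        (s≤s (#copies-bound H G (subst (ℕ._≤ N) (ℕ.+-identityʳ (length G)) ≤N))))
      expected∈ {n = suc n} G (query u v _ _ S₁ S₀) ≤N =
        ∈-cartesianProductWith⁺ (λ a b → p * a + (1# - p) * b)
          (expected∈ ((u , v) ∷ G) S₁ 1+≤N)
          (expected∈ G S₀ (ℕ.≤-trans (ℕ.n≤1+n _) 1+≤N))
        where
        1+≤N : suc (length G) ℕ.+ n ℕ.≤ N
        1+≤N = subst (ℕ._≤ N) (ℕ.+-suc (length G) n) ≤N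

      isValue⇒∈ : ∀ {x} → IsValue x → ∃ λ y → y ∈ values N × x ≈ y
      isValue⇒∈ {x} (S , eq) =
        x , subst (_∈ values N) eq (expected∈ [] S ℕ.≤-refl) , ≈-refl
    ... | _ , (S , refl) , max = S , λ S′ → max (S′ , refl)

  -- The maximum expected number of copies of H built in N turns.

  t : Graph → ℝ → ℕ → ℝ
  t H p N = value H p (proj₁ (optimal H p N))

{-# OPTIONS --safe #-}

-- Write s = √(2N).  Let G ⊆ Q be the graphs of built and of queried pairs after N
-- turns, and X = G − pQ.  Whatever the strategy, X is a sum of martingale differences.
-- Replacing the edges of K_m in the count of K_m in G by pQ + X one at a time, an error
-- term contains X on one edge of a triangle whose other edges are in Q; by
-- Cauchy–Schwarz it is at most κ(X)^¼ times the number of K_{m−1} in Q, which is at most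
-- s^(m−1), where κ(X) = ∑_{y,y′} (∑_x X(x,y) X(x,y′))².  In 𝔼 κ only the degenerate terms
-- survive, so 𝔼 κ = O(ND) provided that noise is only collected at vertices of degree at
-- most D; this is o(s⁴) for D = O(s).  The O(s²/D) vertices of larger degree are in
-- O(s²/D) s^(m−1) copies of K_m.  Thus #K_m(G) ≈ p^(m choose 2) #K_m(Q), where
-- #K_m(Q) ≤ s^m, and Builder attains this by querying all pairs of ⌊s⌋ vertices.  For
-- K₂ there is no triangle, but then the error is exactly centred.

module Submission where

open import Defs
open import Algebra.Bundles using (RawRing)
import Algebra.Solver.Ring
open import Algebra.Solver.Ring.AlmostCommutativeRing
  using (AlmostCommutativeRing; fromCommutativeRing; _-Raw-AlmostCommutative⟶_)
open import Data.Bool.Base using (Bool; true; false; _∧_; _∨_; not)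
open import Data.Bool.Properties using (∨-comm)
open import Data.Empty using (⊥-elim)
open import Data.Fin.Base using (zero; suc)
open import Data.Fin.Properties using (suc-injective) renaming (_≟_ to _≟ᶠ_)
open import Data.Integer.Base as ℤ using (ℤ; +_; -[1+_]; _⊖_)
import Data.Integer.Properties as ℤ
open import Data.List.Base
  using (List; []; _∷_; _++_; map; length; cartesianProductWith; upTo; deduplicate)
import Data.List.Membership.DecPropositional as DecMembership
open import Data.List.Membership.Propositional using (_∈_; _∉_)
open import Data.List.Membership.Propositional.Properties
  using ( ∈-map⁺; ∈-map⁻; ∈-++⁺ˡ; ∈-++⁺ʳ; ∈-++⁻; ∈-∃++; ∈-upTo⁺; ∈-upTo⁻
        ; ∈-deduplicate⁺)
open import Data.List.Properties using (length-map; length-++; length-upTo)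
open import Data.List.Relation.Unary.All as All using (All; []; _∷_)
import Data.List.Relation.Unary.All.Properties as All
open import Data.List.Relation.Unary.AllPairs using ([]; _∷_)
open import Data.List.Relation.Unary.Any using (here; there)
import Data.List.Relation.Unary.Unique.DecPropositional.Properties as UniqueDec
open import Data.List.Relation.Unary.Unique.Propositional using (Unique)
import Data.List.Relation.Unary.Unique.Propositional.Properties as Unique
open import Data.Maybe.Base using (Maybe; just; nothing)
open import Data.Nat.Base as ℕ using (ℕ; zero; suc; _∸_; z≤n; s≤s; _!)
open import Data.Nat.Combinatorics using (_C_; nC1≡n; nCk+nC[k+1]≡[n+1]C[k+1])
import Data.Nat.Properties as ℕ
open import Data.Nat.Solver using (module +-*-Solver)
open import Data.Product.Base using (∃; _×_; _,_; proj₁; proj₂)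
open import Data.Sum.Base using (_⊎_; inj₁; inj₂)
open import Data.Vec.Base using (Vec; []; _∷_; lookup)
open import Data.Vec.Properties using (∷-injective)
open import Function.Base using (_∘_)
open import Relation.Binary.Definitions using (tri<; tri≈; tri>)
open import Relation.Binary.PropositionalEquality as ≡ using (_≡_; _≢_)
open import Relation.Binary.Bundles using (DecTotalOrder)
open import Relation.Nullary using (¬_; Dec; yes; no; does; contradiction)
open import Relation.Nullary.Decidable using (_×-dec_)

open DecMembership _≟ᵖ_ using (_∈?_)
open +-*-Solver using ()
  renaming (solve to ℕ-solve; con to ℕ-con; _:+_ to _⊕_; _:*_ to _⊗_; _:=_ to _⊜_)

-- Builder's adaptivity makes the entries of X dependent, so only one-step conditional means are
-- under control. `κ` suits this: it is a polynomial in X whose mean change under one query can be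
-- computed exactly, since the noise of a fresh pair is 0, its two possible jumps have mean 0, and
-- only the row of one end and the column of the other end enter. To make a query a rank-one change,
-- the noise is kept one-sided, on u < v; the symmetric X is its sum with the transpose, at the cost
-- of a factor 2.
--
-- No event and no probability occurs. On every outcome the deviation is at most s^m (c + κ r) with
-- c small: by the box inequality when κ is below the threshold 1/r, trivially otherwise. The bound
-- is affine in κ, so 𝔼 κ alone decides (Markov's inequality in disguise).
--
-- Degrees are known only at the end, whereas discarding noise must not look ahead. Hence `thin`
-- judges a query by the noise collected before it, which the final degrees dominate. The threshold
-- is D = ℓ s with ℓ a large constant: vertices of high degree cost about m/ℓ, while 𝔼 κ / s⁴ is of
-- order ℓ/s.

infix 4 _⇒_ _⊆_ _⊑_
infixl 6 _⊓_

-- Vertex sets and relations are Boolean-valued so that indicators turn them into real weights;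
-- inclusion is then an implication between truth values.
_⇒_ : Bool → Bool → Set
b ⇒ c = b ≡ true → c ≡ true

_⊆_ : (a q : ℤ → Bool) → Set
a ⊆ q = ∀ x → a x ⇒ q x

_⊑_ : (v w : ℤ → ℤ → Bool) → Set
v ⊑ w = ∀ x y → v x y ⇒ w x y

_⊓_ : (a b : ℤ → Bool) → ℤ → Bool
(a ⊓ b) x = a x ∧ b x

∧-⇒ : ∀ {b c b′ c′} → b ⇒ b′ → c ⇒ c′ → b ∧ c ⇒ b′ ∧ c′
∧-⇒ {true}  f g eq rewrite f ≡.refl = g eq
∧-⇒ {false} f g ()

⊓-⊆ : ∀ {a b a′ b′} → a ⊆ a′ → b ⊆ b′ → a ⊓ b ⊆ a′ ⊓ b′
⊓-⊆ f g x = ∧-⇒ (f x) (g x)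

∧-rotate : ∀ a b c → (a ∧ b) ∧ c ≡ (a ∧ c) ∧ b
∧-rotate false b     c     = ≡.refl
∧-rotate true  false false = ≡.refl
∧-rotate true  false true  = ≡.refl
∧-rotate true  true  false = ≡.refl
∧-rotate true  true  true  = ≡.refl

-- The binomial coefficient in the form in which it grows when a vertex with `k` new edges is added
-- to a clique.
tri : ℕ → ℕ
tri zero    = 0
tri (suc k) = k ℕ.+ tri k

-- Histories of the game

History : Set
History = List (Pair × Bool)

asked built : History → List Pair
asked = map proj₁
built []                = []
built ((e , true)  ∷ h) = e ∷ built h
built ((e , false) ∷ h) = built h

-- A recursive test, so that the effect of one more pair is explicit: its indicator is a product of
-- two Kronecker deltas, a rank-one matrix.
mem : List Pair → ℤ → ℤ → Bool
mem []            x y = false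
mem ((u , v) ∷ L) x y = (does (x ℤ.≟ u) ∧ does (y ℤ.≟ v)) ∨ mem L x y

mem⇒∈ : ∀ L {x y} → mem L x y ≡ true → (x , y) ∈ L
mem⇒∈ ((u , v) ∷ L) {x} {y} eq with x ℤ.≟ u | y ℤ.≟ v
... | yes ≡.refl | yes ≡.refl = here ≡.refl
... | yes _      | no _       = there (mem⇒∈ L eq)
... | no _       | yes _      = there (mem⇒∈ L eq)
... | no _       | no _       = there (mem⇒∈ L eq)

∈⇒mem : ∀ {L x y} → (x , y) ∈ L → mem L x y ≡ true
∈⇒mem {(u , v) ∷ L} {x} {y} e∈ with x ℤ.≟ u | y ℤ.≟ v | e∈
... | yes _  | yes _  | _           = ≡.refl
... | no x≢u | _      | here ≡.refl = ⊥-elim (x≢u ≡.refl)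
... | _      | no y≢v | here ≡.refl = ⊥-elim (y≢v ≡.refl)
... | yes _  | no _   | there e∈L   = ∈⇒mem e∈L
... | no _   | yes _  | there e∈L   = ∈⇒mem e∈L
... | no _   | no _   | there e∈L   = ∈⇒mem e∈L

∉⇒mem : ∀ {L x y} → (x , y) ∉ L → mem L x y ≡ false
∉⇒mem {L} {x} {y} e∉ with mem L x y in eq
... | true  = ⊥-elim (e∉ (mem⇒∈ L eq))
... | false = ≡.refl

built⊆asked : ∀ h {e} → e ∈ built h → e ∈ asked h
built⊆asked ((e , true)  ∷ h) (here eq)  = here eq
built⊆asked ((e , true)  ∷ h) (there e∈) = there (built⊆asked h e∈)
built⊆asked ((e , false) ∷ h) e∈         = there (built⊆asked h e∈)

adj : List Pair → ℤ → ℤ → Bool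
adj L x y = mem L x y ∨ mem L y x

adj-sym : ∀ L x y → adj L x y ≡ adj L y x
adj-sym L x y = ∨-comm (mem L x y) (mem L y x)

∨-⇒ : ∀ {b c b′ c′} → b ⇒ b′ → c ⇒ c′ → b ∨ c ⇒ b′ ∨ c′
∨-⇒ {true}         f g _  rewrite f ≡.refl = ≡.refl
∨-⇒ {false} {b′ = true}  f g _  = ≡.refl
∨-⇒ {false} {b′ = false} f g eq = g eq

mem-mono : ∀ {L M} → (∀ {e} → e ∈ L → e ∈ M) → mem L ⊑ mem M
mem-mono {L} L⊆M x y eq = ∈⇒mem (L⊆M (mem⇒∈ L eq))

adj-mono : ∀ {L M} → (∀ {e} → e ∈ L → e ∈ M) → adj L ⊑ adj M
adj-mono {L} L⊆M x y = ∨-⇒ {mem L x y} (mem-mono {L} L⊆M x y) (mem-mono {L} L⊆M y x)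

Increasing : Pair → Set
Increasing (u , v) = u ℤ.< v

Valid : History → Set
Valid h = All Increasing (asked h)

-- Cliques as Boolean predicates on tuples

clique : (ℤ → ℤ → Bool) → (ℤ → Bool) → ∀ {k} → Vec ℤ k → Bool
clique w a []      = true
clique w a (x ∷ f) = a x ∧ clique w (a ⊓ w x) f

clique-vertices : ∀ w a {k} (f : Vec ℤ k) → clique w a f ≡ true → ∀ i → a (lookup f i) ≡ true
clique-vertices w a (x ∷ f) eq i with a x in ax
clique-vertices w a (x ∷ f) eq zero    | true = ax
clique-vertices w a (x ∷ f) eq (suc i) | true with a (lookup f i) | clique-vertices w (a ⊓ w x) f eq i
... | true | _ = ≡.refl

clique-edges : ∀ w → (∀ x y → w x y ≡ w y x) → ∀ a {k} (f : Vec ℤ k) → clique w a f ≡ true →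
               ∀ i j → i ≢ j → w (lookup f i) (lookup f j) ≡ true
clique-edges w w-sym a (x ∷ f) eq i j i≢j with a x
clique-edges w w-sym a (x ∷ f) eq zero    zero    i≢j | true = ⊥-elim (i≢j ≡.refl)
clique-edges w w-sym a (x ∷ f) eq zero    (suc j) i≢j | true
  with a (lookup f j) | clique-vertices w (a ⊓ w x) f eq j
... | true | h = h
clique-edges w w-sym a (x ∷ f) eq (suc i) zero    i≢j | true
  with a (lookup f i) | clique-vertices w (a ⊓ w x) f eq i
... | true | h = ≡.trans (w-sym _ _) h
clique-edges w w-sym a (x ∷ f) eq (suc i) (suc j) i≢j | true =
  clique-edges w w-sym (a ⊓ w x) f eq i j (i≢j ∘ ≡.cong suc)

clique⁺ : ∀ w a {k} (f : Vec ℤ k) → (∀ i → a (lookup f i) ≡ true) →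
          (∀ i j → i ≢ j → w (lookup f i) (lookup f j) ≡ true) → clique w a f ≡ true
clique⁺ w a []      vs es = ≡.refl
clique⁺ w a (x ∷ f) vs es rewrite vs zero = clique⁺ w (a ⊓ w x) f
  (λ i → ≡.cong₂ _∧_ (vs (suc i)) (es zero (suc i) λ ()))
  (λ i j i≢j → es (suc i) (suc j) (i≢j ∘ suc-injective))

adj⇒Joined : ∀ L {x y} → adj L x y ≡ true → Joined L x y
adj⇒Joined L {x} {y} eq with mem L x y in eqm
... | true  = inj₁ (mem⇒∈ L eqm)
... | false = inj₂ (mem⇒∈ L eq)

Joined⇒adj : ∀ L {x y} → Joined L x y → adj L x y ≡ true
Joined⇒adj L {x} {y} (inj₁ e∈) rewrite ∈⇒mem e∈ = ≡.refl
Joined⇒adj L {x} {y} (inj₂ e∈) rewrite adj-sym L x y | ∈⇒mem e∈ = ≡.refl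

-- Querying a complete graph


Below : ℕ → Pair → Set
Below k (u , v) = v ℤ.< + suc k

-- A strategy must use exactly `n` turns without repeating a query: a pair already asked is skipped
-- at no cost, and `star` spends the turns left over. `Below k` is the invariant under which the
-- pairs of `star k` are fresh.
follow : ∀ {L₀} (L : List Pair) (k n : ℕ) → All Increasing L → All (Below k) L → All (Below k) L₀ → Strategy L₀ n
follow []            k n       _         _          below = star k n below
follow (_ ∷ L)       k zero    _         _          _     = done
follow {L₀} ((u , v) ∷ L) k (suc n) (u<v ∷ inc) (v<k ∷ bel) below with (u , v) ∈? L₀
... | yes _     = follow L k (suc n) inc bel below
... | no  fresh = query u v u<v fresh next next
  where
  next : Strategy ((u , v) ∷ L₀) n
  next = follow L k n inc bel (v<k ∷ below)

complete-pairs : ℕ → List Pair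
complete-pairs zero    = []
complete-pairs (suc n) = map (λ i → (+ i , + n)) (upTo n) ++ complete-pairs n

length-complete-pairs : ∀ n → length (complete-pairs n) ≡ tri n
length-complete-pairs zero    = ≡.refl
length-complete-pairs (suc n) = ≡.trans (length-++ (map (λ i → (+ i , + n)) (upTo n)))
  (≡.cong₂ ℕ._+_ (≡.trans (length-map _ (upTo n)) (length-upTo n)) (length-complete-pairs n))

complete-pairs-increasing : ∀ n → All Increasing (complete-pairs n)
complete-pairs-increasing zero    = []
complete-pairs-increasing (suc n) = All.++⁺
  (All.map⁺ (All.tabulate λ i∈ → ℤ.+<+ (∈-upTo⁻ i∈))) (complete-pairs-increasing n)

complete-pairs-below : ∀ n {k} → n ℕ.≤ k → All (Below k) (complete-pairs n)
complete-pairs-below zero    _   = []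
complete-pairs-below (suc n) n<k = All.++⁺
  (All.map⁺ (All.tabulate λ _ → ℤ.+<+ (s≤s (ℕ.<⇒≤ n<k)))) (complete-pairs-below n (ℕ.<⇒≤ n<k))

∈-complete-pairs : ∀ {n i j} → i ℕ.< j → j ℕ.< n → (+ i , + j) ∈ complete-pairs n
∈-complete-pairs {suc n} {i} {j} i<j (s≤s j≤n) with j ℕ.≟ n
... | yes ≡.refl = ∈-++⁺ˡ (∈-map⁺ (λ i → (+ i , + n)) (∈-upTo⁺ i<j))
... | no  j≢n    = ∈-++⁺ʳ (map (λ i → (+ i , + n)) (upTo n)) (∈-complete-pairs i<j (ℕ.≤∧≢⇒< j≤n j≢n))

query-complete : (n N : ℕ) → Strategy [] N
query-complete n N = follow (complete-pairs n) n N (complete-pairs-increasing n)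
  (complete-pairs-below n ℕ.≤-refl) []

initial : ℕ → List ℤ
initial n = map +_ (upTo n)

unique-initial : ∀ n → Unique (initial n)
unique-initial n = Unique.map⁺ ℤ.+-injective (Unique.upTo⁺ n)

length-initial : ∀ n → length (initial n) ≡ n
length-initial n = ≡.trans (length-map +_ (upTo n)) (length-upTo n)

adj-complete : ∀ {n L} → (∀ {e} → e ∈ complete-pairs n → e ∈ L) →
               ∀ {x y} → x ∈ initial n → y ∈ initial n → x ≢ y → adj L x y ≡ true
adj-complete {n} {L} ⊆L x∈ y∈ x≢y with ∈-map⁻ +_ x∈ | ∈-map⁻ +_ y∈
... | i , i∈ , ≡.refl | j , j∈ , ≡.refl with ℕ.<-cmp i j
... | tri< i<j _ _ = Joined⇒adj L (inj₁ (⊆L (∈-complete-pairs i<j (∈-upTo⁻ j∈))))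
... | tri≈ _ i≡j _ = ⊥-elim (x≢y (≡.cong +_ i≡j))
... | tri> _ _ j<i = Joined⇒adj L (inj₂ (⊆L (∈-complete-pairs j<i (∈-upTo⁻ i∈))))

-- Arithmetic of the number of pairs

tri≡C2 : ∀ m → tri m ≡ m C 2
tri≡C2 zero    = ≡.refl
tri≡C2 (suc m) = ≡.trans (≡.cong₂ ℕ._+_ (≡.sym (nC1≡n m)) (tri≡C2 m)) (nCk+nC[k+1]≡[n+1]C[k+1] m 1)

tri+tri+n : ∀ n → (tri n ℕ.+ tri n) ℕ.+ n ≡ n ℕ.* n
tri+tri+n zero    = ≡.refl
tri+tri+n (suc n) = ≡.trans
  (ℕ-solve 2 (λ n t → ((n ⊕ t) ⊕ (n ⊕ t)) ⊕ (ℕ-con 1 ⊕ n) ⊜ (ℕ-con 1 ⊕ (n ⊕ n)) ⊕ ((t ⊕ t) ⊕ n)) ≡.refl n (tri n))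
  (≡.trans (≡.cong ((1 ℕ.+ (n ℕ.+ n)) ℕ.+_) (tri+tri+n n))
    (ℕ-solve 1 (λ n → (ℕ-con 1 ⊕ (n ⊕ n)) ⊕ n ⊗ n ⊜ (ℕ-con 1 ⊕ n) ⊗ (ℕ-con 1 ⊕ n)) ≡.refl n))

-- Since 2 `tri n` ≤ n², all pairs of ⌊√(2N)⌋ vertices fit into N queries.
tri≤ : ∀ {n N} → n ℕ.* n ℕ.≤ N ℕ.+ N → tri n ℕ.≤ N
tri≤ {n} {N} nn≤2N with tri n ℕ.≤? N
... | yes ≤N = ≤N
... | no  ≰N = contradiction
  (ℕ.≤-trans (ℕ.+-mono-≤ (ℕ.<⇒≤ N<) ℕ.≤-refl) (ℕ.≤-trans (ℕ.≤-trans (ℕ.m≤m+n _ n) (ℕ.≤-reflexive (tri+tri+n n))) nn≤2N))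
  (ℕ.<⇒≱ (ℕ.+-monoʳ-< N N<))
  where
  N< = ℕ.≰⇒> ≰N

natural-sqrt : ∀ M → ∃ λ n → n ℕ.* n ℕ.≤ M × M ℕ.≤ suc n ℕ.* suc n
natural-sqrt zero = 0 , z≤n , z≤n
natural-sqrt (suc M) with natural-sqrt M
... | n , nn≤M , M≤ with suc M ℕ.≤? suc n ℕ.* suc n
... | yes M<  = n , ℕ.m≤n⇒m≤1+n nn≤M , M<
... | no  M≮  = suc n , ℕ.m≤n⇒m≤1+n (ℕ.≤-pred (ℕ.≰⇒> M≮)) ,
  ℕ.≤-trans (s≤s M≤) (ℕ.*-mono-< {suc n} (ℕ.n<1+n (suc n)) (ℕ.n<1+n (suc n)))

≥2-cases : ∀ {m} → 2 ℕ.≤ m → 3 ℕ.≤ m ⊎ m ≡ 2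
≥2-cases {m} 2≤m with 3 ℕ.≤? m
... | yes 3≤m = inj₁ 3≤m
... | no  3≰m = inj₂ (ℕ.≤-antisym (ℕ.≤-pred (ℕ.≰⇒> 3≰m)) 2≤m)

module CliqueGame (R : CompleteOrderedField) where
  open Game R
  open import Algebra.Properties.Ring ring using (-‿distribˡ-*; -‿distribʳ-*; -‿+-comm; -‿involutive; -0#≈0#)
  open import Algebra.Properties.Semiring.Mult semiring
    using (×-homo-+; ×1-homo-*)
  open import Algebra.Properties.Semiring.Mult.TCOptimised semiring
    using (×ᵤ≈×) renaming (_×_ to _×′_)
  open import Algebra.Properties.Semiring.Exp semiring using (^-homo-*)
  open import Relation.Binary.Reasoning.PartialOrder (DecTotalOrder.poset decTotalOrder)

  -- The ring solver with integer coefficients: the real numbers themselves do not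
  -- compute, so cancellation must be decided on ℤ.

  ⟦_⟧ᶻ : ℤ → ℝ
  ⟦ + n      ⟧ᶻ = n ×′ 1#
  ⟦ -[1+ n ] ⟧ᶻ = - (suc n ×′ 1#)

  private
    -- Coefficients are interpreted by the optimised multiple `×′`, for which `1 ×′ 1#` reduces to
    -- `1#`, so that `con (+ 1)` is `1#` definitionally. The homomorphism laws are transferred from
    -- the plain multiple `ι`.
    ι≈ : ∀ n → ι n ≈ n ×′ 1#
    ι≈ n = ×ᵤ≈× n 1#

    ι⊖ : ∀ m n → ⟦ m ⊖ n ⟧ᶻ ≈ ι m - ι n
    ι⊖ m zero = begin-equality
      m ×′ 1#     ≈⟨ ι≈ m ⟨
      ι m         ≈⟨ +-identityʳ _ ⟨
      ι m + 0#    ≈⟨ +-congˡ -0#≈0# ⟨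
      ι m - 0#    ∎
    ι⊖ zero (suc n) = begin-equality
      - (suc n ×′ 1#)  ≈⟨ -‿cong (ι≈ (suc n)) ⟨
      - ι (suc n)      ≈⟨ +-identityˡ _ ⟨
      0# - ι (suc n)   ∎
    ι⊖ (suc m) (suc n) = begin-equality
      ⟦ suc m ⊖ suc n ⟧ᶻ           ≡⟨ ≡.cong ⟦_⟧ᶻ (ℤ.[1+m]⊖[1+n]≡m⊖n m n) ⟩
      ⟦ m ⊖ n ⟧ᶻ                   ≈⟨ ι⊖ m n ⟩
      ι m - ι n                    ≈⟨ +-congʳ (+-identityʳ _) ⟨
      (ι m + 0#) - ι n             ≈⟨ +-congʳ (+-congˡ (-‿inverseʳ 1#)) ⟨
      (ι m + (1# - 1#)) - ι n      ≈⟨ +-congʳ (+-assoc _ _ _) ⟨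
      ((ι m + 1#) - 1#) - ι n      ≈⟨ +-assoc _ _ _ ⟩
      (ι m + 1#) + (- 1# - ι n)    ≈⟨ +-cong (+-comm _ _) (-‿+-comm 1# (ι n)) ⟩
      ι (suc m) - ι (suc n)        ∎

    ι× : ∀ m n → (m ℕ.* n) ×′ 1# ≈ (m ×′ 1#) * (n ×′ 1#)
    ι× m n = begin-equality
      (m ℕ.* n) ×′ 1#            ≈⟨ ι≈ (m ℕ.* n) ⟨
      ι (m ℕ.* n)                ≈⟨ ×1-homo-* m n ⟩
      ι m * ι n                  ≈⟨ *-cong (ι≈ m) (ι≈ n) ⟩
      (m ×′ 1#) * (n ×′ 1#)      ∎

    ⟦⟧-neg : ∀ i → ⟦ ℤ.- i ⟧ᶻ ≈ - ⟦ i ⟧ᶻ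
    ⟦⟧-neg (+ zero)  = ≈-sym -0#≈0#
    ⟦⟧-neg (+ suc n) = ≈-refl
    ⟦⟧-neg -[1+ n ]  = ≈-sym (-‿involutive _)

    ⟦⟧-+ : ∀ i j → ⟦ i ℤ.+ j ⟧ᶻ ≈ ⟦ i ⟧ᶻ + ⟦ j ⟧ᶻ
    ⟦⟧-+ (+ m) (+ n) = begin-equality
      (m ℕ.+ n) ×′ 1#            ≈⟨ ι≈ (m ℕ.+ n) ⟨
      ι (m ℕ.+ n)                ≈⟨ ×-homo-+ 1# m n ⟩
      ι m + ι n                  ≈⟨ +-cong (ι≈ m) (ι≈ n) ⟩
      (m ×′ 1#) + (n ×′ 1#)      ∎
    ⟦⟧-+ (+ m) -[1+ n ] = ≈-trans (ι⊖ m (suc n)) (+-cong (ι≈ m) (-‿cong (ι≈ (suc n))))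
    ⟦⟧-+ -[1+ m ] (+ n) = ≈-trans (ι⊖ n (suc m))
      (≈-trans (+-comm _ _) (+-cong (-‿cong (ι≈ (suc m))) (ι≈ n)))
    ⟦⟧-+ -[1+ m ] -[1+ n ] = begin-equality
      - (suc (suc (m ℕ.+ n)) ×′ 1#)            ≈⟨ -‿cong (ι≈ (2 ℕ.+ (m ℕ.+ n))) ⟨
      - ι (suc (suc (m ℕ.+ n)))                ≡⟨ ≡.cong (λ k → - ι (suc k)) (ℕ.+-suc m n) ⟨
      - ι (suc m ℕ.+ suc n)                    ≈⟨ -‿cong (×-homo-+ 1# (suc m) (suc n)) ⟩
      - (ι (suc m) + ι (suc n))                ≈⟨ -‿+-comm _ _ ⟨
      - ι (suc m) - ι (suc n)                  ≈⟨ +-cong (-‿cong (ι≈ (suc m))) (-‿cong (ι≈ (suc n))) ⟩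
      - (suc m ×′ 1#) - (suc n ×′ 1#)          ∎

    ⟦⟧-*₊ : ∀ m j → ⟦ + m ℤ.* j ⟧ᶻ ≈ ⟦ + m ⟧ᶻ * ⟦ j ⟧ᶻ
    ⟦⟧-*₊ m (+ n) = ≈-trans (reflexive (≡.cong ⟦_⟧ᶻ (≡.sym (ℤ.pos-* m n)))) (ι× m n)
    ⟦⟧-*₊ m -[1+ n ] = begin-equality
      ⟦ + m ℤ.* -[1+ n ] ⟧ᶻ              ≡⟨ ≡.cong ⟦_⟧ᶻ (ℤ.neg-distribʳ-* (+ m) (+ suc n)) ⟨
      ⟦ ℤ.- (+ m ℤ.* + suc n) ⟧ᶻ         ≈⟨ ⟦⟧-neg (+ m ℤ.* + suc n) ⟩
      - ⟦ + m ℤ.* + suc n ⟧ᶻ             ≡⟨ ≡.cong (λ i → - ⟦ i ⟧ᶻ) (ℤ.pos-* m (suc n)) ⟨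
      - ((m ℕ.* suc n) ×′ 1#)            ≈⟨ -‿cong (ι× m (suc n)) ⟩
      - ((m ×′ 1#) * (suc n ×′ 1#))      ≈⟨ -‿distribʳ-* _ _ ⟩
      (m ×′ 1#) * - (suc n ×′ 1#)        ∎

    ⟦⟧-* : ∀ i j → ⟦ i ℤ.* j ⟧ᶻ ≈ ⟦ i ⟧ᶻ * ⟦ j ⟧ᶻ
    ⟦⟧-* (+ m) j = ⟦⟧-*₊ m j
    ⟦⟧-* -[1+ m ] j = begin-equality
      ⟦ -[1+ m ] ℤ.* j ⟧ᶻ            ≡⟨ ≡.cong ⟦_⟧ᶻ (ℤ.neg-distribˡ-* (+ suc m) j) ⟨
      ⟦ ℤ.- (+ suc m ℤ.* j) ⟧ᶻ       ≈⟨ ⟦⟧-neg (+ suc m ℤ.* j) ⟩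
      - ⟦ + suc m ℤ.* j ⟧ᶻ           ≈⟨ -‿cong (⟦⟧-*₊ (suc m) j) ⟩
      - ((suc m ×′ 1#) * ⟦ j ⟧ᶻ)     ≈⟨ -‿distribˡ-* _ _ ⟩
      - (suc m ×′ 1#) * ⟦ j ⟧ᶻ       ∎

    acr : AlmostCommutativeRing _ _
    acr = fromCommutativeRing commutativeRing

    ℤ-raw : RawRing _ _
    ℤ-raw = record
      { Carrier = ℤ ; _≈_ = _≡_ ; _+_ = ℤ._+_ ; _*_ = ℤ._*_ ; -_ = ℤ.-_ ; 0# = + 0 ; 1# = + 1 }

    ℤ⟶ℝ : ℤ-raw -Raw-AlmostCommutative⟶ acr
    ℤ⟶ℝ = record
      { ⟦_⟧ = ⟦_⟧ᶻ ; +-homo = ⟦⟧-+ ; *-homo = ⟦⟧-* ; -‿homo = ⟦⟧-neg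
      ; 0-homo = ≈-refl ; 1-homo = ≈-refl }

    coeff≟ : ∀ i j → Maybe (⟦ i ⟧ᶻ ≈ ⟦ j ⟧ᶻ)
    coeff≟ i j with i ℤ.≟ j
    ... | yes eq = just (reflexive (≡.cong ⟦_⟧ᶻ eq))
    ... | no  _  = nothing

  open Algebra.Solver.Ring ℤ-raw acr ℤ⟶ℝ coeff≟ using (solve; _:=_; _:+_; _:*_; _:-_; :-_; con)

  -- Ordered fields

  +-mono-≤ : ∀ {a b c d} → a ≤ b → c ≤ d → a + c ≤ b + d
  +-mono-≤ {a} {b} {c} {d} a≤b c≤d = ≤-trans (+-monoʳ-≤ a c≤d) (+-monoˡ-≤ d a≤b)

  *-monoʳ-≤ : ∀ {x y z} → 0# ≤ x → y ≤ z → y * x ≤ z * x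
  *-monoʳ-≤ {x} {y} {z} 0≤x y≤z = begin
    y * x  ≈⟨ *-comm y x ⟩
    x * y  ≤⟨ *-monoˡ-≤ 0≤x y≤z ⟩
    x * z  ≈⟨ *-comm x z ⟩
    z * x  ∎

  *-mono-≤ : ∀ {a b c d} → 0# ≤ a → 0# ≤ d → a ≤ b → c ≤ d → a * c ≤ b * d
  *-mono-≤ 0≤a 0≤d a≤b c≤d = ≤-trans (*-monoˡ-≤ 0≤a c≤d) (*-monoʳ-≤ 0≤d a≤b)

  +-nonNeg : ∀ {x y} → 0# ≤ x → 0# ≤ y → 0# ≤ x + y
  +-nonNeg 0≤x 0≤y = ≤-respˡ-≈ (+-identityˡ 0#) (+-mono-≤ 0≤x 0≤y)

  x≤x+nonNeg : ∀ {x y} → 0# ≤ y → x ≤ x + y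
  x≤x+nonNeg {x} 0≤y = ≤-respˡ-≈ (+-identityʳ x) (+-monoʳ-≤ x 0≤y)

  ≤-by : ∀ {x y d} → 0# ≤ d → y - x ≈ d → x ≤ y
  ≤-by 0≤d eq = 0≤y-x⇒x≤y (≤-respʳ-≈ (≈-sym eq) 0≤d)

  neg-mono : ∀ {x y} → x ≤ y → - y ≤ - x
  neg-mono {x} {y} x≤y = ≤-by (x≤y⇒0≤y-x x≤y) (solve 2 (λ x y → :- x :- (:- y) := y :- x) ≈-refl x y)

  <⇒≤ : ∀ {x y} → x < y → x ≤ y
  <⇒≤ = proj₁

  ≤-<-trans : ∀ {x y z} → x ≤ y → y < z → x < z
  ≤-<-trans x≤y y<z = ≰⇒> λ z≤x → <⇒≱ y<z (≤-trans z≤x x≤y)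

  <-≤-trans : ∀ {x y z} → x < y → y ≤ z → x < z
  <-≤-trans x<y y≤z = ≰⇒> λ z≤x → <⇒≱ x<y (≤-trans y≤z z≤x)

  0<1 : 0# < 1#
  0<1 = 0≤1 , 0≉1

  pos⇒≉0 : ∀ {x} → 0# < x → x ≉ 0#
  pos⇒≉0 (_ , 0≉x) eq = 0≉x (≈-sym eq)

  *-inverseˡ : ∀ {x} → 0# < x → x ⁻¹ * x ≈ 1#
  *-inverseˡ 0<x = ≈-trans (*-comm _ _) (*-inverseʳ (pos⇒≉0 0<x))

  ⁻¹-pos : ∀ {x} → 0# < x → 0# < x ⁻¹
  ⁻¹-pos {x} 0<x = ≰⇒> λ x⁻¹≤0 → <⇒≱ 0<1 (begin
    1#           ≈⟨ *-inverseʳ (pos⇒≉0 0<x) ⟨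
    x * x ⁻¹     ≤⟨ *-monoˡ-≤ (<⇒≤ 0<x) x⁻¹≤0 ⟩
    x * 0#       ≈⟨ zeroʳ x ⟩
    0#           ∎)

  *-cancelˡ-≤ : ∀ {x y z} → 0# < x → x * y ≤ x * z → y ≤ z
  *-cancelˡ-≤ {x} {y} {z} 0<x xy≤xz = begin
    y                  ≈⟨ lem y ⟨
    x ⁻¹ * (x * y)     ≤⟨ *-monoˡ-≤ (<⇒≤ (⁻¹-pos 0<x)) xy≤xz ⟩
    x ⁻¹ * (x * z)     ≈⟨ lem z ⟩
    z                  ∎
    where
    lem : ∀ y → x ⁻¹ * (x * y) ≈ y
    lem y = ≈-trans (≈-sym (*-assoc _ _ _)) (≈-trans (*-congʳ (*-inverseˡ 0<x)) (*-identityˡ y))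

  *-pos : ∀ {x y} → 0# < x → 0# < y → 0# < x * y
  *-pos {x} {y} 0<x 0<y = ≰⇒> λ xy≤0 → <⇒≱ 0<y (*-cancelˡ-≤ 0<x (≤-respʳ-≈ (≈-sym (zeroʳ x)) xy≤0))

  +-pos : ∀ {x y} → 0# < x → 0# ≤ y → 0# < x + y
  +-pos 0<x 0≤y = <-≤-trans 0<x (x≤x+nonNeg 0≤y)

  ^-nonNeg : ∀ {x} n → 0# ≤ x → 0# ≤ x ^ n
  ^-nonNeg zero    0≤x = 0≤1
  ^-nonNeg (suc n) 0≤x = *-nonNeg 0≤x (^-nonNeg n 0≤x)

  ^-pos : ∀ {x} n → 0# < x → 0# < x ^ n
  ^-pos zero    0<x = 0<1
  ^-pos (suc n) 0<x = *-pos 0<x (^-pos n 0<x)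

  ^-monoˡ-≤ : ∀ {x y} n → 0# ≤ x → x ≤ y → x ^ n ≤ y ^ n
  ^-monoˡ-≤ zero    0≤x x≤y = ≤-refl
  ^-monoˡ-≤ (suc n) 0≤x x≤y =
    *-mono-≤ 0≤x (^-nonNeg n (≤-trans 0≤x x≤y)) x≤y (^-monoˡ-≤ n 0≤x x≤y)

  ^-≤1 : ∀ {x} n → 0# ≤ x → x ≤ 1# → x ^ n ≤ 1#
  ^-≤1 zero    0≤x x≤1 = ≤-refl
  ^-≤1 (suc n) 0≤x x≤1 = ≤-respʳ-≈ (*-identityˡ 1#) (*-mono-≤ 0≤x 0≤1 x≤1 (^-≤1 n 0≤x x≤1))

  square-cancel-≤ : ∀ {x y} → 0# ≤ y → x * x ≤ y * y → x ≤ y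
  square-cancel-≤ {x} {y} 0≤y xx≤yy with x ≤? y
  ... | yes x≤y = x≤y
  ... | no  x≰y = ⊥-elim (<⇒≱ y*y<x*x xx≤yy)
    where
    y<x = ≰⇒> x≰y
    0<x = ≤-<-trans 0≤y y<x
    y*y<x*x : y * y < x * x
    y*y<x*x = ≰⇒> λ le → <⇒≱ y<x (*-cancelˡ-≤ 0<x (≤-trans le (*-monoʳ-≤ 0≤y (<⇒≤ y<x))))

  -- Absolute values occur only in upper bounds.

  infix 4 ∣_∣≤_
  ∣_∣≤_ : ℝ → ℝ → Set
  ∣ x ∣≤ e = x ≤ e × - x ≤ e

  abs-cong : ∀ {x y e} → x ≈ y → ∣ x ∣≤ e → ∣ y ∣≤ e
  abs-cong x≈y (l , r) = ≤-respˡ-≈ x≈y l , ≤-respˡ-≈ (-‿cong x≈y) r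

  abs-mono : ∀ {x e e′} → e ≤ e′ → ∣ x ∣≤ e → ∣ x ∣≤ e′
  abs-mono e≤e′ (l , r) = ≤-trans l e≤e′ , ≤-trans r e≤e′

  abs-+ : ∀ {x y e f} → ∣ x ∣≤ e → ∣ y ∣≤ f → ∣ x + y ∣≤ e + f
  abs-+ {x} {y} (l , r) (l′ , r′) =
    +-mono-≤ l l′ , ≤-respˡ-≈ (-‿+-comm x y) (+-mono-≤ r r′)

  abs-* : ∀ {c x e} → 0# ≤ c → ∣ x ∣≤ e → ∣ c * x ∣≤ c * e
  abs-* {c} {x} 0≤c (l , r) =
    *-monoˡ-≤ 0≤c l , ≤-respˡ-≈ (≈-sym (-‿distribʳ-* c x)) (*-monoˡ-≤ 0≤c r)

  abs-square : ∀ {x e} → 0# ≤ e → x * x ≤ e * e → ∣ x ∣≤ e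
  abs-square {x} 0≤e le = square-cancel-≤ 0≤e le ,
    square-cancel-≤ 0≤e (≤-respˡ-≈ (solve 1 (λ x → x :* x := (:- x) :* (:- x)) ≈-refl x) le)

  -- Finite sums

  ∑ : {A : Set} → List A → (A → ℝ) → ℝ
  ∑ []      f = 0#
  ∑ (x ∷ V) f = f x + ∑ V f

  module _ {A : Set} where

    ∑-cong : ∀ (V : List A) {f g} → (∀ x → f x ≈ g x) → ∑ V f ≈ ∑ V g
    ∑-cong []      f≈g = ≈-refl
    ∑-cong (x ∷ V) f≈g = +-cong (f≈g x) (∑-cong V f≈g)

    ∑-mono : ∀ (V : List A) {f g} → (∀ x → f x ≤ g x) → ∑ V f ≤ ∑ V g
    ∑-mono []      f≤g = ≤-refl
    ∑-mono (x ∷ V) f≤g = +-mono-≤ (f≤g x) (∑-mono V f≤g)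

    ∑-0 : ∀ (V : List A) → ∑ V (λ _ → 0#) ≈ 0#
    ∑-0 []      = ≈-refl
    ∑-0 (x ∷ V) = ≈-trans (+-identityˡ _) (∑-0 V)

    ∑-1 : ∀ (V : List A) → ∑ V (λ _ → 1#) ≈ ι (length V)
    ∑-1 []      = ≈-refl
    ∑-1 (x ∷ V) = +-congˡ (∑-1 V)

    ∑-nonNeg : ∀ (V : List A) {f} → (∀ x → 0# ≤ f x) → 0# ≤ ∑ V f
    ∑-nonNeg V 0≤f = ≤-respˡ-≈ (∑-0 V) (∑-mono V 0≤f)

    ∑-+ : ∀ (V : List A) f g → ∑ V (λ x → f x + g x) ≈ ∑ V f + ∑ V g
    ∑-+ []      f g = ≈-sym (+-identityˡ 0#)
    ∑-+ (x ∷ V) f g = ≈-trans (+-congˡ (∑-+ V f g))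
      (solve 4 (λ a b c d → (a :+ b) :+ (c :+ d) := (a :+ c) :+ (b :+ d)) ≈-refl _ _ _ _)

    ∑-*ˡ : ∀ (V : List A) c f → ∑ V (λ x → c * f x) ≈ c * ∑ V f
    ∑-*ˡ []      c f = ≈-sym (zeroʳ c)
    ∑-*ˡ (x ∷ V) c f = ≈-trans (+-congˡ (∑-*ˡ V c f)) (≈-sym (distribˡ _ _ _))

    ∑-*ʳ : ∀ (V : List A) c f → ∑ V (λ x → f x * c) ≈ ∑ V f * c
    ∑-*ʳ V c f = ≈-trans (∑-cong V (λ _ → *-comm _ _)) (≈-trans (∑-*ˡ V c f) (*-comm _ _))

    ∑-neg : ∀ (V : List A) f → ∑ V (λ x → - f x) ≈ - ∑ V f
    ∑-neg []      f = ≈-sym -0#≈0#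
    ∑-neg (x ∷ V) f = ≈-trans (+-congˡ (∑-neg V f)) (-‿+-comm _ _)

    ∑-- : ∀ (V : List A) f g → ∑ V (λ x → f x - g x) ≈ ∑ V f - ∑ V g
    ∑-- V f g = ≈-trans (∑-+ V f _) (+-congˡ (∑-neg V g))

    ∑-abs : ∀ (V : List A) {f e} → (∀ x → ∣ f x ∣≤ e x) → ∣ ∑ V f ∣≤ ∑ V e
    ∑-abs V {f} h = ∑-mono V (λ x → proj₁ (h x)) ,
      ≤-respˡ-≈ (∑-neg V f) (∑-mono V (λ x → proj₂ (h x)))

    ∑-++ : ∀ (U V : List A) f → ∑ (U ++ V) f ≈ ∑ U f + ∑ V f
    ∑-++ []      V f = ≈-sym (+-identityˡ _)
    ∑-++ (x ∷ U) V f = ≈-trans (+-congˡ (∑-++ U V f)) (≈-sym (+-assoc _ _ _))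

  ∑-map : ∀ {A B : Set} (g : A → B) V f → ∑ (map g V) f ≈ ∑ V (λ x → f (g x))
  ∑-map g []      f = ≈-refl
  ∑-map g (x ∷ V) f = +-congˡ (∑-map g V f)

  ∑-product : ∀ {A B C : Set} (g : A → B → C) U V f →
              ∑ (cartesianProductWith g U V) f ≈ ∑ U (λ x → ∑ V (λ y → f (g x y)))
  ∑-product g []      V f = ≈-refl
  ∑-product g (x ∷ U) V f =
    ≈-trans (∑-++ (map (g x) V) _ f) (+-cong (∑-map (g x) V f) (∑-product g U V f))

  ∑-swap : ∀ {A B : Set} (U : List A) (V : List B) (f : A → B → ℝ) →
           ∑ U (λ x → ∑ V (λ y → f x y)) ≈ ∑ V (λ y → ∑ U (λ x → f x y))
  ∑-swap []      V f = ≈-sym (∑-0 V)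
  ∑-swap (x ∷ U) V f = ≈-trans (+-congˡ (∑-swap U V f)) (≈-sym (∑-+ V (f x) _))

  ∑-*-∑ : ∀ {A B : Set} (U : List A) (V : List B) f g →
          ∑ U f * ∑ V g ≈ ∑ U (λ x → ∑ V (λ y → f x * g y))
  ∑-*-∑ U V f g = ≈-trans (≈-sym (∑-*ʳ U _ f)) (∑-cong U (λ x → ≈-sym (∑-*ˡ V (f x) g)))

  ∑-cong₂ : ∀ {A B : Set} (U : List A) (V : List B) {f g : A → B → ℝ} → (∀ x y → f x y ≈ g x y) →
            ∑ U (λ x → ∑ V (λ y → f x y)) ≈ ∑ U (λ x → ∑ V (λ y → g x y))
  ∑-cong₂ U V h = ∑-cong U (λ x → ∑-cong V (h x))

  ∑-mono₂ : ∀ {A B : Set} (U : List A) (V : List B) {f g : A → B → ℝ} → (∀ x y → f x y ≤ g x y) →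
            ∑ U (λ x → ∑ V (λ y → f x y)) ≤ ∑ U (λ x → ∑ V (λ y → g x y))
  ∑-mono₂ U V h = ∑-mono U (λ x → ∑-mono V (h x))

  -- Lagrange's identity: the difference of the two sides is half of ∑∑ (fᵢgⱼ − fⱼgᵢ)².

  cauchy-schwarz : ∀ {A : Set} (V : List A) (f g : A → ℝ) →
    ∑ V (λ x → f x * g x) * ∑ V (λ x → f x * g x) ≤
    ∑ V (λ x → f x * f x) * ∑ V (λ x → g x * g x)
  cauchy-schwarz {A} V f g = *-cancelˡ-≤ 0<2 (≤-by lagrange-nonNeg eq)
    where
    0<2 : 0# < 1# + 1#
    0<2 = +-pos 0<1 0≤1
    F = ∑ V (λ x → f x * f x)
    H = ∑ V (λ x → g x * g x)
    S = ∑ V (λ x → f x * g x)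
    D : A → A → ℝ
    D x y = f x * g y - f y * g x
    L = ∑ V (λ x → ∑ V (λ y → D x y * D x y))
    lagrange-nonNeg : 0# ≤ L
    lagrange-nonNeg = ∑-nonNeg V λ x → ∑-nonNeg V λ y → x*x-nonNeg (D x y)
    L≈ : L ≈ (F * H + F * H) - (S * S + S * S)
    L≈ = begin-equality
      L ≈⟨ ∑-cong₂ V V (λ x y → solve 4 (λ a b c d →
             (a :* b :- c :* d) :* (a :* b :- c :* d) :=
             ((a :* a) :* (b :* b) :+ (d :* d) :* (c :* c)) :-
               ((a :* d) :* (c :* b) :+ (a :* d) :* (c :* b)))
             ≈-refl (f x) (g y) (f y) (g x)) ⟩
      ∑ V (λ x → ∑ V (λ y → (ff x * gg y + gg x * ff y) - (fg x * fg y + fg x * fg y)))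
        ≈⟨ ∑-cong V (λ x → ∑-- V _ _) ⟩
      ∑ V (λ x → ∑ V (λ y → ff x * gg y + gg x * ff y) - ∑ V (λ y → fg x * fg y + fg x * fg y))
        ≈⟨ ∑-- V _ _ ⟩
      ∑ V (λ x → ∑ V (λ y → ff x * gg y + gg x * ff y)) -
        ∑ V (λ x → ∑ V (λ y → fg x * fg y + fg x * fg y))
        ≈⟨ +-cong (split ff gg gg ff) (-‿cong (split fg fg fg fg)) ⟩
      (F * H + H * F) - (S * S + S * S)
        ≈⟨ +-congʳ (+-congˡ (*-comm H F)) ⟩
      (F * H + F * H) - (S * S + S * S) ∎
      where
      ff = λ x → f x * f x
      gg = λ x → g x * g x
      fg = λ x → f x * g x
      split : ∀ a b c d → ∑ V (λ x → ∑ V (λ y → a x * b y + c x * d y)) ≈ ∑ V a * ∑ V b + ∑ V c * ∑ V d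
      split a b c d = begin-equality
        ∑ V (λ x → ∑ V (λ y → a x * b y + c x * d y))  ≈⟨ ∑-cong V (λ x → ∑-+ V _ _) ⟩
        ∑ V (λ x → ∑ V (λ y → a x * b y) + ∑ V (λ y → c x * d y))  ≈⟨ ∑-+ V _ _ ⟩
        ∑ V (λ x → ∑ V (λ y → a x * b y)) + ∑ V (λ x → ∑ V (λ y → c x * d y))
          ≈⟨ +-cong (∑-*-∑ V V a b) (∑-*-∑ V V c d) ⟨
        ∑ V a * ∑ V b + ∑ V c * ∑ V d ∎
    eq : (1# + 1#) * (F * H) - (1# + 1#) * (S * S) ≈ L
    eq = ≈-trans (solve 2 (λ a b → con (+ 2) :* a :- con (+ 2) :* b := (a :+ a) :- (b :+ b))
      ≈-refl (F * H) (S * S)) (≈-sym L≈)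

  -- The one-variable inequality on the list of all pairs.
  cauchy-schwarz₂ : ∀ {A B : Set} (U : List A) (V : List B) (f g : A → B → ℝ) →
    let S = ∑ U (λ x → ∑ V (λ y → f x y * g x y)) in
    S * S ≤ ∑ U (λ x → ∑ V (λ y → f x y * f x y)) * ∑ U (λ x → ∑ V (λ y → g x y * g x y))
  cauchy-schwarz₂ U V f g = begin
    S * S ≈⟨ *-cong pairs pairs ⟨
    _     ≤⟨ cauchy-schwarz (cartesianProductWith _,_ U V) (λ (x , y) → f x y) (λ (x , y) → g x y) ⟩
    _     ≈⟨ *-cong (∑-product _,_ U V _) (∑-product _,_ U V _) ⟩
    _     ∎
    where
    S = ∑ U (λ x → ∑ V (λ y → f x y * g x y))
    pairs = ∑-product _,_ U V (λ (x , y) → f x y * g x y)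

  -- The box norm

  module Box (V : List ℤ) where

    gram : (ℤ → ℤ → ℝ) → ℤ → ℤ → ℝ
    gram X y y′ = ∑ V λ x → X x y * X x y′

    norm² : (ℤ → ℤ → ℝ) → ℝ
    norm² A = ∑ V λ x → ∑ V λ y → A x y * A x y

    -- The squared Hilbert-Schmidt norm of XᵀX, that is, the fourth power of the Schatten 4-norm of
    -- X: a weighted count of closed walks of length 4.
    κ : (ℤ → ℤ → ℝ) → ℝ
    κ X = norm² (gram X)

    triangles : (X A B : ℤ → ℤ → ℝ) → ℝ
    triangles X A B = ∑ V λ x → ∑ V λ y → ∑ V λ z → X x y * (A x z * B y z)

    norm²-nonNeg : ∀ A → 0# ≤ norm² A
    norm²-nonNeg A = ∑-nonNeg V λ x → ∑-nonNeg V λ y → x*x-nonNeg (A x y)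

    norm²-transpose : ∀ A → norm² (λ x y → A y x) ≈ norm² A
    norm²-transpose A = ∑-swap V V _

    -- Cauchy-Schwarz in each entry of the Gram matrix.
    κ-≤-norm⁴ : ∀ X → κ X ≤ norm² X * norm² X
    κ-≤-norm⁴ X = begin
      κ X
        ≤⟨ ∑-mono₂ V V (λ y y′ → cauchy-schwarz V (λ x → X x y) (λ x → X x y′)) ⟩
      ∑ V (λ y → ∑ V (λ y′ → ∑ V (λ x → X x y * X x y) * ∑ V (λ x → X x y′ * X x y′)))
        ≈⟨ ∑-*-∑ V V _ _ ⟨
      norm² (λ x y → X y x) * norm² (λ x y → X y x)
        ≈⟨ *-cong (norm²-transpose X) (norm²-transpose X) ⟩
      norm² X * norm² X ∎

    private
      module _ (X A B : ℤ → ℤ → ℝ) where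
        XB : ℤ → ℤ → ℝ
        XB x z = ∑ V λ y → X x y * B y z

        triangles≈ : triangles X A B ≈ ∑ V (λ x → ∑ V λ z → A x z * XB x z)
        triangles≈ = ∑-cong V λ x → ≈-trans (∑-swap V V _) (∑-cong V λ z →
          ≈-trans (∑-cong V λ y → solve 3 (λ a b c → a :* (b :* c) := b :* (a :* c)) ≈-refl _ _ _)
            (∑-*ˡ V _ _))

        BBᵀ : ℤ → ℤ → ℝ
        BBᵀ y y′ = ∑ V λ z → B y z * B y′ z

        -- The identity ‖XB‖² = tr(BᵀXᵀXB) = ⟨XᵀX, BBᵀ⟩, which separates X from B.
        XB-norm : norm² XB ≈ ∑ V (λ y → ∑ V λ y′ → gram X y y′ * BBᵀ y y′)
        XB-norm = begin-equality
          norm² XB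
            ≈⟨ ∑-cong₂ V V (λ x z → ∑-*-∑ V V _ _) ⟩
          ∑ V (λ x → ∑ V λ z → ∑ V λ y → ∑ V λ y′ → (X x y * B y z) * (X x y′ * B y′ z))
            ≈⟨ ∑-cong V (λ x → ≈-trans (∑-swap V V _) (∑-cong V λ y → ∑-swap V V _)) ⟩
          ∑ V (λ x → ∑ V λ y → ∑ V λ y′ → ∑ V λ z → (X x y * B y z) * (X x y′ * B y′ z))
            ≈⟨ ≈-trans (∑-swap V V _) (∑-cong V λ y → ∑-swap V V _) ⟩
          ∑ V (λ y → ∑ V λ y′ → ∑ V λ x → ∑ V λ z → (X x y * B y z) * (X x y′ * B y′ z))
            ≈⟨ ∑-cong₂ V V (λ y y′ → ≈-trans
                 (∑-cong₂ V V λ x z → solve 4 (λ a b c d → (a :* b) :* (c :* d) := (a :* c) :* (b :* d))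
                   ≈-refl _ _ _ _)
                 (≈-sym (∑-*-∑ V V _ _))) ⟩
          ∑ V (λ y → ∑ V λ y′ → gram X y y′ * BBᵀ y y′) ∎

    -- Cauchy-Schwarz twice: on ⟨A, XB⟩ it splits off A, and on ‖XB‖² = ⟨XᵀX, BBᵀ⟩ it leaves κ(X)^½
    -- ≤ s² times ‖BBᵀ‖ ≤ ‖B‖² ≤ Δ.
    box-inequality : ∀ X A B {s Δ} → 0# ≤ s → 0# ≤ Δ → κ X ≤ (s * s) * (s * s) →
      norm² A ≤ Δ → norm² B ≤ Δ → ∣ triangles X A B ∣≤ s * Δ
    box-inequality X A B {s} {Δ} 0≤s 0≤Δ κ≤ A≤ B≤ = abs-square (*-nonNeg 0≤s 0≤Δ) (begin
      T * T                      ≤⟨ T²≤ ⟩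
      norm² A * P                ≤⟨ *-mono-≤ (norm²-nonNeg A) 0≤ssΔ A≤ P≤ ⟩
      Δ * ((s * s) * Δ)          ≈⟨ solve 2 (λ s d → d :* ((s :* s) :* d) := (s :* d) :* (s :* d)) ≈-refl s Δ ⟩
      (s * Δ) * (s * Δ)          ∎)
      where
      T = triangles X A B
      P = norm² (XB X A B)
      0≤ssΔ = *-nonNeg (x*x-nonNeg s) 0≤Δ
      T²≤ : T * T ≤ norm² A * P
      T²≤ = ≤-respˡ-≈ (≈-sym (*-cong (triangles≈ X A B) (triangles≈ X A B)))
        (cauchy-schwarz₂ V V A (XB X A B))
      BB≤ : norm² (BBᵀ X A B) ≤ Δ * Δ
      BB≤ = begin
        norm² (BBᵀ X A B)                          ≤⟨ κ-≤-norm⁴ (λ z y → B y z) ⟩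
        norm² (λ z y → B y z) * norm² (λ z y → B y z)
          ≈⟨ *-cong (norm²-transpose B) (norm²-transpose B) ⟩
        norm² B * norm² B                          ≤⟨ *-mono-≤ (norm²-nonNeg B) 0≤Δ B≤ B≤ ⟩
        Δ * Δ                                      ∎
      P≤ : P ≤ (s * s) * Δ
      P≤ = square-cancel-≤ 0≤ssΔ (begin
        P * P
          ≈⟨ *-cong (XB-norm X A B) (XB-norm X A B) ⟩
        _ ≤⟨ cauchy-schwarz₂ V V (gram X) (BBᵀ X A B) ⟩
        κ X * norm² (BBᵀ X A B)
          ≤⟨ *-mono-≤ (norm²-nonNeg (gram X)) (*-nonNeg 0≤Δ 0≤Δ) κ≤ BB≤ ⟩
        ((s * s) * (s * s)) * (Δ * Δ)
          ≈⟨ solve 2 (λ s d → ((s :* s) :* (s :* s)) :* (d :* d) :=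
               ((s :* s) :* d) :* ((s :* s) :* d)) ≈-refl s Δ ⟩
        ((s * s) * Δ) * ((s * s) * Δ) ∎)

  -- Weighted clique counts

  ⟦_⟧ : Bool → ℝ
  ⟦ true  ⟧ = 1#
  ⟦ false ⟧ = 0#

  ⟦⟧-nonNeg : ∀ b → 0# ≤ ⟦ b ⟧
  ⟦⟧-nonNeg true  = 0≤1
  ⟦⟧-nonNeg false = ≤-refl

  ⟦⟧-≤1 : ∀ b → ⟦ b ⟧ ≤ 1#
  ⟦⟧-≤1 true  = ≤-refl
  ⟦⟧-≤1 false = 0≤1

  ⟦⟧-∧ : ∀ b c → ⟦ b ∧ c ⟧ ≈ ⟦ b ⟧ * ⟦ c ⟧
  ⟦⟧-∧ true  c = ≈-sym (*-identityˡ _)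
  ⟦⟧-∧ false c = ≈-sym (zeroˡ _)

  ⟦⟧-idem : ∀ b → ⟦ b ⟧ * ⟦ b ⟧ ≈ ⟦ b ⟧
  ⟦⟧-idem true  = *-identityˡ _
  ⟦⟧-idem false = zeroˡ _

  ⟦⟧-mono : ∀ {b c} → b ⇒ c → ⟦ b ⟧ ≤ ⟦ c ⟧
  ⟦⟧-mono {false} {c} _ = ⟦⟧-nonNeg c
  ⟦⟧-mono {true} b⇒c rewrite b⇒c ≡.refl = ≤-refl

  abs-*-≤1 : ∀ {c x e} → 0# ≤ c → c ≤ 1# → 0# ≤ e → ∣ x ∣≤ e → ∣ c * x ∣≤ e
  abs-*-≤1 {e = e} 0≤c c≤1 0≤e h =
    abs-mono (≤-respʳ-≈ (*-identityˡ e) (*-monoʳ-≤ 0≤e c≤1)) (abs-* 0≤c h)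

  module Cliques (V : List ℤ) where
    open Box V

    -- cl k w a is the number of ordered k-cliques of w with all vertices in a.

    cl : ℕ → (ℤ → ℤ → Bool) → (ℤ → Bool) → ℝ
    cl zero    w a = 1#
    cl (suc k) w a = ∑ V λ x → ⟦ a x ⟧ * cl k w (a ⊓ w x)

    cl-nonNeg : ∀ k w a → 0# ≤ cl k w a
    cl-nonNeg zero    w a = 0≤1
    cl-nonNeg (suc k) w a = ∑-nonNeg V λ x → *-nonNeg (⟦⟧-nonNeg (a x)) (cl-nonNeg k w _)

    cl-cong : ∀ k w {a b} → (∀ x → a x ≡ b x) → cl k w a ≈ cl k w b
    cl-cong zero    w a≡b = ≈-refl
    cl-cong (suc k) w a≡b = ∑-cong V λ x → *-cong (reflexive (≡.cong ⟦_⟧ (a≡b x)))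
      (cl-cong k w λ y → ≡.cong (_∧ w x y) (a≡b y))

    cl-mono : ∀ k {v w a b} → v ⊑ w → a ⊆ b → cl k v a ≤ cl k w b
    cl-mono zero    v⊑w a⊆b = ≤-refl
    cl-mono (suc k) {v} {w} {a} {b} v⊑w a⊆b = ∑-mono V λ x →
      *-mono-≤ (⟦⟧-nonNeg (a x)) (cl-nonNeg k w (b ⊓ w x)) (⟦⟧-mono (a⊆b x))
        (cl-mono k {a = a ⊓ v x} v⊑w (⊓-⊆ a⊆b (v⊑w x)))

    norm²-⟦⟧ : ∀ (w : ℤ → ℤ → Bool) → norm² (λ x y → ⟦ w x y ⟧) ≈ ∑ V (λ x → ∑ V λ y → ⟦ w x y ⟧)
    norm²-⟦⟧ w = ∑-cong₂ V V λ x y → ⟦⟧-idem (w x y)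

    cl-2 : ∀ w q → cl 2 w q ≈ ∑ V (λ x → ∑ V λ y → ⟦ q x ⟧ * ⟦ q y ∧ w x y ⟧)
    cl-2 w q = ∑-cong V λ x → ≈-trans (*-congˡ (∑-cong V λ y → *-identityʳ _)) (≈-sym (∑-*ˡ V _ _))

    -- Replacing the edges of K_m one at a time, G = pQ + X, where every replaced edge
    -- lies in a triangle whose other two edges are edges of Q.

    module Counting
      (G Q : ℤ → ℤ → Bool) (X : ℤ → ℤ → ℝ) (p β : ℝ)
      (0≤p : 0# ≤ p) (p≤1 : p ≤ 1#) (0≤β : 0# ≤ β)
      (G-sym : ∀ x y → G x y ≡ G y x) (Q-sym : ∀ x y → Q x y ≡ Q y x) (G⊑Q : G ⊑ Q)
      (split : ∀ x y → ⟦ G x y ⟧ ≈ p * ⟦ Q x y ⟧ + X x y)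
      (box : ∀ A B {Δ} → 0# ≤ Δ → norm² A ≤ Δ → norm² B ≤ Δ → ∣ triangles X A B ∣≤ β * Δ)
      where

      -- `F x y` counts the ways to complete the noisy edge xy to a clique; `α` and `γ` collect what
      -- the vertices fixed so far demand of x and of y.
      edges : (α γ : ℤ → Bool) (F : ℤ → ℤ → ℝ) → ℝ
      edges α γ F = ∑ V λ x → ⟦ α x ⟧ * ∑ V λ y → ⟦ γ y ⟧ * (X x y * F x y)

      edges-cong : ∀ {α α′ γ γ′ : ℤ → Bool} {F F′ : ℤ → ℤ → ℝ} → (∀ x → α x ≡ α′ x) → (∀ y → γ y ≡ γ′ y) →
                   (∀ x y → F x y ≈ F′ x y) → edges α γ F ≈ edges α′ γ′ F′
      edges-cong α≡ γ≡ F≈ = ∑-cong V λ x → *-cong (reflexive (≡.cong ⟦_⟧ (α≡ x)))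
        (∑-cong V λ y → *-cong (reflexive (≡.cong ⟦_⟧ (γ≡ y))) (*-congˡ (F≈ x y)))

      edges≈ : ∀ α γ F → edges α γ F ≈ ∑ V (λ x → ∑ V λ y → (⟦ α x ⟧ * ⟦ γ y ⟧) * (X x y * F x y))
      edges≈ α γ F = ∑-cong V λ x → ≈-trans (≈-sym (∑-*ˡ V _ _)) (∑-cong V λ y → ≈-sym (*-assoc _ _ _))

      -- Once the sum over z is outermost, the adjacency of z to x and y restricts the ranges of x
      -- and y, and z has become a fixed vertex of the clique.
      edges-expand : ∀ (α γ a : ℤ → Bool) (g h : ℤ → ℤ → Bool) (F : ℤ → ℤ → ℤ → ℝ) →
        edges α γ (λ x y → ∑ V λ z → ⟦ (a z ∧ g x z) ∧ h y z ⟧ * F x y z) ≈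
        ∑ V (λ z → ⟦ a z ⟧ * edges (α ⊓ λ x → g x z) (γ ⊓ λ y → h y z) (λ x y → F x y z))
      edges-expand α γ a g h F = begin-equality
        edges α γ (λ x y → ∑ V λ z → ⟦ (a z ∧ g x z) ∧ h y z ⟧ * F x y z)
          ≈⟨ edges≈ α γ _ ⟩
        ∑ V (λ x → ∑ V λ y → (⟦ α x ⟧ * ⟦ γ y ⟧) * (X x y * ∑ V λ z → ⟦ (a z ∧ g x z) ∧ h y z ⟧ * F x y z))
          ≈⟨ ∑-cong₂ V V (λ x y → ≈-trans (≈-sym (*-assoc _ _ _)) (≈-trans (≈-sym (∑-*ˡ V _ _))
               (∑-cong V λ z → pointwise x y z))) ⟩
        ∑ V (λ x → ∑ V λ y → ∑ V λ z → T x y z)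
          ≈⟨ ∑-cong V (λ x → ∑-swap V V _) ⟩
        ∑ V (λ x → ∑ V λ z → ∑ V λ y → T x y z)
          ≈⟨ ∑-swap V V _ ⟩
        ∑ V (λ z → ∑ V λ x → ∑ V λ y → T x y z)
          ≈⟨ ∑-cong V (λ z → ≈-trans (∑-cong V λ x → ∑-*ˡ V _ _) (∑-*ˡ V _ _)) ⟩
        ∑ V (λ z → ⟦ a z ⟧ * ∑ V λ x → ∑ V λ y →
          (⟦ α x ∧ g x z ⟧ * ⟦ γ y ∧ h y z ⟧) * (X x y * F x y z))
          ≈⟨ ∑-cong V (λ z → *-congˡ (edges≈ (α ⊓ λ x → g x z) (γ ⊓ λ y → h y z) _)) ⟨
        ∑ V (λ z → ⟦ a z ⟧ * edges (α ⊓ λ x → g x z) (γ ⊓ λ y → h y z) (λ x y → F x y z)) ∎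
        where
        T : ℤ → ℤ → ℤ → ℝ
        T x y z = ⟦ a z ⟧ * ((⟦ α x ∧ g x z ⟧ * ⟦ γ y ∧ h y z ⟧) * (X x y * F x y z))
        pointwise : ∀ x y z → ((⟦ α x ⟧ * ⟦ γ y ⟧) * X x y) * (⟦ (a z ∧ g x z) ∧ h y z ⟧ * F x y z) ≈ T x y z
        pointwise x y z = begin-equality
          ((⟦ α x ⟧ * ⟦ γ y ⟧) * X x y) * (⟦ (a z ∧ g x z) ∧ h y z ⟧ * F x y z)
            ≈⟨ *-congˡ (*-congʳ (≈-trans (⟦⟧-∧ (a z ∧ g x z) (h y z)) (*-congʳ (⟦⟧-∧ (a z) (g x z))))) ⟩
          ((⟦ α x ⟧ * ⟦ γ y ⟧) * X x y) * (((⟦ a z ⟧ * ⟦ g x z ⟧) * ⟦ h y z ⟧) * F x y z)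
            ≈⟨ solve 7 (λ α γ X a g h F → ((α :* γ) :* X) :* (((a :* g) :* h) :* F) :=
                 a :* (((α :* g) :* (γ :* h)) :* (X :* F))) ≈-refl
                 ⟦ α x ⟧ ⟦ γ y ⟧ (X x y) ⟦ a z ⟧ ⟦ g x z ⟧ ⟦ h y z ⟧ (F x y z) ⟩
          ⟦ a z ⟧ * (((⟦ α x ⟧ * ⟦ g x z ⟧) * (⟦ γ y ⟧ * ⟦ h y z ⟧)) * (X x y * F x y z))
            ≈⟨ *-congˡ (*-congʳ (*-cong (⟦⟧-∧ (α x) (g x z)) (⟦⟧-∧ (γ y) (h y z)))) ⟨
          T x y z ∎

      -- The induction step over fixed vertices: bounds within the Q-neighbourhoods of all z add up
      -- to the same constant times the cliques with one more vertex.
      in-context : ∀ {a q : ℤ → Bool} {c} {f : ℤ → ℝ} k → 0# ≤ c → a ⊆ q →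
                   (∀ z → ∣ f z ∣≤ c * cl k Q (q ⊓ Q z)) →
                   ∣ ∑ V (λ z → ⟦ a z ⟧ * f z) ∣≤ c * cl (suc k) Q q
      in-context {a} {q} {c} k 0≤c a⊆q h =
        abs-mono (≤-trans (∑-mono V λ z → le z) (≤-reflexive (∑-*ˡ V c _)))
          (∑-abs V λ z → abs-* (⟦⟧-nonNeg (a z)) (h z))
        where
        le : ∀ z → ⟦ a z ⟧ * (c * cl k Q (q ⊓ Q z)) ≤ c * (⟦ q z ⟧ * cl k Q (q ⊓ Q z))
        le z = begin
          ⟦ a z ⟧ * (c * cl k Q (q ⊓ Q z))
            ≤⟨ *-monoʳ-≤ (*-nonNeg 0≤c (cl-nonNeg k Q _)) (⟦⟧-mono (a⊆q z)) ⟩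
          ⟦ q z ⟧ * (c * cl k Q (q ⊓ Q z))
            ≈⟨ solve 3 (λ a b c → a :* (b :* c) := b :* (a :* c)) ≈-refl _ _ _ ⟩
          c * (⟦ q z ⟧ * cl k Q (q ⊓ Q z)) ∎

      -- The sum is the triangle form of the noise at two 0/1 matrices supported on Q-edges inside
      -- `q`, so both squared norms are at most `cl 2 Q q`.
      edges-in-triangles : ∀ {α γ a q : ℤ → Bool} {g h : ℤ → ℤ → Bool} → α ⊆ q → γ ⊆ q → a ⊆ q → g ⊑ Q → h ⊑ Q →
        ∣ ∑ V (λ z → ⟦ a z ⟧ * edges (α ⊓ λ x → g x z) (γ ⊓ λ y → h y z) (λ _ _ → 1#)) ∣≤ β * cl 2 Q q
      edges-in-triangles {α} {γ} {a} {q} {g} {h} α⊆q γ⊆q a⊆q g⊑Q h⊑Q =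
        abs-cong (≈-sym sum≈) (box A B (cl-nonNeg 2 Q q) (norm≤ α⊆q g⊑Q) (norm≤ γ⊆q h⊑Q))
        where
        -- The condition on z stands in both matrices, so that each is supported on pairs inside
        -- `q`; idempotence of the indicator supplies the second copy.
        A B : ℤ → ℤ → ℝ
        A x z = ⟦ α x ∧ (a z ∧ g x z) ⟧
        B y z = ⟦ γ y ∧ (a z ∧ h y z) ⟧
        norm≤ : ∀ {α g} → α ⊆ q → g ⊑ Q → norm² (λ x z → ⟦ α x ∧ (a z ∧ g x z) ⟧) ≤ cl 2 Q q
        norm≤ {α} {g} α⊆q g⊑Q = begin
          norm² (λ x z → ⟦ α x ∧ (a z ∧ g x z) ⟧)
            ≈⟨ norm²-⟦⟧ (λ x z → α x ∧ (a z ∧ g x z)) ⟩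
          ∑ V (λ x → ∑ V λ z → ⟦ α x ∧ (a z ∧ g x z) ⟧)
            ≤⟨ ∑-mono₂ V V (λ x z → ⟦⟧-mono (∧-⇒ (α⊆q x) (∧-⇒ (a⊆q z) (g⊑Q x z)))) ⟩
          ∑ V (λ x → ∑ V λ z → ⟦ q x ∧ (q z ∧ Q x z) ⟧)
            ≈⟨ ∑-cong₂ V V (λ x z → ⟦⟧-∧ (q x) _) ⟩
          ∑ V (λ x → ∑ V λ z → ⟦ q x ⟧ * ⟦ q z ∧ Q x z ⟧)
            ≈⟨ cl-2 Q q ⟨
          cl 2 Q q ∎
        sum≈ : ∑ V (λ z → ⟦ a z ⟧ * edges (α ⊓ λ x → g x z) (γ ⊓ λ y → h y z) (λ _ _ → 1#)) ≈
               triangles X A B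
        sum≈ = begin-equality
          ∑ V (λ z → ⟦ a z ⟧ * edges (α ⊓ λ x → g x z) (γ ⊓ λ y → h y z) (λ _ _ → 1#))
            ≈⟨ edges-expand α γ a g h (λ _ _ _ → 1#) ⟨
          edges α γ (λ x y → ∑ V λ z → ⟦ (a z ∧ g x z) ∧ h y z ⟧ * 1#)
            ≈⟨ edges≈ α γ _ ⟩
          ∑ V (λ x → ∑ V λ y → (⟦ α x ⟧ * ⟦ γ y ⟧) * (X x y * ∑ V λ z → ⟦ (a z ∧ g x z) ∧ h y z ⟧ * 1#))
            ≈⟨ ∑-cong₂ V V (λ x y → ≈-trans (≈-sym (*-assoc _ _ _)) (≈-trans (≈-sym (∑-*ˡ V _ _))
                 (∑-cong V λ z → pointwise x y z))) ⟩
          triangles X A B ∎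
          where
          pointwise : ∀ x y z →
            ((⟦ α x ⟧ * ⟦ γ y ⟧) * X x y) * (⟦ (a z ∧ g x z) ∧ h y z ⟧ * 1#) ≈ X x y * (A x z * B y z)
          pointwise x y z = begin-equality
            ((⟦ α x ⟧ * ⟦ γ y ⟧) * X x y) * (⟦ (a z ∧ g x z) ∧ h y z ⟧ * 1#)
              ≈⟨ *-congˡ (*-congʳ (≈-trans (⟦⟧-∧ (a z ∧ g x z) (h y z))
                   (*-congʳ (≈-trans (⟦⟧-∧ (a z) (g x z)) (*-congʳ (≈-sym (⟦⟧-idem (a z)))))))) ⟩
            ((⟦ α x ⟧ * ⟦ γ y ⟧) * X x y) * ((((⟦ a z ⟧ * ⟦ a z ⟧) * ⟦ g x z ⟧) * ⟦ h y z ⟧) * 1#)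
              ≈⟨ solve 6 (λ α γ X a g h → ((α :* γ) :* X) :* ((((a :* a) :* g) :* h) :* con (+ 1)) :=
                   X :* ((α :* (a :* g)) :* (γ :* (a :* h)))) ≈-refl
                   ⟦ α x ⟧ ⟦ γ y ⟧ (X x y) ⟦ a z ⟧ ⟦ g x z ⟧ ⟦ h y z ⟧ ⟩
            X x y * ((⟦ α x ⟧ * (⟦ a z ⟧ * ⟦ g x z ⟧)) * (⟦ γ y ⟧ * (⟦ a z ⟧ * ⟦ h y z ⟧)))
              ≈⟨ *-congˡ (*-cong (≈-trans (⟦⟧-∧ (α x) _) (*-congˡ (⟦⟧-∧ (a z) (g x z))))
                   (≈-trans (⟦⟧-∧ (γ y) _) (*-congˡ (⟦⟧-∧ (a z) (h y z))))) ⟨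
            X x y * (A x z * B y z) ∎

      ⊑-refl : ∀ w → w ⊑ w
      ⊑-refl w x y eq = eq

      transposed : ∀ {w : ℤ → ℤ → Bool} → (∀ x y → w x y ≡ w y x) → ∀ {q a : ℤ → Bool} → a ⊆ q →
                   w ⊑ Q → ∀ z → (a ⊓ λ x → w x z) ⊆ (q ⊓ Q z)
      transposed w-sym a⊆q w⊑Q z = ⊓-⊆ a⊆q λ x eq → w⊑Q z x (≡.trans (w-sym z x) eq)

      -- The completing vertices are fixed one after another until a single one remains, which
      -- closes the triangle over xy. Altogether a factor `β` replaces one vertex of a clique on 3 +
      -- k vertices.
      edges-in-cliques : ∀ k {α γ a q : ℤ → Bool} → α ⊆ q → γ ⊆ q → a ⊆ q →
        ∣ edges α γ (λ x y → cl (suc k) Q (a ⊓ G x ⊓ Q y)) ∣≤ β * cl (suc (suc k)) Q q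
      edges-in-cliques zero {α} {γ} {a} α⊆q γ⊆q a⊆q =
        abs-cong (≈-sym (edges-expand α γ a G Q (λ _ _ _ → 1#)))
          (edges-in-triangles {α} {γ} {a} α⊆q γ⊆q a⊆q G⊑Q (⊑-refl Q))
      edges-in-cliques (suc k) {α} {γ} {a} {q} α⊆q γ⊆q a⊆q = abs-cong (≈-sym expand)
        (in-context {a} (suc (suc k)) 0≤β a⊆q λ z →
          edges-in-cliques k {α ⊓ λ x → G x z} {γ ⊓ λ y → Q y z} {a ⊓ Q z} (transposed G-sym α⊆q G⊑Q z) (transposed Q-sym γ⊆q (⊑-refl Q) z)
            (⊓-⊆ a⊆q (⊑-refl Q z)))
        where
        expand : edges α γ (λ x y → cl (suc (suc k)) Q (a ⊓ G x ⊓ Q y)) ≈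
          ∑ V (λ z → ⟦ a z ⟧ * edges (α ⊓ λ x → G x z) (γ ⊓ λ y → Q y z)
            (λ x y → cl (suc k) Q (a ⊓ Q z ⊓ G x ⊓ Q y)))
        expand = ≈-trans (edges-expand α γ a G Q _) (∑-cong V λ z → *-congˡ
          (edges-cong {α ⊓ λ x → G x z} {γ = γ ⊓ λ y → Q y z} (λ _ → ≡.refl) (λ _ → ≡.refl) λ x y → cl-cong (suc k) Q λ w →
            ≡.trans (∧-rotate (a w ∧ G x w) (Q y w) (Q z w))
              (≡.cong (_∧ Q y w) (∧-rotate (a w) (G x w) (Q z w)))))

      -- The cost of replacing the edges at one vertex x of the clique.

      star-error : ℕ → (α a : ℤ → Bool) → ℝ
      star-error k α a = ∑ V λ x → ⟦ α x ⟧ * (cl k Q (a ⊓ G x) - p ^ k * cl k Q (a ⊓ Q x))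

      -- The edge xy is split as pQ + X. In the Q-part y turns into a fixed Q-neighbour of x and of
      -- the remaining vertices, and x has one edge fewer to replace.
      star-error-suc : ∀ k α a → star-error (suc k) α a ≈
        edges α a (λ x y → cl k Q (a ⊓ G x ⊓ Q y)) +
        p * ∑ V (λ y → ⟦ a y ⟧ * star-error k (α ⊓ λ x → Q x y) (a ⊓ Q y))
      star-error-suc k α a = begin-equality
        star-error (suc k) α a
          ≈⟨ ∑-cong V (λ x → *-congˡ (+-congˡ (-‿cong (≈-sym (∑-*ˡ V _ _))))) ⟩
        ∑ V (λ x → ⟦ α x ⟧ * (∑ V (λ y → ⟦ a y ∧ G x y ⟧ * c x y) - ∑ V (λ y → (p * p ^ k) * (⟦ a y ∧ Q x y ⟧ * d x y))))
          ≈⟨ ∑-cong V (λ x → *-congˡ (≈-sym (∑-- V _ _))) ⟩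
        ∑ V (λ x → ⟦ α x ⟧ * ∑ V (λ y → ⟦ a y ∧ G x y ⟧ * c x y - (p * p ^ k) * (⟦ a y ∧ Q x y ⟧ * d x y)))
          ≈⟨ ∑-cong V (λ x → ≈-trans (≈-sym (∑-*ˡ V _ _)) (∑-cong V λ y → pointwise x y)) ⟩
        ∑ V (λ x → ∑ V λ y → ⟦ α x ⟧ * (⟦ a y ⟧ * (X x y * c x y)) + p * (⟦ a y ⟧ * T x y))
          ≈⟨ ∑-cong V (λ x → ∑-+ V _ _) ⟩
        ∑ V (λ x → ∑ V (λ y → ⟦ α x ⟧ * (⟦ a y ⟧ * (X x y * c x y))) + ∑ V (λ y → p * (⟦ a y ⟧ * T x y)))
          ≈⟨ ∑-+ V _ _ ⟩
        ∑ V (λ x → ∑ V λ y → ⟦ α x ⟧ * (⟦ a y ⟧ * (X x y * c x y))) + ∑ V (λ x → ∑ V λ y → p * (⟦ a y ⟧ * T x y))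
          ≈⟨ +-cong (∑-cong V λ x → ∑-*ˡ V _ _) (begin-equality
               ∑ V (λ x → ∑ V λ y → p * (⟦ a y ⟧ * T x y))  ≈⟨ ∑-swap V V _ ⟩
               ∑ V (λ y → ∑ V λ x → p * (⟦ a y ⟧ * T x y))  ≈⟨ ∑-cong V (λ y → ≈-trans (∑-*ˡ V _ _) (*-congˡ (∑-*ˡ V _ _))) ⟩
               ∑ V (λ y → p * (⟦ a y ⟧ * ∑ V λ x → T x y))  ≈⟨ ∑-*ˡ V _ _ ⟩
               p * ∑ V (λ y → ⟦ a y ⟧ * ∑ V λ x → T x y)    ∎) ⟩
        edges α a c + p * ∑ V (λ y → ⟦ a y ⟧ * ∑ V λ x → T x y)
          ≈⟨ +-congˡ (*-congˡ (∑-cong V λ y → *-congˡ (∑-cong V λ x → *-congˡ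
               (+-cong (rotated (G x) y) (-‿cong (*-congˡ (rotated (Q x) y))))))) ⟩
        edges α a c + p * ∑ V (λ y → ⟦ a y ⟧ * star-error k (α ⊓ λ x → Q x y) (a ⊓ Q y)) ∎
        where
        c d T : ℤ → ℤ → ℝ
        c x y = cl k Q (a ⊓ G x ⊓ Q y)
        d x y = cl k Q (a ⊓ Q x ⊓ Q y)
        T x y = ⟦ α x ∧ Q x y ⟧ * (c x y - p ^ k * d x y)
        rotated : ∀ w y → cl k Q (a ⊓ w ⊓ Q y) ≈ cl k Q (a ⊓ Q y ⊓ w)
        rotated w y = cl-cong k Q λ z → ∧-rotate (a z) (w z) (Q y z)
        pointwise : ∀ x y →
          ⟦ α x ⟧ * (⟦ a y ∧ G x y ⟧ * c x y - (p * p ^ k) * (⟦ a y ∧ Q x y ⟧ * d x y)) ≈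
          ⟦ α x ⟧ * (⟦ a y ⟧ * (X x y * c x y)) + p * (⟦ a y ⟧ * T x y)
        pointwise x y = begin-equality
          ⟦ α x ⟧ * (⟦ a y ∧ G x y ⟧ * c x y - (p * p ^ k) * (⟦ a y ∧ Q x y ⟧ * d x y))
            ≈⟨ *-congˡ (+-cong (*-congʳ (≈-trans (⟦⟧-∧ (a y) (G x y)) (*-congˡ (split x y))))
                 (-‿cong (*-congˡ (*-congʳ (⟦⟧-∧ (a y) (Q x y)))))) ⟩
          ⟦ α x ⟧ * ((⟦ a y ⟧ * (p * ⟦ Q x y ⟧ + X x y)) * c x y - (p * p ^ k) * ((⟦ a y ⟧ * ⟦ Q x y ⟧) * d x y))
            ≈⟨ solve 8 (λ α a p Q X c P d →
                 α :* ((a :* (p :* Q :+ X)) :* c :- (p :* P) :* ((a :* Q) :* d)) :=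
                 α :* (a :* (X :* c)) :+ p :* (a :* ((α :* Q) :* (c :- P :* d)))) ≈-refl
                 ⟦ α x ⟧ ⟦ a y ⟧ p ⟦ Q x y ⟧ (X x y) (c x y) (p ^ k) (d x y) ⟩
          ⟦ α x ⟧ * (⟦ a y ⟧ * (X x y * c x y)) +
            p * (⟦ a y ⟧ * ((⟦ α x ⟧ * ⟦ Q x y ⟧) * (c x y - p ^ k * d x y)))
            ≈⟨ +-congˡ (*-congˡ (*-congˡ (*-congʳ (⟦⟧-∧ (α x) (Q x y))))) ⟨
          ⟦ α x ⟧ * (⟦ a y ⟧ * (X x y * c x y)) + p * (⟦ a y ⟧ * T x y) ∎

      star-error-1 : ∀ α a → star-error 1 α a ≈ edges α a (λ _ _ → 1#)
      star-error-1 α a = ≈-trans (star-error-suc 0 α a) (≈-trans (+-congˡ vanishes) (+-identityʳ _))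
        where
        vanishes : p * ∑ V (λ y → ⟦ a y ⟧ * star-error 0 (α ⊓ λ x → Q x y) (a ⊓ Q y)) ≈ 0#
        vanishes = ≈-trans (*-congˡ (≈-trans
          (∑-cong V λ y → ≈-trans (*-congˡ (≈-trans
            (∑-cong V λ x → solve 1 (λ a → a :* (con (+ 1) :- con (+ 1) :* con (+ 1)) := con (+ 0)) ≈-refl _)
            (∑-0 V))) (zeroʳ _)) (∑-0 V))) (zeroʳ p)

      -- Each of the 2 + k edges at x costs `β` times the same clique count. The last edge has no
      -- vertex left to complete it; the vertex y fixed just before closes its triangle, which is
      -- why at least two edges are required.
      star-error-bound : ∀ k {α a q} → α ⊆ q → a ⊆ q →
        ∣ star-error (2 ℕ.+ k) α a ∣≤ (ι (2 ℕ.+ k) * β) * cl (2 ℕ.+ k) Q q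
      star-error-bound k {α} {a} {q} α⊆q a⊆q = abs-cong (≈-sym (star-error-suc (suc k) α a))
        (abs-mono (≤-reflexive (solve 3 (λ b c n → b :* c :+ (n :* b) :* c := ((con (+ 1) :+ n) :* b) :* c)
            ≈-refl β (cl (2 ℕ.+ k) Q q) (ι (suc k))))
          (abs-+ (edges-in-cliques k α⊆q a⊆q a⊆q)
            (abs-*-≤1 0≤p p≤1 (*-nonNeg 0≤kβ (cl-nonNeg (2 ℕ.+ k) Q q)) (rest k))))
        where
        0≤kβ : 0# ≤ ι (suc k) * β
        0≤kβ = *-nonNeg (0≤ι (suc k)) 0≤β
        rest : ∀ k → ∣ ∑ V (λ y → ⟦ a y ⟧ * star-error (suc k) (α ⊓ λ x → Q x y) (a ⊓ Q y)) ∣≤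
                     (ι (suc k) * β) * cl (2 ℕ.+ k) Q q
        rest zero = abs-cong (∑-cong V λ y → *-congˡ (≈-trans
            (edges-cong {α ⊓ λ x → Q x y} {γ = a ⊓ λ x → Q x y} (λ _ → ≡.refl) (λ x → ≡.cong (a x ∧_) (Q-sym x y)) λ _ _ → ≈-refl)
            (≈-sym (star-error-1 (α ⊓ λ x → Q x y) (a ⊓ Q y)))))
          -- `ι 1` unfolds to `1# + 0#`, hence this spelling of the factor 1.
          (abs-mono (≤-reflexive (solve 2 (λ b c → b :* c := ((con (+ 1) :+ con (+ 0)) :* b) :* c) ≈-refl β (cl 2 Q q)))
            (edges-in-triangles {α} {a} {a} α⊆q a⊆q a⊆q (⊑-refl Q) (⊑-refl Q)))
        rest (suc k) = in-context {a} (2 ℕ.+ k) (*-nonNeg (0≤ι (2 ℕ.+ k)) 0≤β) a⊆q λ y →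
          star-error-bound k {α ⊓ λ x → Q x y} {a ⊓ Q y} (transposed Q-sym α⊆q (⊑-refl Q) y) (⊓-⊆ a⊆q (⊑-refl Q y))

      error : ℕ → (ℤ → Bool) → ℝ
      error k a = cl k G a - p ^ tri k * cl k Q a

      -- With the first vertex x fixed, the k other vertices pass from G-cliques to Q-cliques while
      -- still inside the G-neighbourhood of x; afterwards the k edges at x are replaced.
      error-suc : ∀ k a → error (suc k) a ≈
        ∑ V (λ x → ⟦ a x ⟧ * error k (a ⊓ G x)) + p ^ tri k * star-error k a a
      error-suc k a = ≈-sym (begin-equality
        ∑ V (λ x → ⟦ a x ⟧ * error k (a ⊓ G x)) + p ^ tri k * star-error k a a
          ≈⟨ +-congˡ (∑-*ˡ V _ _) ⟨
        ∑ V (λ x → ⟦ a x ⟧ * error k (a ⊓ G x)) + ∑ V (λ x → p ^ tri k * (⟦ a x ⟧ *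
          (cl k Q (a ⊓ G x) - p ^ k * cl k Q (a ⊓ Q x))))
          ≈⟨ ∑-+ V _ _ ⟨
        ∑ V (λ x → ⟦ a x ⟧ * error k (a ⊓ G x) + p ^ tri k * (⟦ a x ⟧ *
          (cl k Q (a ⊓ G x) - p ^ k * cl k Q (a ⊓ Q x))))
          ≈⟨ ∑-cong V (λ x → solve 6 (λ a g t c P d →
               a :* (g :- t :* c) :+ t :* (a :* (c :- P :* d)) := a :* g :- (P :* t) :* (a :* d)) ≈-refl
               ⟦ a x ⟧ (cl k G (a ⊓ G x)) (p ^ tri k) (cl k Q (a ⊓ G x)) (p ^ k) (cl k Q (a ⊓ Q x))) ⟩
        ∑ V (λ x → ⟦ a x ⟧ * cl k G (a ⊓ G x) - (p ^ k * p ^ tri k) * (⟦ a x ⟧ * cl k Q (a ⊓ Q x)))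
          ≈⟨ ∑-- V _ _ ⟩
        cl (suc k) G a - ∑ V (λ x → (p ^ k * p ^ tri k) * (⟦ a x ⟧ * cl k Q (a ⊓ Q x)))
          ≈⟨ +-congˡ (-‿cong (≈-trans (∑-*ˡ V _ _) (*-congʳ (≈-sym (^-homo-* p k (tri k)))))) ⟩
        error (suc k) a ∎)

      error-2 : ∀ a → error 2 a ≈ edges a a (λ _ _ → 1#)
      error-2 a = begin-equality
        error 2 a
          ≈⟨ error-suc 1 a ⟩
        ∑ V (λ x → ⟦ a x ⟧ * error 1 (a ⊓ G x)) + 1# * star-error 1 a a
          ≈⟨ +-cong (≈-trans (∑-cong V λ x → ≈-trans (*-congˡ
               (solve 1 (λ s → s :- con (+ 1) :* s := con (+ 0)) ≈-refl (cl 1 G (a ⊓ G x)))) (zeroʳ _)) (∑-0 V))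
               (≈-trans (*-identityˡ _) (star-error-1 a a)) ⟩
        0# + edges a a (λ _ _ → 1#)
          ≈⟨ +-identityˡ _ ⟩
        edges a a (λ _ _ → 1#) ∎

      -- One term `β` for each edge of the clique. A lone edge has no such bound by itself;
      -- `error 2` occurs only within the G-neighbourhood of a vertex x, which makes it a side of a
      -- triangle.
      error-bound : ∀ k {a q} → a ⊆ q →
        ∣ error (3 ℕ.+ k) a ∣≤ (ι (tri (3 ℕ.+ k)) * β) * cl (2 ℕ.+ k) Q q
      error-bound k {a} {q} a⊆q = abs-cong (≈-sym (error-suc (2 ℕ.+ k) a))
        (abs-mono (≤-reflexive (begin-equality
            (ι (tri (2 ℕ.+ k)) * β) * C + (ι (2 ℕ.+ k) * β) * C
              ≈⟨ solve 4 (λ s t b c → (t :* b) :* c :+ (s :* b) :* c := ((s :+ t) :* b) :* c) ≈-refl _ _ _ _ ⟩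
            ((ι (2 ℕ.+ k) + ι (tri (2 ℕ.+ k))) * β) * C
              ≈⟨ *-congʳ (*-congʳ (×-homo-+ 1# (2 ℕ.+ k) (tri (2 ℕ.+ k)))) ⟨
            (ι (tri (3 ℕ.+ k)) * β) * C ∎))
          (abs-+ (rest k) (abs-*-≤1 (^-nonNeg τ 0≤p) (^-≤1 τ 0≤p p≤1)
            (*-nonNeg (*-nonNeg (0≤ι (2 ℕ.+ k)) 0≤β) (cl-nonNeg (2 ℕ.+ k) Q q)) (star-error-bound k a⊆q a⊆q))))
        where
        C = cl (2 ℕ.+ k) Q q
        τ = tri (2 ℕ.+ k)
        rest : ∀ k → ∣ ∑ V (λ x → ⟦ a x ⟧ * error (2 ℕ.+ k) (a ⊓ G x)) ∣≤
                     (ι (tri (2 ℕ.+ k)) * β) * cl (2 ℕ.+ k) Q q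
        rest zero = abs-cong (∑-cong V λ x → *-congˡ (≈-trans
            (edges-cong {a ⊓ λ y → G y x}  {γ = a ⊓ λ y → G y x} (λ y → ≡.cong (a y ∧_) (G-sym y x)) (λ y → ≡.cong (a y ∧_) (G-sym y x)) λ _ _ → ≈-refl)
            (≈-sym (error-2 (a ⊓ G x)))))
          (abs-mono (≤-reflexive (solve 2 (λ b c → b :* c := ((con (+ 1) :+ con (+ 0)) :* b) :* c) ≈-refl β (cl 2 Q q)))
            (edges-in-triangles {a} {a} {a} a⊆q a⊆q a⊆q G⊑Q G⊑Q))
        rest (suc k) = in-context {a} (2 ℕ.+ k) (*-nonNeg (0≤ι (tri (3 ℕ.+ k))) 0≤β) a⊆q λ x →
          error-bound k {a ⊓ G x} (⊓-⊆ a⊆q (G⊑Q x))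

  -- Upper and lower bounds on clique counts

  ∑-mono-∈ : ∀ {A : Set} (V : List A) {f g} → (∀ {x} → x ∈ V → f x ≤ g x) → ∑ V f ≤ ∑ V g
  ∑-mono-∈ []      f≤g = ≤-refl
  ∑-mono-∈ (x ∷ V) f≤g = +-mono-≤ (f≤g (here ≡.refl)) (∑-mono-∈ V (λ y∈ → f≤g (there y∈)))

  module CliqueBounds (V : List ℤ) where
    open Box V
    open Cliques V

    everything : ℤ → Bool
    everything _ = true

    -- The edges between the first two vertices and the others are forgotten.
    cl-2+k : ∀ k w a → cl (2 ℕ.+ k) w a ≤ cl 2 w a * cl k w a
    cl-2+k k w a = begin
      cl (2 ℕ.+ k) w a
        ≤⟨ ∑-mono V (λ x → *-monoˡ-≤ (⟦⟧-nonNeg (a x)) (∑-mono V λ y →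
             *-monoˡ-≤ (⟦⟧-nonNeg (a y ∧ w x y)) (shrink x y))) ⟩
      ∑ V (λ x → ⟦ a x ⟧ * ∑ V (λ y → ⟦ a y ∧ w x y ⟧ * cl k w a))
        ≈⟨ ∑-cong V (λ x → *-congˡ (≈-trans (∑-cong V λ y → *-congʳ (≈-sym (*-identityʳ _))) (∑-*ʳ V _ _))) ⟩
      ∑ V (λ x → ⟦ a x ⟧ * (∑ V (λ y → ⟦ a y ∧ w x y ⟧ * 1#) * cl k w a))
        ≈⟨ ≈-trans (∑-cong V λ x → ≈-sym (*-assoc _ _ _)) (∑-*ʳ V _ _) ⟩
      cl 2 w a * cl k w a ∎
      where
      ⊓-⊆ˡ : ∀ b c → b ⊓ c ⊆ b
      ⊓-⊆ˡ b c x eq with b x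
      ... | true = ≡.refl
      shrink : ∀ x y → cl k w (a ⊓ w x ⊓ w y) ≤ cl k w a
      shrink x y = ≤-trans
        (cl-mono k {a = a ⊓ w x ⊓ w y} (λ _ _ eq → eq) (⊓-⊆ˡ (a ⊓ w x) (w y)))
        (cl-mono k {a = a ⊓ w x} (λ _ _ eq → eq) (⊓-⊆ˡ a (w x)))

    norm²-edges : ∀ w → norm² (λ x y → ⟦ w x y ⟧) ≈ cl 2 w everything
    norm²-edges w = ≈-trans (norm²-⟦⟧ w) (≈-sym (≈-trans (cl-2 w everything)
      (∑-cong₂ V V λ x y → *-identityˡ _)))

    -- Triangles are counted by the triangle form at the adjacency matrix W itself, to which the box
    -- inequality applies because κ(W) ≤ ‖W‖⁴ ≤ s⁴.
    cl-3 : ∀ w {s} → 0# ≤ s → cl 2 w everything ≤ s * s → cl 3 w everything ≤ s * (s * s)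
    cl-3 w {s} 0≤s ≤ss = ≤-respˡ-≈ (≈-sym cl≈)
      (proj₁ (box-inequality W W W 0≤s (x*x-nonNeg s) κ≤ norm≤ norm≤))
      where
      W : ℤ → ℤ → ℝ
      W x y = ⟦ w x y ⟧
      norm≤ : norm² W ≤ s * s
      norm≤ = ≤-respˡ-≈ (≈-sym (norm²-edges w)) ≤ss
      κ≤ : κ W ≤ (s * s) * (s * s)
      κ≤ = ≤-trans (κ-≤-norm⁴ W) (*-mono-≤ (norm²-nonNeg W) (x*x-nonNeg s) norm≤ norm≤)
      cl≈ : cl 3 w everything ≈ triangles W W W
      cl≈ = ∑-cong V λ x → ≈-trans (*-identityˡ _) (∑-cong V λ y →
        ≈-trans (≈-sym (∑-*ˡ V _ _)) (∑-cong V λ z →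
          *-congˡ (≈-trans (*-identityʳ _) (⟦⟧-∧ (w x z) (w y z)))))

    -- An edge is split off at a time, each worth s², so the recursion goes down by two and ends at
    -- an edge or a triangle.
    cl-upper : ∀ k w {s} → 0# ≤ s → cl 2 w everything ≤ s * s → cl (2 ℕ.+ k) w everything ≤ s ^ (2 ℕ.+ k)
    cl-upper 0 w {s} 0≤s ≤ss =
      ≤-respʳ-≈ (solve 1 (λ s → s :* s := s :* (s :* con (+ 1))) ≈-refl s) ≤ss
    cl-upper 1 w {s} 0≤s ≤ss = ≤-respʳ-≈
      (solve 1 (λ s → s :* (s :* s) := s :* (s :* (s :* con (+ 1)))) ≈-refl s) (cl-3 w 0≤s ≤ss)
    cl-upper (suc (suc k)) w {s} 0≤s ≤ss = begin
      cl (4 ℕ.+ k) w everything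
        ≤⟨ cl-2+k (2 ℕ.+ k) w everything ⟩
      cl 2 w everything * cl (2 ℕ.+ k) w everything
        ≤⟨ *-mono-≤ (cl-nonNeg 2 w everything) (^-nonNeg (2 ℕ.+ k) 0≤s) ≤ss (cl-upper k w 0≤s ≤ss) ⟩
      (s * s) * s ^ (2 ℕ.+ k)
        ≈⟨ *-assoc _ _ _ ⟩
      s ^ (4 ℕ.+ k) ∎

    -- Greedy choice: a chosen vertex rules out at most one candidate, so at each of the `k` choices
    -- at least `c` candidates remain.
    cl-lower : ∀ w → (∀ a {x} → x ∈ V → ∑ V (λ y → ⟦ a y ⟧) ≤ 1# + ∑ V (λ y → ⟦ a y ∧ w x y ⟧)) →
               ∀ k a {c} → 0# ≤ c → c + ι k ≤ ∑ V (λ y → ⟦ a y ⟧) → c ^ k ≤ cl k w a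
    cl-lower w co-degree zero    a 0≤c c≤ = ≤-refl
    cl-lower w co-degree (suc k) a {c} 0≤c c≤ = begin
      c * c ^ k
        ≤⟨ *-monoʳ-≤ (^-nonNeg k 0≤c) (≤-trans (x≤x+nonNeg (0≤ι (suc k))) c≤) ⟩
      ∑ V (λ x → ⟦ a x ⟧) * c ^ k
        ≈⟨ ∑-*ʳ V _ _ ⟨
      ∑ V (λ x → ⟦ a x ⟧ * c ^ k)
        ≤⟨ ∑-mono-∈ V (λ {x} x∈ → *-monoˡ-≤ (⟦⟧-nonNeg (a x)) (cl-lower w co-degree k (a ⊓ w x) 0≤c (rest x∈))) ⟩
      cl (suc k) w a ∎
      where
      rest : ∀ {x} → x ∈ V → c + ι k ≤ ∑ V (λ y → ⟦ a y ∧ w x y ⟧)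
      rest {x} x∈ = ≤-by (x≤y⇒0≤y-x (≤-trans c≤ (co-degree a x∈)))
        (solve 3 (λ c k S → S :- (c :+ k) := (con (+ 1) :+ S) :- (c :+ (con (+ 1) :+ k))) ≈-refl c (ι k) _)

    module _ (w : ℤ → ℤ → Bool) (w-sym : ∀ x y → w x y ≡ w y x) (l : ℤ → Bool) where

      cl-through : ℕ → (ℤ → Bool) → ℝ
      cl-through k a = ∑ V λ y → ⟦ a y ∧ not (l y) ⟧ * cl k w (a ⊓ w y)

      private
        -- The union bound over the position of a vertex outside `l`; all positions count alike.
        remainder : ℕ → (ℤ → Bool) → ℝ
        remainder zero    a = 0#
        remainder (suc k) a = ι (suc k) * cl-through k a

        remainder-nonNeg : ∀ k a → 0# ≤ remainder k a
        remainder-nonNeg zero    a = ≤-refl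
        remainder-nonNeg (suc k) a = *-nonNeg (0≤ι (suc k))
          (∑-nonNeg V λ y → *-nonNeg (⟦⟧-nonNeg (a y ∧ not (l y))) (cl-nonNeg k w _))

        ⟦⟧-split : ∀ b c → ⟦ b ⟧ ≈ ⟦ b ∧ c ⟧ + ⟦ b ∧ not c ⟧
        ⟦⟧-split true  true  = ≈-sym (+-identityʳ _)
        ⟦⟧-split true  false = ≈-sym (+-identityˡ _)
        ⟦⟧-split false c     = ≈-sym (+-identityˡ _)

        ∧-swap : ∀ b c d e → ⟦ b ⟧ * ⟦ (c ∧ d) ∧ e ⟧ ≈ ⟦ c ∧ e ⟧ * ⟦ b ∧ d ⟧
        ∧-swap b c d e = begin-equality
          ⟦ b ⟧ * ⟦ (c ∧ d) ∧ e ⟧            ≈⟨ *-congˡ (≈-trans (⟦⟧-∧ (c ∧ d) e) (*-congʳ (⟦⟧-∧ c d))) ⟩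
          ⟦ b ⟧ * ((⟦ c ⟧ * ⟦ d ⟧) * ⟦ e ⟧)  ≈⟨ solve 4 (λ b c d e → b :* ((c :* d) :* e) := (c :* e) :* (b :* d)) ≈-refl _ _ _ _ ⟩
          (⟦ c ⟧ * ⟦ e ⟧) * (⟦ b ⟧ * ⟦ d ⟧)  ≈⟨ *-cong (⟦⟧-∧ c e) (⟦⟧-∧ b d) ⟨
          ⟦ c ∧ e ⟧ * ⟦ b ∧ d ⟧              ∎

        -- Symmetry of `w` allows the vertex y outside `l` to be exchanged with the first vertex x.
        remainder-sum : ∀ k a → ∑ V (λ x → ⟦ a x ⟧ * remainder k (a ⊓ w x)) ≈ ι k * cl-through k a
        remainder-sum zero a = ≈-trans (≈-trans (∑-cong V λ x → zeroʳ _) (∑-0 V)) (≈-sym (zeroˡ _))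
        remainder-sum (suc k) a = begin-equality
          ∑ V (λ x → ⟦ a x ⟧ * (ι (suc k) * cl-through k (a ⊓ w x)))
            ≈⟨ ≈-trans (∑-cong V λ x → solve 3 (λ a b c → a :* (b :* c) := b :* (a :* c)) ≈-refl _ _ _) (∑-*ˡ V _ _) ⟩
          ι (suc k) * ∑ V (λ x → ⟦ a x ⟧ * cl-through k (a ⊓ w x))
            ≈⟨ *-congˡ (∑-cong V λ x → ∑-*ˡ V _ _) ⟨
          ι (suc k) * ∑ V (λ x → ∑ V λ y → ⟦ a x ⟧ * (⟦ (a y ∧ w x y) ∧ not (l y) ⟧ * cl k w (a ⊓ w x ⊓ w y)))
            ≈⟨ *-congˡ (∑-swap V V _) ⟩
          ι (suc k) * ∑ V (λ y → ∑ V λ x → ⟦ a x ⟧ * (⟦ (a y ∧ w x y) ∧ not (l y) ⟧ * cl k w (a ⊓ w x ⊓ w y)))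
            ≈⟨ *-congˡ (∑-cong₂ V V pointwise) ⟩
          ι (suc k) * ∑ V (λ y → ∑ V λ x → ⟦ a y ∧ not (l y) ⟧ * (⟦ a x ∧ w y x ⟧ * cl k w (a ⊓ w y ⊓ w x)))
            ≈⟨ *-congˡ (∑-cong V λ y → ∑-*ˡ V _ _) ⟩
          ι (suc k) * cl-through (suc k) a ∎
          where
          pointwise : ∀ y x → ⟦ a x ⟧ * (⟦ (a y ∧ w x y) ∧ not (l y) ⟧ * cl k w (a ⊓ w x ⊓ w y)) ≈
                              ⟦ a y ∧ not (l y) ⟧ * (⟦ a x ∧ w y x ⟧ * cl k w (a ⊓ w y ⊓ w x))
          pointwise y x = begin-equality
            ⟦ a x ⟧ * (⟦ (a y ∧ w x y) ∧ not (l y) ⟧ * cl k w (a ⊓ w x ⊓ w y))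
              ≈⟨ *-assoc _ _ _ ⟨
            (⟦ a x ⟧ * ⟦ (a y ∧ w x y) ∧ not (l y) ⟧) * cl k w (a ⊓ w x ⊓ w y)
              ≈⟨ *-cong (∧-swap (a x) (a y) (w x y) (not (l y))) (cl-cong k w λ z → ∧-rotate (a z) (w x z) (w y z)) ⟩
            (⟦ a y ∧ not (l y) ⟧ * ⟦ a x ∧ w x y ⟧) * cl k w (a ⊓ w y ⊓ w x)
              ≈⟨ *-congʳ (*-congˡ (reflexive (≡.cong (λ b → ⟦ a x ∧ b ⟧) (w-sym x y)))) ⟩
            (⟦ a y ∧ not (l y) ⟧ * ⟦ a x ∧ w y x ⟧) * cl k w (a ⊓ w y ⊓ w x)
              ≈⟨ *-assoc _ _ _ ⟩
            ⟦ a y ∧ not (l y) ⟧ * (⟦ a x ∧ w y x ⟧ * cl k w (a ⊓ w y ⊓ w x)) ∎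

        cl-restrict′ : ∀ k a → cl k w a ≤ cl k w (a ⊓ l) + remainder k a
        cl-restrict′ zero    a = ≤-reflexive (≈-sym (+-identityʳ _))
        cl-restrict′ (suc k) a = begin
          ∑ V (λ x → ⟦ a x ⟧ * cl k w (a ⊓ w x))
            ≈⟨ ≈-trans (∑-cong V λ x → ≈-trans (*-congʳ (⟦⟧-split (a x) (l x))) (distribʳ _ _ _)) (∑-+ V _ _) ⟩
          ∑ V (λ x → ⟦ a x ∧ l x ⟧ * cl k w (a ⊓ w x)) + cl-through k a
            ≤⟨ +-monoˡ-≤ _ (∑-mono V pointwise) ⟩
          ∑ V (λ x → ⟦ a x ∧ l x ⟧ * cl k w (a ⊓ l ⊓ w x) + ⟦ a x ⟧ * remainder k (a ⊓ w x)) + cl-through k a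
            ≈⟨ +-congʳ (≈-trans (∑-+ V _ _) (+-congˡ (remainder-sum k a))) ⟩
          (cl (suc k) w (a ⊓ l) + ι k * cl-through k a) + cl-through k a
            ≈⟨ solve 3 (λ c k t → (c :+ k :* t) :+ t := c :+ (con (+ 1) :+ k) :* t) ≈-refl _ _ _ ⟩
          cl (suc k) w (a ⊓ l) + ι (suc k) * cl-through k a ∎
          where
          pointwise : ∀ x → ⟦ a x ∧ l x ⟧ * cl k w (a ⊓ w x) ≤
                            ⟦ a x ∧ l x ⟧ * cl k w (a ⊓ l ⊓ w x) + ⟦ a x ⟧ * remainder k (a ⊓ w x)
          pointwise x = begin
            ⟦ a x ∧ l x ⟧ * cl k w (a ⊓ w x)
              ≤⟨ *-monoˡ-≤ (⟦⟧-nonNeg (a x ∧ l x)) (cl-restrict′ k (a ⊓ w x)) ⟩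
            ⟦ a x ∧ l x ⟧ * (cl k w (a ⊓ w x ⊓ l) + remainder k (a ⊓ w x))
              ≈⟨ distribˡ _ _ _ ⟩
            ⟦ a x ∧ l x ⟧ * cl k w (a ⊓ w x ⊓ l) + ⟦ a x ∧ l x ⟧ * remainder k (a ⊓ w x)
              ≤⟨ +-mono-≤ (≤-reflexive (*-congˡ (cl-cong k w λ z → ∧-rotate (a z) (w x z) (l z))))
                   (*-monoʳ-≤ (remainder-nonNeg k (a ⊓ w x)) (⟦⟧-mono (∧-true (a x)))) ⟩
            ⟦ a x ∧ l x ⟧ * cl k w (a ⊓ l ⊓ w x) + ⟦ a x ⟧ * remainder k (a ⊓ w x) ∎
            where
            ∧-true : ∀ b {c} → b ∧ c ⇒ b
            ∧-true true _ = ≡.refl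

      -- A clique not inside `l` has a vertex outside it in one of `suc k` positions, and the other
      -- vertices form some `k`-clique.
      cl-restrict : ∀ k → cl (suc k) w everything ≤
        cl (suc k) w l + (ι (suc k) * ∑ V (λ y → ⟦ not (l y) ⟧)) * cl k w everything
      cl-restrict k = ≤-trans (cl-restrict′ (suc k) everything) (+-monoʳ-≤ _ (begin
        ι (suc k) * cl-through k everything
          ≤⟨ *-monoˡ-≤ (0≤ι (suc k)) (∑-mono V λ y → *-monoˡ-≤ (⟦⟧-nonNeg (not (l y)))
               (cl-mono k {a = everything ⊓ w y} (λ _ _ eq → eq) λ _ _ → ≡.refl)) ⟩
        ι (suc k) * ∑ V (λ y → ⟦ not (l y) ⟧ * cl k w everything)
          ≈⟨ *-congˡ (∑-*ʳ V _ _) ⟩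
        ι (suc k) * (∑ V (λ y → ⟦ not (l y) ⟧) * cl k w everything)
          ≈⟨ *-assoc _ _ _ ⟨
        (ι (suc k) * ∑ V (λ y → ⟦ not (l y) ⟧)) * cl k w everything ∎))

  -- Edge counts and indicators of pairs

  ∑-δ : ∀ {V} v → Unique V → ∑ V (λ y → ⟦ does (y ℤ.≟ v) ⟧) ≤ 1#
  ∑-δ v [] = 0≤1
  ∑-δ {y ∷ V} v (y∉V ∷ uV) with y ℤ.≟ v
  ... | yes ≡.refl = ≤-reflexive (≈-trans (+-congˡ (zeros V y∉V)) (+-identityʳ _))
    where
    zeros : ∀ W → All (y ≢_) W → ∑ W (λ z → ⟦ does (z ℤ.≟ y) ⟧) ≈ 0#
    zeros []      []          = ≈-refl
    zeros (z ∷ W) (y≢z ∷ y∉W) with z ℤ.≟ y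
    ... | yes z≡y = ⊥-elim (y≢z (≡.sym z≡y))
    ... | no  _   = ≈-trans (+-identityˡ _) (zeros W y∉W)
  ... | no _ = ≤-respˡ-≈ (≈-sym (+-identityˡ _)) (∑-δ v uV)

  ⟦∨⟧≤ : ∀ b c → ⟦ b ∨ c ⟧ ≤ ⟦ b ⟧ + ⟦ c ⟧
  ⟦∨⟧≤ true  c = x≤x+nonNeg (⟦⟧-nonNeg c)
  ⟦∨⟧≤ false c = ≤-reflexive (≈-sym (+-identityˡ _))

  ∑-mem≤ : ∀ {V} → Unique V → ∀ L → ∑ V (λ x → ∑ V λ y → ⟦ mem L x y ⟧) ≤ ι (length L)
  ∑-mem≤ {V} uV [] = ≤-reflexive (≈-trans (∑-cong V λ x → ∑-0 V) (∑-0 V))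
  ∑-mem≤ {V} uV ((u , v) ∷ L) = begin
    ∑ V (λ x → ∑ V λ y → ⟦ (does (x ℤ.≟ u) ∧ does (y ℤ.≟ v)) ∨ mem L x y ⟧)
      ≤⟨ ∑-mono₂ V V (λ x y → ≤-trans (⟦∨⟧≤ (does (x ℤ.≟ u) ∧ does (y ℤ.≟ v)) (mem L x y))
           (≤-reflexive (+-congʳ (⟦⟧-∧ (does (x ℤ.≟ u)) (does (y ℤ.≟ v)))))) ⟩
    ∑ V (λ x → ∑ V λ y → ⟦ does (x ℤ.≟ u) ⟧ * ⟦ does (y ℤ.≟ v) ⟧ + ⟦ mem L x y ⟧)
      ≈⟨ ≈-trans (∑-cong V λ x → ∑-+ V _ _) (∑-+ V _ _) ⟩
    ∑ V (λ x → ∑ V λ y → ⟦ does (x ℤ.≟ u) ⟧ * ⟦ does (y ℤ.≟ v) ⟧) + ∑ V (λ x → ∑ V λ y → ⟦ mem L x y ⟧)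
      ≈⟨ +-congʳ (∑-*-∑ V V _ _) ⟨
    ∑ V (λ x → ⟦ does (x ℤ.≟ u) ⟧) * ∑ V (λ y → ⟦ does (y ℤ.≟ v) ⟧) + ∑ V (λ x → ∑ V λ y → ⟦ mem L x y ⟧)
      ≤⟨ +-mono-≤ (≤-respʳ-≈ (*-identityˡ 1#) (*-mono-≤ (∑-nonNeg V λ x → ⟦⟧-nonNeg (does (x ℤ.≟ u))) 0≤1
           (∑-δ u uV) (∑-δ v uV))) (∑-mem≤ uV L) ⟩
    1# + ι (length L) ∎

  ∑-adj≤ : ∀ {V} → Unique V → ∀ L → ∑ V (λ x → ∑ V λ y → ⟦ adj L x y ⟧) ≤ ι (length L) + ι (length L)
  ∑-adj≤ {V} uV L = begin
    ∑ V (λ x → ∑ V λ y → ⟦ mem L x y ∨ mem L y x ⟧)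
      ≤⟨ ∑-mono₂ V V (λ x y → ⟦∨⟧≤ (mem L x y) (mem L y x)) ⟩
    ∑ V (λ x → ∑ V λ y → ⟦ mem L x y ⟧ + ⟦ mem L y x ⟧)
      ≈⟨ ≈-trans (∑-cong V λ x → ∑-+ V _ _) (∑-+ V _ _) ⟩
    ∑ V (λ x → ∑ V λ y → ⟦ mem L x y ⟧) + ∑ V (λ x → ∑ V λ y → ⟦ mem L y x ⟧)
      ≈⟨ +-congˡ (∑-swap V V _) ⟩
    ∑ V (λ x → ∑ V λ y → ⟦ mem L x y ⟧) + ∑ V (λ y → ∑ V λ x → ⟦ mem L y x ⟧)
      ≤⟨ +-mono-≤ (∑-mem≤ uV L) (∑-mem≤ uV L) ⟩
    ι (length L) + ι (length L) ∎

  -- Freshness makes the disjunction exclusive, hence a sum.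
  mem-cons : ∀ L {u v} → (u , v) ∉ L → ∀ x y →
    ⟦ mem ((u , v) ∷ L) x y ⟧ ≈ ⟦ mem L x y ⟧ + ⟦ does (x ℤ.≟ u) ⟧ * ⟦ does (y ℤ.≟ v) ⟧
  mem-cons L {u} {v} fresh x y with x ℤ.≟ u | y ℤ.≟ v
  ... | yes ≡.refl | yes ≡.refl = ≈-sym (≈-trans
    (+-cong (reflexive (≡.cong ⟦_⟧ (∉⇒mem fresh))) (*-identityˡ 1#)) (+-identityˡ 1#))
  ... | yes _ | no _  = ≈-sym (≈-trans (+-congˡ (*-identityˡ 0#)) (+-identityʳ _))
  ... | no _  | yes _ = ≈-sym (≈-trans (+-congˡ (zeroˡ 1#)) (+-identityʳ _))
  ... | no _  | no _  = ≈-sym (≈-trans (+-congˡ (zeroˡ 0#)) (+-identityʳ _))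

  -- Expectations over the outcomes of a strategy, and the noise

  module Play (p : ℝ) (0≤p : 0# ≤ p) (p≤1 : p ≤ 1#) where

    0≤1-p : 0# ≤ 1# - p
    0≤1-p = x≤y⇒0≤y-x p≤1

    1-p≤1 : 1# - p ≤ 1#
    1-p≤1 = ≤-by 0≤p (solve 1 (λ p → con (+ 1) :- (con (+ 1) :- p) := p) ≈-refl p)

    𝔼 : (History → ℝ) → (h : History) → ∀ {n} → Strategy (asked h) n → ℝ
    𝔼 f h done = f h
    𝔼 f h (query u v _ _ S₁ S₀) =
      p * 𝔼 f (((u , v) , true) ∷ h) S₁ + (1# - p) * 𝔼 f (((u , v) , false) ∷ h) S₀

    expected≡𝔼 : ∀ H h {n} (S : Strategy (asked h) n) →
                 expected H p (built h) S ≡ 𝔼 (λ h → ι (#copies H (built h))) h S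
    expected≡𝔼 H h done = ≡.refl
    expected≡𝔼 H h (query u v _ _ S₁ S₀) = ≡.cong₂ (λ a b → p * a + (1# - p) * b)
      (expected≡𝔼 H _ S₁) (expected≡𝔼 H _ S₀)

    Outcomes : (History → Set) → (h : History) → ∀ {n} → Strategy (asked h) n → Set
    Outcomes P h done = P h
    Outcomes P h (query u v _ _ S₁ S₀) =
      Outcomes P (((u , v) , true) ∷ h) S₁ × Outcomes P (((u , v) , false) ∷ h) S₀

    outcomes-map : ∀ {P P′ : History → Set} → (∀ h → P h → P′ h) → ∀ h {n} (S : Strategy (asked h) n) →
                   Outcomes P h S → Outcomes P′ h S
    outcomes-map P⇒P′ h done o = P⇒P′ h o
    outcomes-map P⇒P′ h (query u v _ _ S₁ S₀) (o₁ , o₀) =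
      outcomes-map P⇒P′ _ S₁ o₁ , outcomes-map P⇒P′ _ S₀ o₀

    outcomes-zip : ∀ {P P′ : History → Set} h {n} (S : Strategy (asked h) n) →
                   Outcomes P h S → Outcomes P′ h S → Outcomes (λ h → P h × P′ h) h S
    outcomes-zip h done o o′ = o , o′
    outcomes-zip h (query u v _ _ S₁ S₀) (o₁ , o₀) (o₁′ , o₀′) =
      outcomes-zip _ S₁ o₁ o₁′ , outcomes-zip _ S₀ o₀ o₀′

    outcomes-valid : ∀ h {n} (S : Strategy (asked h) n) → Valid h →
                     Outcomes (λ h′ → Valid h′ × length h′ ≡ length h ℕ.+ n) h S
    outcomes-valid h done valid = valid , ≡.sym (ℕ.+-identityʳ (length h))
    outcomes-valid h {suc n} (query u v u<v _ S₁ S₀) valid =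
      outcomes-map shift _ S₁ (outcomes-valid _ S₁ (u<v ∷ valid)) ,
      outcomes-map shift _ S₀ (outcomes-valid _ S₀ (u<v ∷ valid))
      where
      shift : ∀ h′ → Valid h′ × length h′ ≡ suc (length h) ℕ.+ n →
              Valid h′ × length h′ ≡ length h ℕ.+ suc n
      shift h′ (val , eq) = val , ≡.trans eq (≡.sym (ℕ.+-suc (length h) n))

    -- The vertices of all branches: the sums run over one finite list that must not depend on the
    -- answers.
    vertices : ∀ {L n} → Strategy L n → List ℤ
    vertices done = []
    vertices (query u v _ _ S₁ S₀) = u ∷ v ∷ vertices S₁ ++ vertices S₀

    Within : List ℤ → List Pair → Set
    Within V L = ∀ {x y} → (x , y) ∈ L → x ∈ V × y ∈ V

    outcomes-within : ∀ V h {n} (S : Strategy (asked h) n) → Within V (asked h) →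
      (∀ {x} → x ∈ vertices S → x ∈ V) → Outcomes (λ h′ → Within V (asked h′)) h S
    outcomes-within V h done within _ = within
    outcomes-within V h (query u v _ _ S₁ S₀) within sub =
      outcomes-within V _ S₁ within′ (λ x∈ → sub (there (there (∈-++⁺ˡ x∈)))) ,
      outcomes-within V _ S₀ within′ (λ x∈ → sub (there (there (∈-++⁺ʳ (vertices S₁) x∈))))
      where
      within′ : Within V ((u , v) ∷ asked h)
      within′ (here ≡.refl) = sub (here ≡.refl) , sub (there (here ≡.refl))
      within′ (there e∈)    = within e∈

    𝔼-mono : ∀ {f g} h {n} (S : Strategy (asked h) n) → Outcomes (λ h → f h ≤ g h) h S → 𝔼 f h S ≤ 𝔼 g h S
    𝔼-mono h done o = o
    𝔼-mono h (query u v _ _ S₁ S₀) (o₁ , o₀) =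
      +-mono-≤ (*-monoˡ-≤ 0≤p (𝔼-mono _ S₁ o₁)) (*-monoˡ-≤ 0≤1-p (𝔼-mono _ S₀ o₀))

    mean-affine : ∀ c d x y → p * (c + d * x) + (1# - p) * (c + d * y) ≈ c + d * (p * x + (1# - p) * y)
    mean-affine = solve 5 (λ p c d x y → p :* (c :+ d :* x) :+ (con (+ 1) :- p) :* (c :+ d :* y) :=
      c :+ d :* (p :* x :+ (con (+ 1) :- p) :* y)) ≈-refl p

    𝔼-affine : ∀ c d f h {n} (S : Strategy (asked h) n) → 𝔼 (λ h → c + d * f h) h S ≈ c + d * 𝔼 f h S
    𝔼-affine c d f h done = ≈-refl
    𝔼-affine c d f h (query u v _ _ S₁ S₀) =
      ≈-trans (+-cong (*-congˡ (𝔼-affine c d f _ S₁)) (*-congˡ (𝔼-affine c d f _ S₀))) (mean-affine c d _ _)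

    mean-step : (History → ℝ) → History → ℤ → ℤ → ℝ
    mean-step f h u v = p * f (((u , v) , true) ∷ h) + (1# - p) * f (((u , v) , false) ∷ h)

    -- The mean of one step is taken on top of the bound for the later turns, so a conditional
    -- increase of at most `c` accumulates linearly, whatever the strategy.
    𝔼-drift : ∀ f c → (∀ h u v → (u , v) ∉ asked h → mean-step f h u v ≤ f h + c) →
              ∀ h {n} (S : Strategy (asked h) n) → 𝔼 f h S ≤ f h + ι n * c
    𝔼-drift f c drift h done = ≤-reflexive (solve 2 (λ f c → f := f :+ con (+ 0) :* c) ≈-refl (f h) c)
    𝔼-drift f c drift h {suc n} (query u v _ fresh S₁ S₀) = begin
      p * 𝔼 f h₁ S₁ + (1# - p) * 𝔼 f h₀ S₀
        ≤⟨ +-mono-≤ (*-monoˡ-≤ 0≤p (𝔼-drift f c drift h₁ S₁)) (*-monoˡ-≤ 0≤1-p (𝔼-drift f c drift h₀ S₀)) ⟩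
      p * (f h₁ + ι n * c) + (1# - p) * (f h₀ + ι n * c)
        ≈⟨ solve 4 (λ p f g c → p :* (f :+ c) :+ (con (+ 1) :- p) :* (g :+ c) :=
             (p :* f :+ (con (+ 1) :- p) :* g) :+ c) ≈-refl p (f h₁) (f h₀) (ι n * c) ⟩
      mean-step f h u v + ι n * c
        ≤⟨ +-monoˡ-≤ _ (drift h u v fresh) ⟩
      (f h + c) + ι n * c
        ≈⟨ solve 3 (λ f c n → (f :+ c) :+ n :* c := f :+ (con (+ 1) :+ n) :* c) ≈-refl (f h) c (ι n) ⟩
      f h + ι (suc n) * c ∎
      where
      h₁ = ((u , v) , true)  ∷ h
      h₀ = ((u , v) , false) ∷ h

    𝔼-martingale : ∀ f → (∀ h u v → (u , v) ∉ asked h → mean-step f h u v ≈ f h) →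
                   ∀ h {n} (S : Strategy (asked h) n) → 𝔼 f h S ≈ f h
    𝔼-martingale f step h done = ≈-refl
    𝔼-martingale f step h (query u v _ fresh S₁ S₀) = ≈-trans
      (+-cong (*-congˡ (𝔼-martingale f step _ S₁)) (*-congˡ (𝔼-martingale f step _ S₀))) (step h u v fresh)

    -- Supported on u < v; the noise of the graph is the sum over both orders of a pair.

    noise : History → ℤ → ℤ → ℝ
    noise h x y = ⟦ mem (built h) x y ⟧ - p * ⟦ mem (asked h) x y ⟧

    noise-fresh : ∀ h {u v} → (u , v) ∉ asked h → noise h u v ≈ 0#
    noise-fresh h {u} {v} fresh
      rewrite ∉⇒mem fresh | ∉⇒mem {built h} {u} {v} (λ e∈ → fresh (built⊆asked h e∈)) =
      solve 1 (λ p → con (+ 0) :- p :* con (+ 0) := con (+ 0)) ≈-refl p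

    ξ : Bool → ℝ
    ξ true  = 1# - p
    ξ false = - p

    noise-step : ∀ h u v b → (u , v) ∉ asked h → ∀ x y → noise (((u , v) , b) ∷ h) x y ≈
      noise h x y + ξ b * (⟦ does (x ℤ.≟ u) ⟧ * ⟦ does (y ℤ.≟ v) ⟧)
    noise-step h u v true fresh x y = ≈-trans
      (+-cong (mem-cons (built h) (λ e∈ → fresh (built⊆asked h e∈)) x y) (-‿cong (*-congˡ (mem-cons (asked h) fresh x y))))
      (solve 4 (λ b a d p → (b :+ d) :- p :* (a :+ d) := (b :- p :* a) :+ (con (+ 1) :- p) :* d) ≈-refl
        ⟦ mem (built h) x y ⟧ ⟦ mem (asked h) x y ⟧ _ p)
    noise-step h u v false fresh x y = ≈-trans
      (+-congˡ (-‿cong (*-congˡ (mem-cons (asked h) fresh x y))))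
      (solve 4 (λ b a d p → b :- p :* (a :+ d) := (b :- p :* a) :+ (:- p) :* d) ≈-refl
        ⟦ mem (built h) x y ⟧ ⟦ mem (asked h) x y ⟧ _ p)

    -- The noise is 1 - p or -p on queried pairs and 0 elsewhere; a pair built but not asked is
    -- impossible.
    noise²≤ : ∀ h x y → noise h x y * noise h x y ≤ ⟦ mem (asked h) x y ⟧
    noise²≤ h x y with mem (built h) x y in eqb | mem (asked h) x y in eqa
    ... | true  | true  = ≤-trans (≤-reflexive (solve 1 (λ p →
            (con (+ 1) :- p :* con (+ 1)) :* (con (+ 1) :- p :* con (+ 1)) := (con (+ 1) :- p) :* (con (+ 1) :- p)) ≈-refl p))
            (≤-respʳ-≈ (*-identityˡ 1#) (*-mono-≤ 0≤1-p 0≤1 1-p≤1 1-p≤1))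
    ... | false | true  = ≤-trans (≤-reflexive (solve 1 (λ p →
            (con (+ 0) :- p :* con (+ 1)) :* (con (+ 0) :- p :* con (+ 1)) := p :* p) ≈-refl p))
            (≤-respʳ-≈ (*-identityˡ 1#) (*-mono-≤ 0≤p 0≤1 p≤1 p≤1))
    ... | false | false = ≤-reflexive (solve 1 (λ p →
            (con (+ 0) :- p :* con (+ 0)) :* (con (+ 0) :- p :* con (+ 0)) := con (+ 0)) ≈-refl p)
    ... | true  | false with () ← ≡.trans (≡.sym eqa) (∈⇒mem (built⊆asked h (mem⇒∈ (built h) eqb)))

    -- Queried pairs are increasing, so x and y occur in one order only and the disjunction in `adj`
    -- is a sum.
    adj-split : ∀ h → Valid h → ∀ x y →
      ⟦ adj (built h) x y ⟧ ≈ p * ⟦ adj (asked h) x y ⟧ + (noise h x y + noise h y x)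
    adj-split h valid x y = begin-equality
      ⟦ adj (built h) x y ⟧
        ≈⟨ disjoint (mem (built h) x y) (mem (built h) y x) (λ a b → asym
             (∈⇒mem (built⊆asked h (mem⇒∈ (built h) a))) (∈⇒mem (built⊆asked h (mem⇒∈ (built h) b)))) ⟩
      ⟦ mem (built h) x y ⟧ + ⟦ mem (built h) y x ⟧
        ≈⟨ solve 5 (λ p a b c d → a :+ b := p :* (c :+ d) :+ ((a :- p :* c) :+ (b :- p :* d))) ≈-refl p
             ⟦ mem (built h) x y ⟧ ⟦ mem (built h) y x ⟧ ⟦ mem (asked h) x y ⟧ ⟦ mem (asked h) y x ⟧ ⟩
      p * (⟦ mem (asked h) x y ⟧ + ⟦ mem (asked h) y x ⟧) + (noise h x y + noise h y x)
        ≈⟨ +-congʳ (*-congˡ (disjoint (mem (asked h) x y) (mem (asked h) y x) asym)) ⟨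
      p * ⟦ adj (asked h) x y ⟧ + (noise h x y + noise h y x) ∎
      where
      disjoint : ∀ b c → (b ≡ true → c ≢ true) → ⟦ b ∨ c ⟧ ≈ ⟦ b ⟧ + ⟦ c ⟧
      disjoint true  true  h = ⊥-elim (h ≡.refl ≡.refl)
      disjoint true  false h = ≈-sym (+-identityʳ _)
      disjoint false c     h = ≈-sym (+-identityˡ _)
      asym : mem (asked h) x y ≡ true → mem (asked h) y x ≢ true
      asym a b = ℤ.<-asym (All.lookup valid (mem⇒∈ (asked h) a)) (All.lookup valid (mem⇒∈ (asked h) b))

  -- Second-moment bound on the box norm of the noise

  UnitInterval : ℝ → Set
  UnitInterval x = 0# ≤ x × x ≤ 1#

  unit-* : ∀ {x y} → UnitInterval x → UnitInterval y → UnitInterval (x * y)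
  unit-* (0≤x , x≤1) (0≤y , y≤1) =
    *-nonNeg 0≤x 0≤y , ≤-respʳ-≈ (*-identityˡ 1#) (*-mono-≤ 0≤x 0≤1 x≤1 y≤1)

  unit-scale : ∀ {c x} → UnitInterval c → 0# ≤ x → c * x ≤ x
  unit-scale {c} {x} (_ , c≤1) 0≤x = ≤-respʳ-≈ (*-identityˡ x) (*-monoʳ-≤ 0≤x c≤1)

  module Thinning (p : ℝ) (0≤p : 0# ≤ p) (p≤1 : p ≤ 1#)
                  (V : List ℤ) (uV : Unique V) (D : ℝ) (0≤D : 0# ≤ D) where
    open Play p 0≤p p≤1 public
    open Box V public
    open Cliques V public
    open CliqueBounds V public

    private
      q : ℝ
      q = 1# - p

      δ : ℤ → ℤ → ℝ
      δ w x = ⟦ does (x ℤ.≟ w) ⟧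

      -- Equals 1 or 0 according to whether w lies in `V`; the ends of a query are not assumed to
      -- lie there.
      mass : ℤ → ℝ
      mass w = ∑ V (δ w)

      unit-mass : ∀ w → UnitInterval (mass w)
      unit-mass w = ∑-nonNeg V (λ x → ⟦⟧-nonNeg (does (x ℤ.≟ w))) , ∑-δ w uV

    module _ {Y : ℤ → ℤ → ℝ} {u v : ℤ} (Yuv≈0 : Y u v ≈ 0#) where
      private
        i = δ u
        e = δ v
        I = mass u

        δ-row : ∀ x y → i x * Y x y ≈ i x * Y u y
        δ-row x y with x ℤ.≟ u
        ... | yes ≡.refl = ≈-refl
        ... | no  _      = ≈-trans (zeroˡ _) (≈-sym (zeroˡ _))

        row-δ : ∀ y → Y u y * e y ≈ 0#
        row-δ y with y ℤ.≟ v
        ... | yes ≡.refl = ≈-trans (*-congʳ Yuv≈0) (zeroˡ _)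
        ... | no  _      = zeroʳ _

        gram-δ : ∀ y y′ → gram Y y y′ * (e y * e y′) ≈ gram Y v v * (e y * e y′)
        gram-δ y y′ with y ℤ.≟ v | y′ ℤ.≟ v
        ... | yes ≡.refl | yes ≡.refl = ≈-refl
        ... | yes _      | no _  = ≈-trans (*-congˡ (zeroʳ _)) (≈-trans (zeroʳ _) (≈-sym (≈-trans (*-congˡ (zeroʳ _)) (zeroʳ _))))
        ... | no _       | _     = ≈-trans (*-congˡ (zeroˡ _)) (≈-trans (zeroʳ _) (≈-sym (≈-trans (*-congˡ (zeroˡ _)) (zeroʳ _))))

      -- Adding c times the rank-one matrix with entry 1 at (u, v) changes YᵀY by c (r eᵀ + e rᵀ) +
      -- c² e eᵀ, where r is the row of u; `I` vanishes if u is not in `V`.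
      gram-step : ∀ c {Z} → (∀ x y → Z x y ≈ Y x y + c * (i x * e y)) → ∀ y y′ →
        gram Z y y′ ≈ gram Y y y′ + I * (c * (Y u y * e y′ + e y * Y u y′) + (c * c) * (e y * e y′))
      gram-step c {Z} Z≈ y y′ = begin-equality
        ∑ V (λ x → Z x y * Z x y′)
          ≈⟨ ∑-cong V (λ x → pointwise x) ⟩
        ∑ V (λ x → Y x y * Y x y′ + i x * (c * (Y u y * e y′ + e y * Y u y′) + (c * c) * (e y * e y′)))
          ≈⟨ ≈-trans (∑-+ V _ _) (+-congˡ (∑-*ʳ V _ _)) ⟩
        gram Y y y′ + I * (c * (Y u y * e y′ + e y * Y u y′) + (c * c) * (e y * e y′)) ∎
        where
        pointwise : ∀ x → Z x y * Z x y′ ≈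
          Y x y * Y x y′ + i x * (c * (Y u y * e y′ + e y * Y u y′) + (c * c) * (e y * e y′))
        pointwise x = begin-equality
          Z x y * Z x y′
            ≈⟨ *-cong (Z≈ x y) (Z≈ x y′) ⟩
          (Y x y + c * (i x * e y)) * (Y x y′ + c * (i x * e y′))
            ≈⟨ solve 6 (λ a b c i e f → (a :+ c :* (i :* e)) :* (b :+ c :* (i :* f)) :=
                 a :* b :+ (c :* ((i :* a) :* f :+ e :* (i :* b)) :+ (c :* c) :* ((i :* i) :* (e :* f)))) ≈-refl
                 (Y x y) (Y x y′) c (i x) (e y) (e y′) ⟩
          Y x y * Y x y′ + (c * ((i x * Y x y) * e y′ + e y * (i x * Y x y′)) + (c * c) * ((i x * i x) * (e y * e y′)))
            ≈⟨ +-congˡ (+-cong (*-congˡ (+-cong (*-congʳ (δ-row x y)) (*-congˡ (δ-row x y′))))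
                 (*-congˡ (*-congʳ (⟦⟧-idem (does (x ℤ.≟ u)))))) ⟩
          Y x y * Y x y′ + (c * ((i x * Y u y) * e y′ + e y * (i x * Y u y′)) + (c * c) * (i x * (e y * e y′)))
            ≈⟨ +-congˡ (solve 6 (λ a b c i e f →
                 c :* ((i :* a) :* f :+ e :* (i :* b)) :+ (c :* c) :* (i :* (e :* f)) :=
                 i :* (c :* (a :* f :+ e :* b) :+ (c :* c) :* (e :* f))) ≈-refl
                 (Y u y) (Y u y′) c (i x) (e y) (e y′)) ⟩
          Y x y * Y x y′ + i x * (c * (Y u y * e y′ + e y * Y u y′) + (c * c) * (e y * e y′)) ∎

      -- The first-order terms cancel in the mean because the noise is centred.

      κ-mean-step : ∀ {Y₁ Y₀} → (∀ x y → Y₁ x y ≈ Y x y + ξ true * (i x * e y)) →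
        (∀ x y → Y₀ x y ≈ Y x y + ξ false * (i x * e y)) →
        ∑ V (λ y → Y u y * Y u y) ≤ D → ∑ V (λ x → Y x v * Y x v) ≤ D →
        p * κ Y₁ + q * κ Y₀ ≤ κ Y + ((D + D) + ((D + D) + 1#))
      κ-mean-step {Y₁} {Y₀} Y₁≈ Y₀≈ row≤ column≤ = begin
        p * κ Y₁ + q * κ Y₀
          ≈⟨ +-cong (scale p) (scale q) ⟩
        ∑ V (λ y → ∑ V λ y′ → p * (gram Y₁ y y′ * gram Y₁ y y′)) + ∑ V (λ y → ∑ V λ y′ → q * (gram Y₀ y y′ * gram Y₀ y y′))
          ≈⟨ ≈-sym (≈-trans (∑-cong V λ y → ∑-+ V _ _) (∑-+ V _ _)) ⟩
        ∑ V (λ y → ∑ V λ y′ → p * (gram Y₁ y y′ * gram Y₁ y y′) + q * (gram Y₀ y y′ * gram Y₀ y y′))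
          ≤⟨ ∑-mono₂ V V pointwise ⟩
        ∑ V (λ y → ∑ V λ y′ → Γ y y′ * Γ y y′ + ((rr y * e y′ + e y * rr y′) + ((k + k) + 1#) * (e y * e y′)))
          ≈⟨ ≈-trans (∑-cong V λ y → ≈-trans (∑-+ V _ _) (+-congˡ (≈-trans (∑-+ V _ _) (+-cong (∑-+ V _ _) (∑-*ˡ V _ _)))))
               (≈-trans (∑-+ V _ _) (+-congˡ (≈-trans (∑-+ V _ _) (+-cong (∑-+ V _ _) (∑-*ˡ V _ _))))) ⟩
        κ Y + ((∑ V (λ y → ∑ V λ y′ → rr y * e y′) + ∑ V (λ y → ∑ V λ y′ → e y * rr y′)) +
               ((k + k) + 1#) * ∑ V (λ y → ∑ V λ y′ → e y * e y′))
          ≈⟨ +-congˡ (+-cong (+-cong (∑-*-∑ V V rr e) (∑-*-∑ V V e rr)) (*-congˡ (∑-*-∑ V V e e))) ⟨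
        κ Y + ((∑ V rr * E + E * ∑ V rr) + ((k + k) + 1#) * (E * E))
          ≤⟨ +-monoʳ-≤ (κ Y) (+-mono-≤ (+-mono-≤ (≤-trans (≤-reflexive (*-comm _ _)) E-rr) E-rr) (≤-trans
               (≤-respˡ-≈ (*-comm _ _) (unit-scale (unit-* (unit-mass v) (unit-mass v)) (+-nonNeg (+-nonNeg 0≤k 0≤k) 0≤1)))
               (+-monoˡ-≤ 1# (+-mono-≤ column≤ column≤)))) ⟩
        κ Y + ((D + D) + ((D + D) + 1#)) ∎
        where
        Γ = gram Y
        k = gram Y v v
        E = mass v
        rr : ℤ → ℝ
        rr y = Y u y * Y u y
        0≤k : 0# ≤ k
        0≤k = ∑-nonNeg V λ x → x*x-nonNeg (Y x v)
        E-rr : E * ∑ V rr ≤ D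
        E-rr = ≤-trans (unit-scale (unit-mass v) (∑-nonNeg V λ y → x*x-nonNeg (Y u y))) row≤
        scale : ∀ c {Z : ℤ → ℤ → ℝ} → c * ∑ V (λ y → ∑ V λ y′ → Z y y′ * Z y y′) ≈ ∑ V (λ y → ∑ V λ y′ → c * (Z y y′ * Z y y′))
        scale c = ≈-sym (≈-trans (∑-cong V λ y → ∑-*ˡ V _ _) (∑-*ˡ V _ _))
        unit-p : UnitInterval p
        unit-p = 0≤p , p≤1
        unit-q : UnitInterval q
        unit-q = 0≤1-p , 1-p≤1
        unit-I = unit-mass u
        quartic : ℝ
        quartic = p * ((q * q) * (q * q)) + q * ((p * p) * (p * p))
        unit-quartic : UnitInterval quartic
        unit-quartic = +-nonNeg (proj₁ (unit-* unit-p qqqq)) (proj₁ (unit-* unit-q pppp)) ,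
          ≤-trans (+-mono-≤ (≤-respˡ-≈ (*-comm _ _) (unit-scale qqqq 0≤p)) (≤-respˡ-≈ (*-comm _ _) (unit-scale pppp 0≤1-p)))
            (≤-reflexive (solve 1 (λ p → p :+ (con (+ 1) :- p) := con (+ 1)) ≈-refl p))
          where
          qqqq = unit-* (unit-* unit-q unit-q) (unit-* unit-q unit-q)
          pppp = unit-* (unit-* unit-p unit-p) (unit-* unit-p unit-p)
        pointwise : ∀ y y′ → p * (gram Y₁ y y′ * gram Y₁ y y′) + q * (gram Y₀ y y′ * gram Y₀ y y′) ≤
          Γ y y′ * Γ y y′ + ((rr y * e y′ + e y * rr y′) + ((k + k) + 1#) * (e y * e y′))
        pointwise y y′ = begin
          p * (gram Y₁ y y′ * gram Y₁ y y′) + q * (gram Y₀ y y′ * gram Y₀ y y′)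
            ≈⟨ +-cong (*-congˡ (*-cong g₁ g₁)) (*-congˡ (*-cong g₀ g₀)) ⟩
          -- The jumps q and -p, with weights p and q, have mean 0 and second moment pq; `J` is
          -- twice their third moment times `I * I`. Every term of the last group contains `r * e`
          -- or `r′ * e′`.
          _ ≈⟨ solve 7 (λ p K I r r′ e e′ →
                 let q = con (+ 1) :- p
                     g = λ c → K :+ I :* (c :* (r :* e′ :+ e :* r′) :+ (c :* c) :* (e :* e′))
                     J = con (+ 2) :* ((I :* I) :* ((p :* q) :* (q :* q :- p :* p)))
                 in p :* (g q :* g q) :+ q :* (g (:- p) :* g (:- p)) :=
                    (K :* K :+ ((((I :* I) :* (p :* q)) :* ((r :* r) :* (e′ :* e′) :+ (e :* e) :* (r′ :* r′)) :+
                      ((I :* (p :* q)) :* (con (+ 2) :* (K :* (e :* e′))))) :+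
                      ((I :* I) :* (p :* ((q :* q) :* (q :* q)) :+ q :* ((p :* p) :* (p :* p)))) :* ((e :* e) :* (e′ :* e′)))) :+
                    ((r :* e) :* (J :* (e′ :* e′) :+ con (+ 2) :* (((I :* I) :* (p :* q)) :* (r′ :* e′))) :+
                     (r′ :* e′) :* (J :* (e :* e)))) ≈-refl
                 p (Γ y y′) I (Y u y) (Y u y′) (e y) (e y′) ⟩
          -- These products vanish because the noise of the fresh pair was 0 before the query.
          _ ≈⟨ ≈-trans (+-congˡ (≈-trans (+-cong (≈-trans (*-congʳ (row-δ y)) (zeroˡ _)) (≈-trans (*-congʳ (row-δ y′)) (zeroˡ _)))
                 (+-identityˡ 0#))) (+-identityʳ _) ⟩
          Γ y y′ * Γ y y′ + ((((I * I) * (p * q)) * (rr y * (e y′ * e y′) + (e y * e y) * rr y′) +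
            ((I * (p * q)) * ((1# + 1#) * (Γ y y′ * (e y * e y′))))) +
            ((I * I) * quartic) * ((e y * e y) * (e y′ * e y′)))
            ≈⟨ +-congˡ (+-cong (+-cong (*-congˡ (+-cong (*-congˡ (idem y′)) (*-congʳ (idem y))))
                 (*-congˡ (*-congˡ (gram-δ y y′)))) (*-congˡ (*-cong (idem y) (idem y′)))) ⟩
          Γ y y′ * Γ y y′ + ((((I * I) * (p * q)) * (rr y * e y′ + e y * rr y′) +
            ((I * (p * q)) * ((1# + 1#) * (k * (e y * e y′))))) + ((I * I) * quartic) * (e y * e y′))
            ≤⟨ +-monoʳ-≤ _ (+-mono-≤ (+-mono-≤
                 (unit-scale (unit-* (unit-* unit-I unit-I) (unit-* unit-p unit-q))
                   (+-nonNeg (*-nonNeg (x*x-nonNeg (Y u y)) (0≤e y′)) (*-nonNeg (0≤e y) (x*x-nonNeg (Y u y′)))))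
                 (unit-scale (unit-* unit-I (unit-* unit-p unit-q))
                   (*-nonNeg (+-nonNeg 0≤1 0≤1) (*-nonNeg 0≤k (*-nonNeg (0≤e y) (0≤e y′))))))
                 (unit-scale (unit-* (unit-* unit-I unit-I) unit-quartic) (*-nonNeg (0≤e y) (0≤e y′)))) ⟩
          Γ y y′ * Γ y y′ + (((rr y * e y′ + e y * rr y′) + (1# + 1#) * (k * (e y * e y′))) + e y * e y′)
            ≈⟨ +-congˡ (solve 3 (λ a k e → (a :+ con (+ 2) :* (k :* e)) :+ e := a :+ ((k :+ k) :+ con (+ 1)) :* e) ≈-refl _ _ _) ⟩
          Γ y y′ * Γ y y′ + ((rr y * e y′ + e y * rr y′) + ((k + k) + 1#) * (e y * e y′)) ∎
          where
          g₁ = gram-step (ξ true) {Y₁} Y₁≈ y y′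
          g₀ = gram-step (ξ false) {Y₀} Y₀≈ y y′
          0≤e : ∀ y → 0# ≤ e y
          0≤e y = ⟦⟧-nonNeg (does (y ℤ.≟ v))
          idem : ∀ y → e y * e y ≈ e y
          idem y = ⟦⟧-idem (does (y ℤ.≟ v))

    -- A query is discarded when one of its ends already carries a lot of noise; so the
    -- decision depends only on the past, and the kept part of the noise stays centred.

    Light : History → ℤ → ℤ → Set
    Light h u v = ∑ V (λ y → noise h u y * noise h u y) ≤ D × ∑ V (λ x → noise h x v * noise h x v) ≤ D

    light? : ∀ h u v → Dec (Light h u v)
    light? h u v = (_ ≤? D) ×-dec (_ ≤? D)

    thin : History → History
    thin [] = []
    thin (((u , v) , b) ∷ h) with light? (thin h) u v
    ... | yes _ = ((u , v) , b) ∷ thin h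
    ... | no  _ = thin h

    asked-thin : ∀ h {e} → e ∈ asked (thin h) → e ∈ asked h
    asked-thin (((u , v) , b) ∷ h) e∈ with light? (thin h) u v
    asked-thin (((u , v) , b) ∷ h) (here eq)  | yes _ = here eq
    asked-thin (((u , v) , b) ∷ h) (there e∈) | yes _ = there (asked-thin h e∈)
    asked-thin (((u , v) , b) ∷ h) e∈         | no  _ = there (asked-thin h e∈)

    valid-thin : ∀ h → Valid h → Valid (thin h)
    valid-thin h valid = All.tabulate λ e∈ → All.lookup valid (asked-thin h e∈)

    -- The squared row of u enters twice, the squared column of v twice, and the fourth-order term
    -- adds at most 1.
    drift : ℝ
    drift = (D + D) + ((D + D) + 1#)

    0≤drift : 0# ≤ drift
    0≤drift = +-nonNeg (+-nonNeg 0≤D 0≤D) (+-nonNeg (+-nonNeg 0≤D 0≤D) 0≤1)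

    κ-thin : History → ℝ
    κ-thin h = κ (noise (thin h))

    -- A kept query has light ends, so `κ-mean-step` applies; a discarded one leaves the thinned
    -- history as it was for both answers.
    κ-drift : ∀ h u v → (u , v) ∉ asked h → mean-step κ-thin h u v ≤ κ-thin h + drift
    κ-drift h u v fresh with light? (thin h) u v
    ... | yes (row≤ , column≤) = κ-mean-step (noise-fresh (thin h) fresh′)
      (noise-step (thin h) u v true fresh′) (noise-step (thin h) u v false fresh′) row≤ column≤
      where
      fresh′ = fresh ∘ asked-thin h
    ... | no _ = ≤-respˡ-≈ (solve 2 (λ p k → k := p :* k :+ (con (+ 1) :- p) :* k) ≈-refl p (κ-thin h))
      (x≤x+nonNeg 0≤drift)

    𝔼-κ : ∀ {n} (S : Strategy [] n) → 𝔼 κ-thin [] S ≤ ι n * drift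
    𝔼-κ S = ≤-trans (𝔼-drift κ-thin drift κ-drift [] S)
      (≤-reflexive (≈-trans (+-congʳ κ-[]) (+-identityˡ _)))
      where
      κ-[] : κ (noise []) ≈ 0#
      κ-[] = ≈-trans (∑-cong V λ y → ≈-trans (∑-cong V λ y′ → ≈-trans (*-congʳ (≈-trans (∑-cong V λ x →
        solve 1 (λ p → (con (+ 0) :- p :* con (+ 0)) :* (con (+ 0) :- p :* con (+ 0)) := con (+ 0)) ≈-refl p)
        (∑-0 V))) (zeroˡ _)) (∑-0 V)) (∑-0 V)

    noise-row≤ : ∀ h {w : ℤ → ℤ → Bool} → (∀ x y → mem (asked h) x y ⇒ w x y) → ∀ u →
                 ∑ V (λ y → noise h u y * noise h u y) ≤ ∑ V (λ y → ⟦ w u y ⟧)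
    noise-row≤ h ⇒w u = ∑-mono V λ y → ≤-trans (noise²≤ h u y) (⟦⟧-mono (⇒w u y))

    noise-column≤ : ∀ h {w : ℤ → ℤ → Bool} → (∀ x y → mem (asked h) x y ⇒ w y x) → ∀ v →
                    ∑ V (λ x → noise h x v * noise h x v) ≤ ∑ V (λ x → ⟦ w v x ⟧)
    noise-column≤ h ⇒w v = ∑-mono V λ x → ≤-trans (noise²≤ h x v) (⟦⟧-mono (⇒w x v))

    -- The noise at a vertex never exceeds its final degree.

    thin-keeps : ∀ h {w : ℤ → ℤ → Bool} → (∀ x y → mem (asked h) x y ⇒ w x y) → (∀ x y → w x y ≡ w y x) →
      ∀ {x y} → ∑ V (λ z → ⟦ w x z ⟧) ≤ D → ∑ V (λ z → ⟦ w y z ⟧) ≤ D →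
      (x , y) ∈ built h → (x , y) ∈ built (thin h)
    thin-keeps (((u , v) , b) ∷ h) {w} ⇒w w-sym {x} {y} x≤ y≤ e∈ with light? (thin h) u v | b | e∈
    ... | yes _     | true  | here eq   = here eq
    ... | yes _     | true  | there e∈h = there (keep e∈h)
      where
      keep = thin-keeps h (λ x y eq → ⇒w x y (mem-mono {asked h} there x y eq)) w-sym x≤ y≤
    ... | yes _     | false | e∈h       = thin-keeps h (λ x y eq → ⇒w x y (mem-mono {asked h} there x y eq)) w-sym x≤ y≤ e∈h
    ... | no  _     | true  | there e∈h = thin-keeps h (λ x y eq → ⇒w x y (mem-mono {asked h} there x y eq)) w-sym x≤ y≤ e∈h
    ... | no  _     | false | e∈h       = thin-keeps h (λ x y eq → ⇒w x y (mem-mono {asked h} there x y eq)) w-sym x≤ y≤ e∈h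
    ... | no ¬light | true  | here ≡.refl = ⊥-elim (¬light
      (≤-trans (noise-row≤ (thin h) thin⇒w x) x≤ , ≤-trans (noise-column≤ (thin h) (λ x y eq → ≡.trans (w-sym y x) (thin⇒w x y eq)) y) y≤))
      where
      thin⇒w : ∀ x y → mem (asked (thin h)) x y ⇒ w x y
      thin⇒w x y eq = ⇒w x y (mem-mono {asked (thin h)} (there ∘ asked-thin h) x y eq)

    -- Squared noise is at most 1, so a row or column over at most D vertices is light. This serves
    -- the strategy that queries a complete graph.
    thin-id : ∑ V (λ _ → 1#) ≤ D → ∀ h → thin h ≡ h
    thin-id ≤D [] = ≡.refl
    thin-id ≤D (((u , v) , b) ∷ h) with light? (thin h) u v
    ... | yes _ = ≡.cong (((u , v) , b) ∷_) (thin-id ≤D h)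
    ... | no ¬light = ⊥-elim (¬light
      (≤-trans (noise-row≤ (thin h) {λ _ _ → true} (λ _ _ _ → ≡.refl) u) ≤D ,
       ≤-trans (noise-column≤ (thin h) {λ _ _ → true} (λ _ _ _ → ≡.refl) v) ≤D))

    ∑-noise : History → ℝ
    ∑-noise h = ∑ V λ x → ∑ V λ y → noise h x y

    𝔼-∑-noise : ∀ {n} (S : Strategy [] n) → 𝔼 ∑-noise [] S ≈ 0#
    𝔼-∑-noise S = ≈-trans (𝔼-martingale ∑-noise step [] S) (≈-trans (∑-cong V λ x → ≈-trans (∑-cong V λ y →
      solve 1 (λ p → con (+ 0) :- p :* con (+ 0) := con (+ 0)) ≈-refl p) (∑-0 V)) (∑-0 V))
      where
      step : ∀ h u v → (u , v) ∉ asked h → mean-step ∑-noise h u v ≈ ∑-noise h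
      step h u v fresh = ≈-trans (+-cong (*-congˡ (sums true)) (*-congˡ (sums false)))
        (solve 3 (λ p f m → p :* (f :+ (con (+ 1) :- p) :* m) :+ (con (+ 1) :- p) :* (f :+ (:- p) :* m) := f)
          ≈-refl p (∑-noise h) M)
        where
        M = ∑ V (λ x → ∑ V λ y → δ u x * δ v y)
        sums : ∀ b → ∑-noise (((u , v) , b) ∷ h) ≈ ∑-noise h + ξ b * M
        sums b = begin-equality
          ∑-noise (((u , v) , b) ∷ h)
            ≈⟨ ∑-cong₂ V V (noise-step h u v b fresh) ⟩
          ∑ V (λ x → ∑ V λ y → noise h x y + ξ b * (δ u x * δ v y))
            ≈⟨ ≈-trans (∑-cong V λ x → ∑-+ V _ _) (∑-+ V _ _) ⟩
          ∑-noise h + ∑ V (λ x → ∑ V λ y → ξ b * (δ u x * δ v y))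
            ≈⟨ +-congˡ (≈-trans (∑-cong V λ x → ∑-*ˡ V _ _) (∑-*ˡ V _ _)) ⟩
          ∑-noise h + ξ b * M ∎

  -- Copies of K_m

  -- Each x of `U` with a positive term is matched with an occurrence in `L`, which is then removed;
  -- as `U` has no repetitions, the later elements keep theirs.
  ∑-compare : ∀ {A : Set} (U L : List A) (f g : A → ℝ) → Unique U → (∀ x → 0# ≤ g x) →
              (∀ {x} → x ∈ U → f x ≤ 0# ⊎ (x ∈ L × f x ≤ g x)) → ∑ U f ≤ ∑ L g
  ∑-compare []      L f g _ 0≤g h = ∑-nonNeg L 0≤g
  ∑-compare (x ∷ U) L f g (x∉U ∷ uU) 0≤g h with h (here ≡.refl)
  ... | inj₁ fx≤0 = ≤-trans (+-monoˡ-≤ _ fx≤0) (≤-respˡ-≈ (≈-sym (+-identityˡ _))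
    (∑-compare U L f g uU 0≤g (λ y∈ → h (there y∈))))
  ... | inj₂ (x∈L , fx≤gx) with ∈-∃++ x∈L
  ... | L₁ , L₂ , ≡.refl = begin
    f x + ∑ U f                ≤⟨ +-mono-≤ fx≤gx (∑-compare U (L₁ ++ L₂) f g uU 0≤g elsewhere) ⟩
    g x + ∑ (L₁ ++ L₂) g       ≈⟨ +-congˡ (∑-++ L₁ L₂ g) ⟩
    g x + (∑ L₁ g + ∑ L₂ g)    ≈⟨ solve 3 (λ a b c → a :+ (b :+ c) := b :+ (a :+ c)) ≈-refl _ _ _ ⟩
    ∑ L₁ g + (g x + ∑ L₂ g)    ≈⟨ ∑-++ L₁ (x ∷ L₂) g ⟨
    ∑ (L₁ ++ x ∷ L₂) g         ∎
    where
    skip : ∀ {y} → x ≢ y → y ∈ L₁ ++ x ∷ L₂ → y ∈ L₁ ++ L₂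
    skip x≢y y∈ with ∈-++⁻ L₁ y∈
    ... | inj₁ y∈L₁           = ∈-++⁺ˡ y∈L₁
    ... | inj₂ (here y≡x)     = ⊥-elim (x≢y (≡.sym y≡x))
    ... | inj₂ (there y∈L₂)   = ∈-++⁺ʳ L₁ y∈L₂
    elsewhere : ∀ {y} → y ∈ U → f y ≤ 0# ⊎ (y ∈ L₁ ++ L₂ × f y ≤ g y)
    elsewhere y∈ with h (there y∈)
    ... | inj₁ fy≤0         = inj₁ fy≤0
    ... | inj₂ (y∈L , le)   = inj₂ (skip (All.lookup x∉U y∈) y∈L , le)

  module CopyCount (V : List ℤ) (uV : Unique V) where
    open Cliques V
    open CliqueBounds V

    cl-tuples : ∀ k w a → cl k w a ≈ ∑ (tuples V k) (λ f → ⟦ clique w a f ⟧)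
    cl-tuples zero    w a = ≈-sym (+-identityʳ _)
    cl-tuples (suc k) w a = ≈-sym (≈-trans (∑-product _∷_ V (tuples V k) _) (∑-cong V λ x →
      ≈-trans (∑-cong (tuples V k) λ f → ⟦⟧-∧ (a x) (clique w (a ⊓ w x) f))
        (≈-trans (∑-*ˡ (tuples V k) _ _) (*-congˡ (≈-sym (cl-tuples k w (a ⊓ w x)))))))

    unique-tuples : ∀ k → Unique (tuples V k)
    unique-tuples zero    = [] ∷ []
    unique-tuples (suc k) = Unique.cartesianProductWith⁺ _∷_ ∷-injective uV (unique-tuples k)

    module _ (m : ℕ) (2≤m : 2 ℕ.≤ m) (L : List Pair) where

      copies≤cl : (∀ {x y} → (x , y) ∈ L → x ∈ V × y ∈ V) → ι (#copies (K m 2≤m) L) ≤ cl m (adj L) everything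
      copies≤cl within = begin
        ι (#copies (K m 2≤m) L)                       ≈⟨ ∑-1 (copies (K m 2≤m) L) ⟨
        ∑ (copies (K m 2≤m) L) (λ _ → 1#)
          ≤⟨ ∑-compare (copies (K m 2≤m) L) (tuples V m) _ _ (copies-unique (K m 2≤m) L)
               (λ f → ⟦⟧-nonNeg (clique (adj L) everything f)) (λ f∈ → inj₂ (good f∈)) ⟩
        ∑ (tuples V m) (λ f → ⟦ clique (adj L) everything f ⟧) ≈⟨ cl-tuples m (adj L) everything ⟨
        cl m (adj L) everything ∎
        where
        good : ∀ {f} → f ∈ copies (K m 2≤m) L → f ∈ tuples V m × 1# ≤ ⟦ clique (adj L) everything f ⟧
        good {f} f∈ = ∈-tuples f inV ,
          ≤-reflexive (reflexive (≡.cong ⟦_⟧ (≡.sym (clique⁺ (adj L) everything f (λ _ → ≡.refl)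
            (λ i j i≢j → Joined⇒adj L (proj₂ cp i j i≢j))))))
          where
          cp = ∈-copies⁻ (K m 2≤m) L f∈
          inV : ∀ i → lookup f i ∈ V
          inV i with Graph.noIsolated (K m 2≤m) i
          ... | j , i≢j with proj₂ cp i j i≢j
          ... | inj₁ e∈ = proj₁ (within e∈)
          ... | inj₂ e∈ = proj₂ (within e∈)

      -- `clique` does not ask for distinct vertices. Increasing pairs exclude loops, so adjacency
      -- at distinct positions forces distinct vertices and the tuple is injective.
      cl≤copies : All Increasing L → cl m (adj L) everything ≤ ι (#copies (K m 2≤m) L)
      cl≤copies increasing = begin
        cl m (adj L) everything  ≈⟨ cl-tuples m (adj L) everything ⟩
        ∑ (tuples V m) (λ f → ⟦ clique (adj L) everything f ⟧)
          ≤⟨ ∑-compare (tuples V m) (copies (K m 2≤m) L) _ _ (unique-tuples m) (λ _ → 0≤1) (λ {f} _ → good f) ⟩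
        ∑ (copies (K m 2≤m) L) (λ _ → 1#)             ≈⟨ ∑-1 (copies (K m 2≤m) L) ⟩
        ι (#copies (K m 2≤m) L)  ∎
        where
        loop : ∀ {x} → ¬ Joined L x x
        loop (inj₁ e∈) = ℤ.<-irrefl ≡.refl (All.lookup increasing e∈)
        loop (inj₂ e∈) = ℤ.<-irrefl ≡.refl (All.lookup increasing e∈)
        copy : ∀ f → clique (adj L) everything f ≡ true → IsCopy (K m 2≤m) L f
        copy f eq = injective , joined
          where
          joined : ∀ i j → i ≢ j → Joined L (lookup f i) (lookup f j)
          joined i j i≢j = adj⇒Joined L (clique-edges (adj L) (adj-sym L) everything f eq i j i≢j)
          injective : ∀ i j → lookup f i ≡ lookup f j → i ≡ j
          injective i j fi≡fj with i ≟ᶠ j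
          ... | yes i≡j = i≡j
          ... | no  i≢j = ⊥-elim (loop (≡.subst (λ x → Joined L x (lookup f j)) fi≡fj (joined i j i≢j)))
        good : ∀ f → ⟦ clique (adj L) everything f ⟧ ≤ 0# ⊎
                     (f ∈ copies (K m 2≤m) L × ⟦ clique (adj L) everything f ⟧ ≤ 1#)
        good f with clique (adj L) everything f in eq
        ... | true  = inj₂ (∈-copies⁺ (K m 2≤m) L (copy f eq) , ≤-refl)
        ... | false = inj₁ ≤-refl

  -- Pointwise bounds on the number of cliques

  module Pointwise (p : ℝ) (0≤p : 0# ≤ p) (p≤1 : p ≤ 1#)
                   (V : List ℤ) (uV : Unique V) (D : ℝ) (0<D : 0# < D)
                   (s : ℝ) (0<s : 0# < s) (N : ℕ) (2N≤s² : ι N + ι N ≤ s * s) where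
    open Thinning p 0≤p p≤1 V uV D (<⇒≤ 0<D) public
    open CopyCount V uV public

    private
      0≤s = <⇒≤ 0<s

    module _ (h : History) (valid : Valid h) (length≡ : length h ≡ N) where

      G Q G′ Q′ : ℤ → ℤ → Bool
      G  = adj (built h)
      Q  = adj (asked h)
      G′ = adj (built (thin h))
      Q′ = adj (asked (thin h))

      noise± : ℤ → ℤ → ℝ
      noise± x y = noise (thin h) x y + noise (thin h) y x

      edges≤ : cl 2 Q everything ≤ s * s
      edges≤ = begin
        cl 2 Q everything                                  ≈⟨ ≈-trans (cl-2 Q everything) (∑-cong₂ V V λ x y → *-identityˡ _) ⟩
        ∑ V (λ x → ∑ V λ y → ⟦ Q x y ⟧)                    ≤⟨ ∑-adj≤ uV (asked h) ⟩
        ι (length (asked h)) + ι (length (asked h))        ≡⟨ ≡.cong (λ n → ι n + ι n) (≡.trans (length-map proj₁ h) length≡) ⟩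
        ι N + ι N                                          ≤⟨ 2N≤s² ⟩
        s * s                                              ∎

      cliques≤ : ∀ k w → w ⊑ Q → cl (2 ℕ.+ k) w everything ≤ s ^ (2 ℕ.+ k)
      cliques≤ k w w⊑Q = ≤-trans (cl-mono (2 ℕ.+ k) {w} {Q} {everything} w⊑Q (λ _ eq → eq)) (cl-upper k Q 0≤s edges≤)

      Q′⊑Q : Q′ ⊑ Q
      Q′⊑Q = adj-mono {asked (thin h)} (asked-thin h)

      G′⊑Q′ : G′ ⊑ Q′
      G′⊑Q′ = adj-mono {built (thin h)} (built⊆asked (thin h))

      -- The transposed half of the noise is the same form with A and B exchanged, so a bound on `κ`
      -- of the one-sided noise serves both halves.
      triangles± : ∀ A B → triangles noise± A B ≈ triangles (noise (thin h)) A B + triangles (noise (thin h)) B A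
      triangles± A B = begin-equality
        ∑ V (λ x → ∑ V λ y → ∑ V λ z → (Y x y + Y y x) * (A x z * B y z))
          ≈⟨ ∑-cong₂ V V (λ x y → ≈-trans (∑-cong V λ z → distribʳ _ _ _) (∑-+ V _ _)) ⟩
        ∑ V (λ x → ∑ V λ y → ∑ V (λ z → Y x y * (A x z * B y z)) + ∑ V (λ z → Y y x * (A x z * B y z)))
          ≈⟨ ≈-trans (∑-cong V λ x → ∑-+ V _ _) (∑-+ V _ _) ⟩
        triangles Y A B + ∑ V (λ x → ∑ V λ y → ∑ V λ z → Y y x * (A x z * B y z))
          ≈⟨ +-congˡ (≈-trans (∑-swap V V _) (∑-cong₂ V V λ y x → ∑-cong V λ z → *-congˡ (*-comm _ _))) ⟩
        triangles Y A B + triangles Y B A ∎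
        where
        Y = noise (thin h)

      -- On the exceptional event κ r ≥ 1 and the trivial bound s ^ m suffices.

      clique-deviation : ∀ k {η r} → 0# ≤ η → 0# ≤ r →
        (∀ {x} → (((η * s) * (η * s)) * ((η * s) * (η * s))) ≤ x → 1# ≤ x * r) →
        ∣ cl (3 ℕ.+ k) G′ everything - p ^ tri (3 ℕ.+ k) * cl (3 ℕ.+ k) Q′ everything ∣≤
          s ^ (3 ℕ.+ k) * (ι (tri (3 ℕ.+ k)) * (η + η) + κ-thin h * r)
      clique-deviation k {η} {r} 0≤η 0≤r r-large with total (κ-thin h) (((η * s) * (η * s)) * ((η * s) * (η * s)))
      ... | inj₁ κ≤ = abs-mono typical (error-bound k {everything} {everything} λ _ eq → eq)
        where
        0≤ηs = *-nonNeg 0≤η 0≤s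
        β = η * s + η * s
        box : ∀ A B {Δ} → 0# ≤ Δ → norm² A ≤ Δ → norm² B ≤ Δ → ∣ triangles noise± A B ∣≤ β * Δ
        box A B {Δ} 0≤Δ A≤ B≤ = abs-cong (≈-sym (triangles± A B)) (abs-mono (≤-reflexive (≈-sym (distribʳ _ _ _)))
          (abs-+ (box-inequality _ A B 0≤ηs 0≤Δ κ≤ A≤ B≤) (box-inequality _ B A 0≤ηs 0≤Δ κ≤ B≤ A≤)))
        open Counting G′ Q′ noise± p β 0≤p p≤1 (+-nonNeg 0≤ηs 0≤ηs) (adj-sym (built (thin h)))
          (adj-sym (asked (thin h))) G′⊑Q′ (adj-split (thin h) (valid-thin h valid)) box
        E = ι (tri (3 ℕ.+ k))
        0≤Eβ = *-nonNeg (0≤ι (tri (3 ℕ.+ k))) (+-nonNeg 0≤ηs 0≤ηs)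
        typical : (E * β) * cl (2 ℕ.+ k) Q′ everything ≤ s ^ (3 ℕ.+ k) * (E * (η + η) + κ-thin h * r)
        typical = begin
          (E * β) * cl (2 ℕ.+ k) Q′ everything       ≤⟨ *-monoˡ-≤ 0≤Eβ (cliques≤ k Q′ Q′⊑Q) ⟩
          (E * β) * s ^ (2 ℕ.+ k)
            ≈⟨ solve 4 (λ E η s S → (E :* (η :* s :+ η :* s)) :* S := (s :* S) :* (E :* (η :+ η))) ≈-refl E η s _ ⟩
          s ^ (3 ℕ.+ k) * (E * (η + η))
            ≤⟨ *-monoˡ-≤ (^-nonNeg (3 ℕ.+ k) 0≤s) (x≤x+nonNeg (*-nonNeg (norm²-nonNeg (gram (noise (thin h)))) 0≤r)) ⟩
          s ^ (3 ℕ.+ k) * (E * (η + η) + κ-thin h * r) ∎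
      ... | inj₂ κ≥ = ≤-trans (≤-trans x-y≤x x≤) rare , ≤-trans (≤-trans y-x≤y y≤) rare
        where
        E = ι (tri (3 ℕ.+ k))
        S = s ^ (3 ℕ.+ k)
        x = cl (3 ℕ.+ k) G′ everything
        y = p ^ tri (3 ℕ.+ k) * cl (3 ℕ.+ k) Q′ everything
        x≤ : x ≤ S
        x≤ = cliques≤ (suc k) G′ (λ u v eq → Q′⊑Q u v (G′⊑Q′ u v eq))
        0≤y : 0# ≤ y
        0≤y = *-nonNeg (^-nonNeg (tri (3 ℕ.+ k)) 0≤p) (cl-nonNeg (3 ℕ.+ k) Q′ everything)
        y≤ : y ≤ S
        y≤ = ≤-trans (unit-scale (^-nonNeg (tri (3 ℕ.+ k)) 0≤p , ^-≤1 (tri (3 ℕ.+ k)) 0≤p p≤1) (cl-nonNeg (3 ℕ.+ k) Q′ everything))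
          (cliques≤ (suc k) Q′ Q′⊑Q)
        x-y≤x : x - y ≤ x
        x-y≤x = ≤-by 0≤y (solve 2 (λ x y → x :- (x :- y) := y) ≈-refl x y)
        y-x≤y : - (x - y) ≤ y
        y-x≤y = ≤-by (cl-nonNeg (3 ℕ.+ k) G′ everything) (solve 2 (λ x y → y :- (:- (x :- y)) := x) ≈-refl x y)
        rare : S ≤ S * (E * (η + η) + κ-thin h * r)
        rare = ≤-respˡ-≈ (*-identityʳ S) (*-monoˡ-≤ (^-nonNeg (3 ℕ.+ k) 0≤s)
          (≤-trans (r-large κ≥) (≤-respˡ-≈ (+-identityˡ _) (+-monoˡ-≤ _
            (*-nonNeg (0≤ι (tri (3 ℕ.+ k))) (+-nonNeg 0≤η 0≤η))))))

      -- Refers to the degree in all queried pairs at the end, which is unknown during play but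
      -- dominates the noise by which `thin` decides.
      low-degree : ℤ → Bool
      low-degree x = does (∑ V (λ y → ⟦ Q x y ⟧) ≤? D)

      low-degree⇒ : ∀ x → low-degree x ≡ true → ∑ V (λ y → ⟦ Q x y ⟧) ≤ D
      low-degree⇒ x eq with ∑ V (λ y → ⟦ Q x y ⟧) ≤? D
      ... | yes ≤D = ≤D

      -- Markov's inequality for the degrees, whose sum is at most 2N.
      high-degree-few : D * ∑ V (λ x → ⟦ not (low-degree x) ⟧) ≤ s * s
      high-degree-few = begin
        D * ∑ V (λ x → ⟦ not (low-degree x) ⟧)    ≈⟨ ∑-*ˡ V _ _ ⟨
        ∑ V (λ x → D * ⟦ not (low-degree x) ⟧)    ≤⟨ ∑-mono V pointwise ⟩
        ∑ V (λ x → ∑ V λ y → ⟦ Q x y ⟧)           ≈⟨ ≈-trans (cl-2 Q everything) (∑-cong₂ V V λ x y → *-identityˡ _) ⟨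
        cl 2 Q everything                         ≤⟨ edges≤ ⟩
        s * s                                     ∎
        where
        pointwise : ∀ x → D * ⟦ not (low-degree x) ⟧ ≤ ∑ V (λ y → ⟦ Q x y ⟧)
        pointwise x with ∑ V (λ y → ⟦ Q x y ⟧) ≤? D
        ... | yes _  = ≤-respˡ-≈ (≈-sym (zeroʳ D)) (∑-nonNeg V λ y → ⟦⟧-nonNeg (Q x y))
        ... | no ≰D  = ≤-respˡ-≈ (≈-sym (*-identityʳ D)) (<⇒≤ (≰⇒> ≰D))

      -- A built edge between vertices of low final degree is never thinned out, so the whole clique
      -- survives.
      cl-low-degree : ∀ k → cl k G low-degree ≤ cl k G′ everything
      cl-low-degree k = begin
        cl k G low-degree                                        ≈⟨ cl-tuples k G low-degree ⟩
        ∑ (tuples V k) (λ f → ⟦ clique G low-degree f ⟧)         ≤⟨ ∑-mono (tuples V k) (λ f → ⟦⟧-mono (survives f)) ⟩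
        ∑ (tuples V k) (λ f → ⟦ clique G′ everything f ⟧)        ≈⟨ cl-tuples k G′ everything ⟨
        cl k G′ everything                                       ∎
        where
        keep : ∀ {x y} → low-degree x ≡ true → low-degree y ≡ true → (x , y) ∈ built h → (x , y) ∈ built (thin h)
        keep {x} {y} lx ly = thin-keeps h {Q} (λ x y eq → Joined⇒adj (asked h) (inj₁ (mem⇒∈ (asked h) eq)))
          (adj-sym (asked h)) (low-degree⇒ x lx) (low-degree⇒ y ly)
        survives : ∀ f → clique G low-degree f ⇒ clique G′ everything f
        survives f eq = clique⁺ G′ everything f (λ _ → ≡.refl) λ i j i≢j →
          edge i j (adj⇒Joined (built h) (clique-edges G (adj-sym (built h)) low-degree f eq i j i≢j))
          where
          l = clique-vertices G low-degree f eq
          edge : ∀ i j → Joined (built h) (lookup f i) (lookup f j) → G′ (lookup f i) (lookup f j) ≡ true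
          edge i j (inj₁ e∈) = Joined⇒adj (built (thin h)) (inj₁ (keep (l i) (l j) e∈))
          edge i j (inj₂ e∈) = Joined⇒adj (built (thin h)) (inj₂ (keep (l j) (l i) e∈))

      -- Low-degree cliques survive thinning and are compared with Q′; the at most μ s vertices of
      -- high degree each meet at most m s^(m-1) ordered cliques.
      cliques-upper : ∀ k {η r μ} → 0# ≤ η → 0# ≤ r →
        (∀ {x} → (((η * s) * (η * s)) * ((η * s) * (η * s))) ≤ x → 1# ≤ x * r) → s ≤ D * μ →
        cl (3 ℕ.+ k) G everything ≤
          s ^ (3 ℕ.+ k) * (((p ^ tri (3 ℕ.+ k) + ι (3 ℕ.+ k) * μ) + ι (tri (3 ℕ.+ k)) * (η + η)) + κ-thin h * r)
      cliques-upper k {η} {r} {μ} 0≤η 0≤r r-large s≤Dμ = begin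
        cl m G everything
          ≤⟨ cl-restrict G (adj-sym (built h)) low-degree (2 ℕ.+ k) ⟩
        cl m G low-degree + (ι m * H) * cl (2 ℕ.+ k) G everything
          ≤⟨ +-mono-≤ (≤-trans (cl-low-degree m) main) rest ⟩
        (P * S + S * e) + (ι m * (μ * s)) * s ^ (2 ℕ.+ k)
          ≈⟨ solve 7 (λ P s S E κ m μ → (P :* (s :* S) :+ (s :* S) :* (E :+ κ)) :+ (m :* (μ :* s)) :* S :=
               (s :* S) :* (((P :+ m :* μ) :+ E) :+ κ)) ≈-refl P s (s ^ (2 ℕ.+ k)) (ι (tri m) * (η + η)) (κ-thin h * r) (ι m) μ ⟩
        S * (((P + ι m * μ) + ι (tri m) * (η + η)) + κ-thin h * r) ∎
        where
        m = 3 ℕ.+ k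
        P = p ^ tri m
        S = s ^ m
        H = ∑ V (λ y → ⟦ not (low-degree y) ⟧)
        e = ι (tri m) * (η + η) + κ-thin h * r
        x = cl m G′ everything
        y = P * cl m Q′ everything
        main : x ≤ P * S + S * e
        main = begin
          x                ≈⟨ solve 2 (λ x y → x := y :+ (x :- y)) ≈-refl x y ⟩
          y + (x - y)      ≤⟨ +-mono-≤ (*-monoˡ-≤ (^-nonNeg (tri m) 0≤p) (cliques≤ (suc k) Q′ Q′⊑Q))
                                (proj₁ (clique-deviation k 0≤η 0≤r r-large)) ⟩
          P * S + S * e    ∎
        0≤H : 0# ≤ H
        0≤H = ∑-nonNeg V λ y → ⟦⟧-nonNeg (not (low-degree y))
        H≤ : H ≤ μ * s
        H≤ = *-cancelˡ-≤ 0<D (≤-trans high-degree-few (≤-trans (*-monoʳ-≤ 0≤s s≤Dμ) (≤-reflexive (*-assoc _ _ _))))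
        rest : (ι m * H) * cl (2 ℕ.+ k) G everything ≤ (ι m * (μ * s)) * s ^ (2 ℕ.+ k)
        rest = *-mono-≤ (*-nonNeg (0≤ι m) 0≤H) (^-nonNeg (2 ℕ.+ k) 0≤s) (*-monoˡ-≤ (0≤ι m) H≤)
          (cliques≤ k G (adj-mono {built h} (built⊆asked h)))

      cl-2-split : cl 2 G everything ≈ p * cl 2 Q everything + (∑-noise h + ∑-noise h)
      cl-2-split = begin-equality
        cl 2 G everything
          ≈⟨ ≈-trans (cl-2 G everything) (∑-cong₂ V V λ x y → ≈-trans (*-identityˡ _) (adj-split h valid x y)) ⟩
        ∑ V (λ x → ∑ V λ y → p * ⟦ Q x y ⟧ + (noise h x y + noise h y x))
          ≈⟨ ≈-trans (∑-cong V λ x → ≈-trans (∑-+ V _ _) (+-cong (∑-*ˡ V _ _) (∑-+ V _ _)))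
               (≈-trans (∑-+ V _ _) (+-cong (∑-*ˡ V _ _) (∑-+ V _ _))) ⟩
        p * ∑ V (λ x → ∑ V λ y → ⟦ Q x y ⟧) + (∑-noise h + ∑ V (λ x → ∑ V λ y → noise h y x))
          ≈⟨ +-cong (*-congˡ (≈-sym (≈-trans (cl-2 Q everything) (∑-cong₂ V V λ x y → *-identityˡ _))))
               (+-congˡ (∑-swap V V _)) ⟩
        p * cl 2 Q everything + (∑-noise h + ∑-noise h) ∎

  -- Among the first `n` vertices only x itself can fail to be a neighbour of x.
  co-degree : ∀ {n L} → (∀ {e} → e ∈ complete-pairs n → e ∈ L) → ∀ (a : ℤ → Bool) {x} → x ∈ initial n →
    ∑ (initial n) (λ y → ⟦ a y ⟧) ≤ 1# + ∑ (initial n) (λ y → ⟦ a y ∧ adj L x y ⟧)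
  co-degree {n} {L} ⊆L a {x} x∈ = begin
    ∑ V (λ y → ⟦ a y ⟧)
      ≤⟨ ∑-mono-∈ V pointwise ⟩
    ∑ V (λ y → ⟦ does (y ℤ.≟ x) ⟧ + ⟦ a y ∧ adj L x y ⟧)
      ≈⟨ ∑-+ V _ _ ⟩
    ∑ V (λ y → ⟦ does (y ℤ.≟ x) ⟧) + ∑ V (λ y → ⟦ a y ∧ adj L x y ⟧)
      ≤⟨ +-monoˡ-≤ _ (∑-δ x (unique-initial n)) ⟩
    1# + ∑ V (λ y → ⟦ a y ∧ adj L x y ⟧) ∎
    where
    V = initial n
    pointwise : ∀ {y} → y ∈ V → ⟦ a y ⟧ ≤ ⟦ does (y ℤ.≟ x) ⟧ + ⟦ a y ∧ adj L x y ⟧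
    pointwise {y} y∈ with y ℤ.≟ x
    ... | yes _  = ≤-trans (⟦⟧-≤1 (a y)) (x≤x+nonNeg (⟦⟧-nonNeg (a y ∧ adj L x y)))
    ... | no y≢x rewrite adj-complete ⊆L x∈ y∈ (λ x≡y → y≢x (≡.sym x≡y)) =
      ≤-respʳ-≈ (≈-sym (+-identityˡ _)) (⟦⟧-mono {a y} (λ eq → ≡.cong (_∧ true) eq))

  -- From bounds on every outcome to the value of a strategy

  module Outcome (p : ℝ) (0≤p : 0# ≤ p) (p≤1 : p ≤ 1#) where
    open Play p 0≤p p≤1

    AllAsked : List Pair → History → Set
    AllAsked L h = ∀ e → e ∈ L → e ∈ asked h

    outcomes-all : ∀ {P : History → Set} → (∀ h → P h) → ∀ h {n} (S : Strategy (asked h) n) → Outcomes P h S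
    outcomes-all h∈P h done = h∈P h
    outcomes-all h∈P h (query u v _ _ S₁ S₀) = outcomes-all h∈P _ S₁ , outcomes-all h∈P _ S₀

    outcomes-grow : ∀ h {n} (S : Strategy (asked h) n) → Outcomes (AllAsked (asked h)) h S
    outcomes-grow h done e e∈ = e∈
    outcomes-grow h (query u v _ _ S₁ S₀) =
      outcomes-map (λ _ grow e e∈ → grow e (there e∈)) _ S₁ (outcomes-grow _ S₁) ,
      outcomes-map (λ _ grow e e∈ → grow e (there e∈)) _ S₀ (outcomes-grow _ S₀)

    outcomes-follow : ∀ h (L : List Pair) k n inc bel below → length L ℕ.≤ n →
      Outcomes (AllAsked L) h (follow {asked h} L k n inc bel below)
    outcomes-follow h [] k n inc bel below _ = outcomes-all (λ _ _ ()) h (star k n below)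
    outcomes-follow h ((u , v) ∷ L) k (suc n) (u<v ∷ inc) (v<k ∷ bel) below (s≤s L≤n) with (u , v) ∈? asked h
    ... | yes e∈ = outcomes-map combine h S (outcomes-zip h S (outcomes-grow h S)
        (outcomes-follow h L k (suc n) inc bel below (ℕ.m≤n⇒m≤1+n L≤n)))
      where
      S = follow L k (suc n) inc bel below
      combine : ∀ h′ → AllAsked (asked h) h′ × AllAsked L h′ → AllAsked ((u , v) ∷ L) h′
      combine h′ (grow , all) e (here ≡.refl) = grow e e∈
      combine h′ (grow , all) e (there e∈L)   = all e e∈L
    ... | no fresh = branch true , branch false
      where
      next : Strategy ((u , v) ∷ asked h) n
      next = follow L k n inc bel (v<k ∷ below)
      branch : ∀ b → Outcomes (AllAsked ((u , v) ∷ L)) (((u , v) , b) ∷ h) next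
      branch b = outcomes-map combine h₁ next (outcomes-zip h₁ next (outcomes-grow h₁ next)
          (outcomes-follow h₁ L k n inc bel (v<k ∷ below) L≤n))
        where
        h₁ = ((u , v) , b) ∷ h
        combine : ∀ h′ → AllAsked (asked h₁) h′ × AllAsked L h′ → AllAsked ((u , v) ∷ L) h′
        combine h′ (grow , all) e (here ≡.refl) = grow e (here ≡.refl)
        combine h′ (grow , all) e (there e∈L)   = all e e∈L

    module _ (m : ℕ) (2≤m : 2 ℕ.≤ m) (N : ℕ) where

      -- The bound on each outcome is affine in one statistic `f`, so the expectation of `f` is all
      -- that is required of the strategy.
      value-upper : ∀ (S : Strategy [] N) c d f → let V = deduplicate ℤ._≟_ (vertices S) in
        (∀ h → Valid h → length h ≡ N →
          Cliques.cl V m (adj (built h)) (CliqueBounds.everything V) ≤ c + d * f h) →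
        value (K m 2≤m) p S ≤ c + d * 𝔼 f [] S
      value-upper S c d f h≤ = begin
        value (K m 2≤m) p S                                  ≡⟨ expected≡𝔼 (K m 2≤m) [] S ⟩
        𝔼 (λ h → ι (#copies (K m 2≤m) (built h))) [] S       ≤⟨ 𝔼-mono [] S (outcomes-map pointwise [] S
          (outcomes-zip [] S (outcomes-valid [] S []) (outcomes-within V [] S (λ ()) (∈-deduplicate⁺ ℤ._≟_)))) ⟩
        𝔼 (λ h → c + d * f h) [] S                           ≈⟨ 𝔼-affine c d f [] S ⟩
        c + d * 𝔼 f [] S ∎
        where
        V = deduplicate ℤ._≟_ (vertices S)
        open CopyCount V (UniqueDec.deduplicate-! ℤ._≟_ (vertices S))
        pointwise : ∀ h → (Valid h × length h ≡ N) × Within V (asked h) →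
                    ι (#copies (K m 2≤m) (built h)) ≤ c + d * f h
        pointwise h ((valid , length≡) , within) = ≤-trans
          (copies≤cl m 2≤m (built h) (λ e∈ → within (built⊆asked h e∈))) (h≤ h valid length≡)

      value-lower : ∀ n c d f → tri n ℕ.≤ N → let V = initial n ; S = query-complete n N in
        (∀ h → Valid h → length h ≡ N → AllAsked (complete-pairs n) h →
          c + d * f h ≤ Cliques.cl V m (adj (built h)) (CliqueBounds.everything V)) →
        c + d * 𝔼 f [] S ≤ value (K m 2≤m) p S
      value-lower n c d f tri≤ ≤h = begin
        c + d * 𝔼 f [] S                                     ≈⟨ 𝔼-affine c d f [] S ⟨
        𝔼 (λ h → c + d * f h) [] S                           ≤⟨ 𝔼-mono [] S (outcomes-map pointwise [] S
          (outcomes-zip [] S (outcomes-valid [] S []) (outcomes-follow [] (complete-pairs n) n N _ _ _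
            (≡.subst (ℕ._≤ N) (≡.sym (length-complete-pairs n)) tri≤)))) ⟩
        𝔼 (λ h → ι (#copies (K m 2≤m) (built h))) [] S       ≡⟨ expected≡𝔼 (K m 2≤m) [] S ⟨
        value (K m 2≤m) p S ∎
        where
        S = query-complete n N
        open CopyCount (initial n) (unique-initial n)
        pointwise : ∀ h → (Valid h × length h ≡ N) × AllAsked (complete-pairs n) h →
                    c + d * f h ≤ ι (#copies (K m 2≤m) (built h))
        pointwise h ((valid , length≡) , ⊆asked) = ≤-trans (≤h h valid length≡ ⊆asked)
          (cl≤copies m 2≤m (built h) (All.tabulate λ e∈ → All.lookup valid (built⊆asked h e∈)))

  -- Square roots, logarithms and natural numbers

  ι-+ : ∀ m n → ι (m ℕ.+ n) ≈ ι m + ι n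
  ι-+ = ×-homo-+ 1#

  ι-mono : ∀ {m n} → m ℕ.≤ n → ι m ≤ ι n
  ι-mono {n = n} z≤n = 0≤ι n
  ι-mono (s≤s m≤n)   = +-monoʳ-≤ 1# (ι-mono m≤n)

  0<ι : ∀ n → 0# < ι (suc n)
  0<ι n = +-pos 0<1 (0≤ι n)

  ι-double : ∀ N → ι (2 ℕ.* N) ≈ ι N + ι N
  ι-double N = ≈-trans (ι-+ N (N ℕ.+ 0)) (+-congˡ (reflexive (≡.cong ι (ℕ.+-identityʳ N))))

  ⁻¹-≤1 : ∀ {x} → 1# ≤ x → x ⁻¹ ≤ 1#
  ⁻¹-≤1 {x} 1≤x = *-cancelˡ-≤ 0<x (≤-respˡ-≈ (≈-sym (*-inverseʳ (pos⇒≉0 0<x))) (≤-respʳ-≈ (≈-sym (*-identityʳ x)) 1≤x))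
    where
    0<x = <-≤-trans 0<1 1≤x

  *⁻¹-cancel : ∀ {x} y → 0# < x → x * (y * x ⁻¹) ≈ y
  *⁻¹-cancel {x} y 0<x = ≈-trans (solve 3 (λ x y z → x :* (y :* z) := y :* (x :* z)) ≈-refl x y (x ⁻¹))
    (≈-trans (*-congˡ (*-inverseʳ (pos⇒≉0 0<x))) (*-identityʳ y))

  0≤sqrt : ∀ {x} (0≤x : 0# ≤ x) → 0# ≤ sqrt x 0≤x
  0≤sqrt {x} 0≤x = proj₁ (proj₂ (sqrt-complete x 0≤x)) (≤-respˡ-≈ (≈-sym (zeroˡ 0#)) 0≤x)

  -- Otherwise the Newton step s - h with h = (s² - x)/(2s) has square x + h² ≥ x, hence bounds the
  -- set from above although it lies below its supremum.
  sqrt²≤ : ∀ {x} (0≤x : 0# ≤ x) → sqrt x 0≤x * sqrt x 0≤x ≤ x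
  sqrt²≤ {x} 0≤x with sqrt x 0≤x * sqrt x 0≤x ≤? x
  ... | yes ≤x = ≤x
  ... | no  ≰x with proj₂ (proj₂ (sqrt-complete x 0≤x)) {s - h} s-h<s
    where
    s = sqrt x 0≤x
    0<ss = ≤-<-trans 0≤x (≰⇒> ≰x)
    0<s : 0# < s
    0<s = 0≤sqrt 0≤x , λ 0≈s → proj₂ 0<ss (≈-sym (≈-trans (*-congʳ (≈-sym 0≈s)) (zeroˡ s)))
    0<2s = +-pos 0<s (0≤sqrt 0≤x)
    h = (s * s - x) * (s + s) ⁻¹
    0<d : 0# < s * s - x
    0<d = ≰⇒> λ d≤0 → ≰x (≤-by (≤-respˡ-≈ -0#≈0# (neg-mono d≤0)) (solve 2 (λ x t → x :- t := :- (t :- x)) ≈-refl x (s * s)))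
    s-h<s : s - h < s
    s-h<s = ≰⇒> λ s≤ → <⇒≱ (*-pos 0<d (⁻¹-pos 0<2s))
      (≤-by (x≤y⇒0≤y-x s≤) (solve 2 (λ s h → con (+ 0) :- h := (s :- h) :- s) ≈-refl s h))
  ... | z , zz≤x , s-h<z = contradiction z≤s-h (<⇒≱ s-h<z)
    where
    s = sqrt x 0≤x
    0≤s = 0≤sqrt 0≤x
    0<ss = ≤-<-trans 0≤x (≰⇒> ≰x)
    0<s : 0# < s
    0<s = 0≤s , λ 0≈s → proj₂ 0<ss (≈-sym (≈-trans (*-congʳ (≈-sym 0≈s)) (zeroˡ s)))
    0<2s = +-pos 0<s 0≤s
    h = (s * s - x) * (s + s) ⁻¹
    2sh≈ : (s + s) * h ≈ s * s - x
    2sh≈ = *⁻¹-cancel (s * s - x) 0<2s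
    h≤s : h ≤ s
    h≤s = *-cancelˡ-≤ 0<2s (≤-respˡ-≈ (≈-sym 2sh≈) (≤-by (+-nonNeg 0≤x (x*x-nonNeg s))
      (solve 2 (λ s x → (s :+ s) :* s :- (s :* s :- x) := x :+ s :* s) ≈-refl s x)))
    z≤s-h : z ≤ s - h
    z≤s-h = square-cancel-≤ (x≤y⇒0≤y-x h≤s) (≤-trans zz≤x (≤-by (x*x-nonNeg h) (begin-equality
      (s - h) * (s - h) - x            ≈⟨ solve 3 (λ s h x → (s :- h) :* (s :- h) :- x :=
                                            ((s :* s :- x) :- (s :+ s) :* h) :+ h :* h) ≈-refl s h x ⟩
      ((s * s - x) - (s + s) * h) + h * h  ≈⟨ +-congʳ (≈-trans (+-congˡ (-‿cong 2sh≈)) (-‿inverseʳ _)) ⟩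
      0# + h * h                       ≈⟨ +-identityˡ _ ⟩
      h * h                            ∎)))

  -- Otherwise d = x - s² is positive, and h = d/(1 + 2s + d) ≤ 1 gives (s + h)² ≤ s² + (1 + 2s) h ≤
  -- x, so s + h is an element above the supremum.
  ≤sqrt² : ∀ {x} (0≤x : 0# ≤ x) → x ≤ sqrt x 0≤x * sqrt x 0≤x
  ≤sqrt² {x} 0≤x with x ≤? sqrt x 0≤x * sqrt x 0≤x
  ... | yes x≤ = x≤
  ... | no  x≰ = ⊥-elim (<⇒≱ 0<h (≤-by (x≤y⇒0≤y-x s+h≤s)
      (solve 2 (λ s h → con (+ 0) :- h := s :- (s :+ h)) ≈-refl s h)))
    where
    s = sqrt x 0≤x
    d = x - s * s
    b = (1# + (s + s)) + d
    0<d : 0# < d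
    0<d = ≰⇒> λ d≤0 → x≰ (≤-by (≤-respˡ-≈ -0#≈0# (neg-mono d≤0)) (solve 2 (λ x t → t :- x := :- (x :- t)) ≈-refl x (s * s)))
    0≤2s = +-nonNeg (0≤sqrt 0≤x) (0≤sqrt 0≤x)
    0<b : 0# < b
    0<b = +-pos (+-pos 0<1 0≤2s) (<⇒≤ 0<d)
    h = d * b ⁻¹
    0<h : 0# < h
    0<h = *-pos 0<d (⁻¹-pos 0<b)
    bh≈d : b * h ≈ d
    bh≈d = *⁻¹-cancel d 0<b
    h≤1 : h ≤ 1#
    h≤1 = *-cancelˡ-≤ 0<b (≤-respˡ-≈ (≈-sym bh≈d) (≤-by (+-nonNeg 0≤1 0≤2s)
      (solve 2 (λ s d → ((con (+ 1) :+ (s :+ s)) :+ d) :* con (+ 1) :- d := con (+ 1) :+ (s :+ s)) ≈-refl s d)))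
    s+h≤s : s + h ≤ s
    s+h≤s = proj₁ (proj₂ (sqrt-complete x 0≤x)) (begin
      (s + h) * (s + h)                  ≈⟨ solve 2 (λ s h → (s :+ h) :* (s :+ h) := s :* s :+ ((s :+ s) :* h :+ h :* h)) ≈-refl s h ⟩
      s * s + ((s + s) * h + h * h)      ≤⟨ +-monoʳ-≤ _ (+-monoʳ-≤ _ (≤-respʳ-≈ (*-identityˡ h) (*-monoʳ-≤ (<⇒≤ 0<h) h≤1))) ⟩
      s * s + ((s + s) * h + h)          ≤⟨ +-monoʳ-≤ _ (≤-by (*-nonNeg (<⇒≤ 0<d) (<⇒≤ 0<h))
                                              (solve 3 (λ s h d → ((con (+ 1) :+ (s :+ s)) :+ d) :* h :- ((s :+ s) :* h :+ h) := d :* h) ≈-refl s h d)) ⟩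
      s * s + b * h                      ≈⟨ +-congˡ bh≈d ⟩
      s * s + (x - s * s)                ≈⟨ solve 2 (λ x t → t :+ (x :- t) := x) ≈-refl x (s * s) ⟩
      x                                  ∎)

  sqrt² : ∀ {x} (0≤x : 0# ≤ x) → sqrt x 0≤x * sqrt x 0≤x ≈ x
  sqrt² 0≤x = antisym (sqrt²≤ 0≤x) (≤sqrt² 0≤x)

  -- exp y ≤ 1 / (1 − y), at y = 1 − p.

  0<log : ∀ {p} (0<p : 0# < p) (p<1 : p < 1#) → 0# < log (p ⁻¹) (1≤x⁻¹ 0<p p<1)
  0<log {p} 0<p p<1 = <-≤-trans 0<1-p (proj₁ (proj₂ (log-complete (p ⁻¹) (1≤x⁻¹ 0<p p<1))) (<⇒≤ 0<1-p , sums))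
    where
    y = 1# - p
    0<1-p : 0# < y
    0<1-p = ≰⇒> λ ≤0 → <⇒≱ p<1 (0≤y-x⇒x≤y (≤-respʳ-≈ (solve 1 (λ p → :- (con (+ 1) :- p) := p :- con (+ 1)) ≈-refl p)
      (≤-respˡ-≈ -0#≈0# (neg-mono ≤0))))
    1≤! : ∀ n → 1# ≤ ι (n !)
    1≤! n = ≤-respˡ-≈ (+-identityʳ 1#) (ι-mono (ℕ.1≤n! n))
    geometric : ∀ n → p * expSum y n ≤ 1# - y ^ n
    geometric zero    = ≤-reflexive (solve 1 (λ p → p :* con (+ 0) := con (+ 1) :- con (+ 1)) ≈-refl p)
    geometric (suc n) = begin
      p * (expSum y n + y ^ n * ι (n !) ⁻¹)       ≈⟨ distribˡ _ _ _ ⟩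
      p * expSum y n + p * (y ^ n * ι (n !) ⁻¹)
        ≤⟨ +-mono-≤ (geometric n) (*-monoˡ-≤ (<⇒≤ 0<p) (≤-respʳ-≈ (*-identityʳ _)
             (*-monoˡ-≤ (^-nonNeg n (<⇒≤ 0<1-p)) (⁻¹-≤1 (1≤! n))))) ⟩
      (1# - y ^ n) + p * y ^ n                    ≈⟨ solve 2 (λ p Y → (con (+ 1) :- Y) :+ p :* Y := con (+ 1) :- (con (+ 1) :- p) :* Y) ≈-refl p (y ^ n) ⟩
      1# - y ^ suc n                              ∎
    sums : ∀ n → expSum y n ≤ p ⁻¹
    sums n = *-cancelˡ-≤ 0<p (begin
      p * expSum y n   ≤⟨ geometric n ⟩
      1# - y ^ n       ≤⟨ ≤-by (^-nonNeg n (<⇒≤ 0<1-p)) (solve 1 (λ Y → con (+ 1) :- (con (+ 1) :- Y) := Y) ≈-refl (y ^ n)) ⟩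
      1#               ≈⟨ *-inverseʳ (pos⇒≉0 0<p) ⟨
      p * p ⁻¹         ∎)

  -- Bernoulli's inequality (1 − b/s) ^ k ≥ 1 − k b/s, cleared of denominators.

  bernoulli : ∀ {s b} → 0# ≤ b → b ≤ s → ∀ k → s * s ^ k ≤ s * (s - b) ^ k + (ι k * b) * s ^ k
  bernoulli {s} {b} 0≤b b≤s zero = ≤-reflexive
    (solve 2 (λ s b → s :* con (+ 1) := s :* con (+ 1) :+ (con (+ 0) :* b) :* con (+ 1)) ≈-refl s b)
  bernoulli {s} {b} 0≤b b≤s (suc k) = begin
    s * (s * S)
      ≤⟨ *-monoˡ-≤ 0≤s (bernoulli 0≤b b≤s k) ⟩
    s * (s * Y + (ι k * b) * S)
      ≈⟨ solve 5 (λ s b S Y k → s :* (s :* Y :+ (k :* b) :* S) :=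
           (s :* ((s :- b) :* Y) :+ (k :* b) :* (s :* S)) :+ (s :* b) :* Y) ≈-refl s b S Y (ι k) ⟩
    (s * ((s - b) * Y) + (ι k * b) * (s * S)) + (s * b) * Y
      ≤⟨ +-monoʳ-≤ _ (*-monoˡ-≤ (*-nonNeg 0≤s 0≤b) (^-monoˡ-≤ k (x≤y⇒0≤y-x b≤s) s-b≤s)) ⟩
    (s * ((s - b) * Y) + (ι k * b) * (s * S)) + (s * b) * S
      ≈⟨ solve 5 (λ s b S Y k → (s :* ((s :- b) :* Y) :+ (k :* b) :* (s :* S)) :+ (s :* b) :* S :=
           s :* ((s :- b) :* Y) :+ ((con (+ 1) :+ k) :* b) :* (s :* S)) ≈-refl s b S Y (ι k) ⟩
    s * ((s - b) * Y) + (ι (suc k) * b) * (s * S) ∎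
    where
    S = s ^ k
    Y = (s - b) ^ k
    0≤s = ≤-trans 0≤b b≤s
    s-b≤s : s - b ≤ s
    s-b≤s = ≤-by 0≤b (solve 2 (λ s b → s :- (s :- b) := b) ≈-refl s b)

  -- The asymptotics

  module Estimates (p : ℝ) (0<p : 0# < p) (p<1 : p < 1#) (m′ : ℕ) (ε : ℝ) (0<ε : 0# < ε) where

    private
      0≤p = <⇒≤ 0<p
      p≤1 = <⇒≤ p<1

      m : ℕ
      m = 2 ℕ.+ m′

      P E δ η w ℓ μ b S₁ S₂ : ℝ
      P  = p ^ tri m
      E  = ι (tri m)
      -- Three errors share the allowed deviation: typical outcomes, exceptional outcomes, and
      -- either the high-degree vertices (upper bound) or the rounding (lower bound).
      δ  = (ε * P) * (ι 3) ⁻¹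
      η  = δ * (1# + (E + E)) ⁻¹
      w  = (η * η) * (η * η)
      -- With D = ℓ s at most s²/D = μ s vertices have high degree, and m μ ≤ δ. The summand 1
      -- ensures D ≥ s.
      ℓ  = 1# + ι m * δ ⁻¹
      μ  = ℓ ⁻¹
      -- One unit for rounding √(2N) down, and m for the vertices used up by the greedy choice.
      b  = 1# + ι m
      -- From 𝔼 κ ≤ N (4D + 1) ≤ 5 ℓ s³, to be at most δ times the threshold (η s)⁴ = w s⁴.
      S₁ = (ι 5 * ℓ) * (δ * w) ⁻¹
      -- From Bernoulli's inequality: the loss P m b s^(m-1) is at most δ s^m.
      S₂ = (P * (ι m * b)) * δ ⁻¹

      0<P : 0# < P
      0<P = ^-pos (tri m) 0<p

      0<δ : 0# < δ
      0<δ = *-pos (*-pos 0<ε 0<P) (⁻¹-pos (0<ι 2))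

      3δ : (δ + δ) + δ ≈ ε * P
      3δ = ≈-trans (solve 1 (λ d → (d :+ d) :+ d := (con (+ 1) :+ (con (+ 1) :+ (con (+ 1) :+ con (+ 0)))) :* d) ≈-refl δ)
        (*⁻¹-cancel (ε * P) (0<ι 2))

      0≤E : 0# ≤ E
      0≤E = 0≤ι (tri m)

      0<1+2E : 0# < 1# + (E + E)
      0<1+2E = +-pos 0<1 (+-nonNeg 0≤E 0≤E)

      0<η : 0# < η
      0<η = *-pos 0<δ (⁻¹-pos 0<1+2E)

      E-small : E * (η + η) ≤ δ
      E-small = begin
        E * (η + η)            ≤⟨ ≤-by (<⇒≤ 0<η) (solve 2 (λ E η → (con (+ 1) :+ (E :+ E)) :* η :- E :* (η :+ η) := η) ≈-refl E η) ⟩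
        (1# + (E + E)) * η     ≈⟨ *⁻¹-cancel δ 0<1+2E ⟩
        δ                      ∎

      0<w : 0# < w
      0<w = *-pos (*-pos 0<η 0<η) (*-pos 0<η 0<η)

      0≤mδ⁻¹ : 0# ≤ ι m * δ ⁻¹
      0≤mδ⁻¹ = *-nonNeg (0≤ι m) (<⇒≤ (⁻¹-pos 0<δ))

      0<ℓ : 0# < ℓ
      0<ℓ = +-pos 0<1 0≤mδ⁻¹

      1≤ℓ : 1# ≤ ℓ
      1≤ℓ = x≤x+nonNeg 0≤mδ⁻¹

      μ-small : ι m * μ ≤ δ
      μ-small = *-cancelˡ-≤ 0<ℓ (begin
        ℓ * (ι m * μ)              ≈⟨ *⁻¹-cancel (ι m) 0<ℓ ⟩
        ι m                        ≈⟨ *⁻¹-cancel (ι m) 0<δ ⟨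
        δ * (ι m * δ ⁻¹)           ≤⟨ ≤-by (<⇒≤ 0<δ) (solve 2 (λ d x → (con (+ 1) :+ x) :* d :- d :* x := d) ≈-refl δ (ι m * δ ⁻¹)) ⟩
        ℓ * δ                      ∎)

      0≤b : 0# ≤ b
      0≤b = +-nonNeg 0≤1 (0≤ι m)

      0≤S₁ : 0# ≤ S₁
      0≤S₁ = *-nonNeg (*-nonNeg (0≤ι 5) (<⇒≤ 0<ℓ)) (<⇒≤ (⁻¹-pos (*-pos 0<δ 0<w)))

      0≤S₂ : 0# ≤ S₂
      0≤S₂ = *-nonNeg (*-nonNeg (<⇒≤ 0<P) (*-nonNeg (0≤ι m) 0≤b)) (<⇒≤ (⁻¹-pos 0<δ))

    -- A sum in place of a maximum: s ≥ `S₀` gives s ≥ 1, `S₁`, `b` and `S₂`.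
    S₀ : ℝ
    S₀ = ((1# + S₁) + b) + S₂

    0<S₀ : 0# < S₀
    0<S₀ = +-pos (+-pos (+-pos 0<1 0≤S₁) 0≤b) 0≤S₂

    module _ (N : ℕ) (s : ℝ) (s²≈2N : s * s ≈ ι N + ι N) (S₀≤s : S₀ ≤ s) (2≤m : 2 ℕ.≤ m) where

      private
        1+S₁+b≤s : (1# + S₁) + b ≤ s
        1+S₁+b≤s = ≤-trans (x≤x+nonNeg 0≤S₂) S₀≤s

        S₂≤s : S₂ ≤ s
        S₂≤s = ≤-trans (≤-respʳ-≈ (+-comm _ _) (x≤x+nonNeg (+-nonNeg (+-nonNeg 0≤1 0≤S₁) 0≤b))) S₀≤s

        b≤s : b ≤ s
        b≤s = ≤-trans (≤-respʳ-≈ (+-comm _ _) (x≤x+nonNeg (+-nonNeg 0≤1 0≤S₁))) 1+S₁+b≤s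

        1+S₁≤s : 1# + S₁ ≤ s
        1+S₁≤s = ≤-trans (x≤x+nonNeg 0≤b) 1+S₁+b≤s

        1≤s : 1# ≤ s
        1≤s = ≤-trans (x≤x+nonNeg 0≤S₁) 1+S₁≤s

        S₁≤s : S₁ ≤ s
        S₁≤s = ≤-trans (≤-respʳ-≈ (+-comm _ _) (x≤x+nonNeg 0≤1)) 1+S₁≤s

        0<s : 0# < s
        0<s = <-≤-trans 0<1 1≤s

        0≤s = <⇒≤ 0<s

        S D σ⁴ r : ℝ
        S  = s ^ m
        D  = ℓ * s
        σ⁴ = ((η * s) * (η * s)) * ((η * s) * (η * s))
        r  = σ⁴ ⁻¹

        0≤S : 0# ≤ S
        0≤S = ^-nonNeg m 0≤s

        0<D : 0# < D
        0<D = *-pos 0<ℓ 0<s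

        s≤D : s ≤ D
        s≤D = ≤-respˡ-≈ (*-identityˡ s) (*-monoʳ-≤ 0≤s 1≤ℓ)

        s≤Dμ : s ≤ D * μ
        s≤Dμ = ≤-reflexive (≈-sym (≈-trans (solve 3 (λ l s m → (l :* s) :* m := l :* (s :* m)) ≈-refl ℓ s μ) (*⁻¹-cancel s 0<ℓ)))

        0<σ⁴ : 0# < σ⁴
        0<σ⁴ = *-pos (*-pos 0<ηs 0<ηs) (*-pos 0<ηs 0<ηs)
          where
          0<ηs = *-pos 0<η 0<s

        0≤r = <⇒≤ (⁻¹-pos 0<σ⁴)

        r-large : ∀ {x} → σ⁴ ≤ x → 1# ≤ x * r
        r-large {x} σ⁴≤x = ≤-respˡ-≈ (*-inverseʳ (pos⇒≉0 0<σ⁴)) (*-monoʳ-≤ 0≤r σ⁴≤x)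

        2N≤s² : ι N + ι N ≤ s * s
        2N≤s² = ≤-reflexive (≈-sym s²≈2N)

        drift-small : r * (ι N * ((D + D) + ((D + D) + 1#))) ≤ δ
        drift-small = *-cancelˡ-≤ 0<σ⁴ (begin
          σ⁴ * (r * (ι N * e))           ≈⟨ ≈-trans (*-congˡ (*-comm _ _)) (*⁻¹-cancel _ 0<σ⁴) ⟩
          ι N * e
            ≤⟨ *-mono-≤ (0≤ι N) (*-nonNeg (0≤ι 5) (<⇒≤ 0<D)) (≤-trans (x≤x+nonNeg (0≤ι N)) 2N≤s²)
                 (≤-by (x≤y⇒0≤y-x (≤-trans 1≤s s≤D)) (solve 1 (λ D →
                   (con (+ 1) :+ (con (+ 1) :+ (con (+ 1) :+ (con (+ 1) :+ (con (+ 1) :+ con (+ 0)))))) :* D :-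
                     ((D :+ D) :+ ((D :+ D) :+ con (+ 1))) := D :- con (+ 1)) ≈-refl D)) ⟩
          (s * s) * (ι 5 * D)
            ≈⟨ solve 3 (λ s l f → (s :* s) :* (f :* (l :* s)) := (f :* l) :* (s :* (s :* s))) ≈-refl s ℓ (ι 5) ⟩
          (ι 5 * ℓ) * (s * (s * s))
            ≤⟨ *-monoʳ-≤ (*-nonNeg 0≤s (x*x-nonNeg s)) (≤-respˡ-≈ (*⁻¹-cancel (ι 5 * ℓ) (*-pos 0<δ 0<w))
                 (*-monoˡ-≤ (<⇒≤ (*-pos 0<δ 0<w)) S₁≤s)) ⟩
          ((δ * w) * s) * (s * (s * s))
            ≈⟨ solve 3 (λ d e s → ((d :* ((e :* e) :* (e :* e))) :* s) :* (s :* (s :* s)) :=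
                 (((e :* s) :* (e :* s)) :* ((e :* s) :* (e :* s))) :* d) ≈-refl δ η s ⟩
          σ⁴ * δ ∎)
          where
          e = (D + D) + ((D + D) + 1#)

        open Play p 0≤p p≤1
        open Outcome p 0≤p p≤1

        from-upper : ∀ {x} → x ≤ S * (((P + δ) + δ) + δ) → x ≤ (1# + ε) * (P * S)
        from-upper {x} x≤ = ≤-trans x≤ (≤-reflexive (begin-equality
          S * (((P + δ) + δ) + δ)      ≈⟨ solve 3 (λ S P d → S :* (((P :+ d) :+ d) :+ d) := S :* (P :+ ((d :+ d) :+ d))) ≈-refl S P δ ⟩
          S * (P + ((δ + δ) + δ))      ≈⟨ *-congˡ (+-congˡ 3δ) ⟩
          S * (P + ε * P)              ≈⟨ solve 3 (λ S P e → S :* (P :+ e :* P) := (con (+ 1) :+ e) :* (P :* S)) ≈-refl S P ε ⟩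
          (1# + ε) * (P * S)           ∎))

        from-lower : ∀ {x} → P * (s - b) ^ m - (S * δ + S * δ) ≤ x → (1# - ε) * (P * S) ≤ x
        from-lower {x} ≤x = ≤-trans (≤-trans (≤-reflexive main≈) (+-monoˡ-≤ _ bern)) ≤x
          where
          main≈ : (1# - ε) * (P * S) ≈ (P * S - S * δ) - (S * δ + S * δ)
          main≈ = begin-equality
            (1# - ε) * (P * S)         ≈⟨ solve 3 (λ S P e → (con (+ 1) :- e) :* (P :* S) := S :* (P :- e :* P)) ≈-refl S P ε ⟩
            S * (P - ε * P)            ≈⟨ *-congˡ (+-congˡ (-‿cong (≈-sym 3δ))) ⟩
            S * (P - ((δ + δ) + δ))    ≈⟨ solve 3 (λ S P d → S :* (P :- ((d :+ d) :+ d)) := (P :* S :- S :* d) :- (S :* d :+ S :* d)) ≈-refl S P δ ⟩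
            (P * S - S * δ) - (S * δ + S * δ) ∎
          PmbS≤ : P * ((ι m * b) * S) ≤ s * (S * δ)
          PmbS≤ = begin
            P * ((ι m * b) * S)        ≈⟨ *-assoc _ _ _ ⟨
            (P * (ι m * b)) * S        ≈⟨ *-congʳ (*⁻¹-cancel (P * (ι m * b)) 0<δ) ⟨
            (δ * S₂) * S               ≤⟨ *-monoʳ-≤ 0≤S (*-monoˡ-≤ (<⇒≤ 0<δ) S₂≤s) ⟩
            (δ * s) * S                ≈⟨ solve 3 (λ d s S → (d :* s) :* S := s :* (S :* d)) ≈-refl δ s S ⟩
            s * (S * δ)                ∎
          bern : P * S - S * δ ≤ P * (s - b) ^ m
          bern = *-cancelˡ-≤ 0<s (begin
            s * (P * S - S * δ)
              ≈⟨ solve 4 (λ s P S d → s :* (P :* S :- S :* d) := P :* (s :* S) :- s :* (S :* d)) ≈-refl s P S δ ⟩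
            P * (s * S) - s * (S * δ)
              ≤⟨ +-mono-≤ (*-monoˡ-≤ (<⇒≤ 0<P) (bernoulli 0≤b b≤s m)) (neg-mono PmbS≤) ⟩
            P * (s * (s - b) ^ m + (ι m * b) * S) - P * ((ι m * b) * S)
              ≈⟨ solve 4 (λ P s Y Z → P :* (s :* Y :+ Z) :- P :* Z := s :* (P :* Y)) ≈-refl P s ((s - b) ^ m) ((ι m * b) * S) ⟩
            s * (P * (s - b) ^ m) ∎)

      upper : 3 ℕ.≤ m ⊎ m ≡ 2 → ∀ (Σ₀ : Strategy [] N) → value (K m 2≤m) p Σ₀ ≤ (1# + ε) * (P * S)
      upper (inj₁ (s≤s (s≤s (s≤s {n = k} z≤n)))) Σ₀ = from-upper (begin
        value (K m 2≤m) p Σ₀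
          ≤⟨ value-upper m 2≤m N Σ₀ (S * ((P + ι m * μ) + E * (η + η))) (S * r) κ-thin (λ h valid length≡ →
               ≤-trans (cliques-upper h valid length≡ k (<⇒≤ 0<η) 0≤r r-large s≤Dμ)
                 (≤-reflexive (solve 4 (λ S A κ r → S :* (A :+ κ :* r) := S :* A :+ (S :* r) :* κ) ≈-refl S _ (κ-thin h) r))) ⟩
        S * ((P + ι m * μ) + E * (η + η)) + (S * r) * 𝔼 κ-thin [] Σ₀
          ≤⟨ +-monoʳ-≤ _ (*-monoˡ-≤ (*-nonNeg 0≤S 0≤r) (𝔼-κ Σ₀)) ⟩
        S * ((P + ι m * μ) + E * (η + η)) + (S * r) * (ι N * drift)
          ≈⟨ solve 4 (λ S A r n → S :* A :+ (S :* r) :* n := S :* (A :+ r :* n)) ≈-refl S _ r _ ⟩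
        S * (((P + ι m * μ) + E * (η + η)) + r * (ι N * drift))
          ≤⟨ *-monoˡ-≤ 0≤S (+-mono-≤ (+-mono-≤ (+-monoʳ-≤ P μ-small) E-small) drift-small) ⟩
        S * (((P + δ) + δ) + δ) ∎)
        where
        open Pointwise p 0≤p p≤1 (deduplicate ℤ._≟_ (vertices Σ₀)) (UniqueDec.deduplicate-! ℤ._≟_ (vertices Σ₀))
          D 0<D s 0<s N 2N≤s² using (κ-thin; cliques-upper; 𝔼-κ; drift)
      upper (inj₂ ≡.refl) Σ₀ = from-upper (begin
        value (K m 2≤m) p Σ₀
          ≤⟨ value-upper m 2≤m N Σ₀ (P * S) (1# + 1#) ∑-noise (λ h valid length≡ → ≤-trans
               (≤-reflexive (cl-2-split h valid length≡))
               (+-mono-≤ (*-mono-≤ 0≤p 0≤S (≤-reflexive (≈-sym (*-identityʳ p)))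
                 (cliques≤ h valid length≡ 0 (adj (asked h)) (λ _ _ eq → eq)))
                 (≤-reflexive (solve 1 (λ f → f :+ f := con (+ 2) :* f) ≈-refl (∑-noise h))))) ⟩
        P * S + (1# + 1#) * 𝔼 ∑-noise [] Σ₀
          ≈⟨ ≈-trans (+-congˡ (≈-trans (*-congˡ (𝔼-∑-noise Σ₀)) (zeroʳ _))) (+-identityʳ _) ⟩
        P * S
          ≤⟨ ≤-by (*-nonNeg 0≤S (+-nonNeg (+-nonNeg 0≤δ 0≤δ) 0≤δ)) (solve 3 (λ S P d →
               S :* (((P :+ d) :+ d) :+ d) :- P :* S := S :* ((d :+ d) :+ d)) ≈-refl S P δ) ⟩
        S * (((P + δ) + δ) + δ) ∎)
        where
        0≤δ = <⇒≤ 0<δ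
        open Pointwise p 0≤p p≤1 (deduplicate ℤ._≟_ (vertices Σ₀)) (UniqueDec.deduplicate-! ℤ._≟_ (vertices Σ₀))
          D 0<D s 0<s N 2N≤s² using (∑-noise; cl-2-split; cliques≤; 𝔼-∑-noise)

      private
        n : ℕ
        n = proj₁ (natural-sqrt (N ℕ.+ N))

        n²≤2N = proj₁ (proj₂ (natural-sqrt (N ℕ.+ N)))

        n≤s : ι n ≤ s
        n≤s = square-cancel-≤ 0≤s (begin
          ι n * ι n         ≈⟨ ×1-homo-* n n ⟨
          ι (n ℕ.* n)       ≤⟨ ι-mono n²≤2N ⟩
          ι (N ℕ.+ N)       ≈⟨ ι-+ N N ⟩
          ι N + ι N         ≈⟨ s²≈2N ⟨
          s * s             ∎)

        s≤1+n : s ≤ ι (suc n)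
        s≤1+n = square-cancel-≤ (0≤ι (suc n)) (begin
          s * s                      ≈⟨ s²≈2N ⟩
          ι N + ι N                  ≈⟨ ι-+ N N ⟨
          ι (N ℕ.+ N)                ≤⟨ ι-mono (proj₂ (proj₂ (natural-sqrt (N ℕ.+ N)))) ⟩
          ι (suc n ℕ.* suc n)        ≈⟨ ×1-homo-* (suc n) (suc n) ⟩
          ι (suc n) * ι (suc n)      ∎)

        S* : Strategy [] N
        S* = query-complete n N

        open Pointwise p 0≤p p≤1 (initial n) (unique-initial n) D 0<D s 0<s N 2N≤s²
          using (κ-thin; clique-deviation; 𝔼-κ; drift; ∑-noise; cl-2-split; 𝔼-∑-noise; thin; thin-id; cl; everything; cl-lower)

        ∑-initial : ∑ (initial n) (λ _ → 1#) ≈ ι n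
        ∑-initial = ≈-trans (∑-1 (initial n)) (reflexive (≡.cong ι (length-initial n)))

        nothing-thinned : ∀ h → thin h ≡ h
        nothing-thinned = thin-id (≤-respˡ-≈ (≈-sym ∑-initial) (≤-trans n≤s s≤D))

        asked-cliques : ∀ h → AllAsked (complete-pairs n) h → (s - b) ^ m ≤ cl m (adj (asked h)) everything
        asked-cliques h all = cl-lower (adj (asked h)) (λ a → co-degree {n} (λ {e} → all e) a) m everything
          -- The greedy bound asks for (s - b) + m = s - 1 ≤ n vertices.
          (x≤y⇒0≤y-x b≤s) (≤-respʳ-≈ (≈-sym ∑-initial) (≤-by (x≤y⇒0≤y-x s≤1+n)
            (solve 3 (λ n s m → n :- ((s :- (con (+ 1) :+ m)) :+ m) := (con (+ 1) :+ n) :- s) ≈-refl (ι n) s (ι m))))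

      -- The affine bound now has slope -S r in κ, so the upper bound on 𝔼 κ again suffices.
      lower : 3 ℕ.≤ m ⊎ m ≡ 2 → (1# - ε) * (P * S) ≤ value (K m 2≤m) p S*
      lower (inj₁ (s≤s (s≤s (s≤s {n = k} z≤n)))) = from-lower (begin
        P * (s - b) ^ m - (S * δ + S * δ)
          ≤⟨ +-monoʳ-≤ _ (neg-mono (+-mono-≤ (*-monoˡ-≤ 0≤S E-small) (*-monoˡ-≤ 0≤S
               (≤-trans (*-monoˡ-≤ 0≤r (𝔼-κ S*)) drift-small)))) ⟩
        P * (s - b) ^ m - (S * (E * (η + η)) + S * (r * 𝔼 κ-thin [] S*))
          ≈⟨ solve 5 (λ A S B r κ → A :- (S :* B :+ S :* (r :* κ)) := (A :- S :* B) :+ (:- (S :* r)) :* κ) ≈-refl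
               (P * (s - b) ^ m) S (E * (η + η)) r (𝔼 κ-thin [] S*) ⟩
        (P * (s - b) ^ m - S * (E * (η + η))) + (- (S * r)) * 𝔼 κ-thin [] S*
          ≤⟨ value-lower m 2≤m N n (P * (s - b) ^ m - S * (E * (η + η))) (- (S * r)) κ-thin (tri≤ {n} n²≤2N) pointwise ⟩
        value (K m 2≤m) p S* ∎)
        where
        pointwise : ∀ h → Valid h → length h ≡ N → AllAsked (complete-pairs n) h →
          (P * (s - b) ^ m - S * (E * (η + η))) + (- (S * r)) * κ-thin h ≤ cl m (adj (built h)) everything
        pointwise h valid length≡ all = begin
          (P * (s - b) ^ m - S * (E * (η + η))) + (- (S * r)) * κ-thin h
            ≈⟨ solve 5 (λ A S B r κ → (A :- S :* B) :+ (:- (S :* r)) :* κ := A :- S :* (B :+ κ :* r)) ≈-refl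
                 (P * (s - b) ^ m) S (E * (η + η)) r (κ-thin h) ⟩
          P * (s - b) ^ m - S * (E * (η + η) + κ-thin h * r)
            ≤⟨ +-monoˡ-≤ _ (*-monoˡ-≤ (<⇒≤ 0<P) (asked-cliques h all)) ⟩
          y - e
            ≤⟨ ≤-by (x≤y⇒0≤y-x (proj₂ deviation)) (solve 3 (λ x y e → x :- (y :- e) := e :- (:- (x :- y))) ≈-refl x y e) ⟩
          x ∎
          where
          x = cl m (adj (built h)) everything
          y = P * cl m (adj (asked h)) everything
          e = S * (E * (η + η) + κ-thin h * r)
          deviation : ∣ x - y ∣≤ e
          deviation = ≡.subst (λ h′ → ∣ cl m (adj (built h′)) everything - P * cl m (adj (asked h′)) everything ∣≤ e)
            (nothing-thinned h) (clique-deviation h valid length≡ k (<⇒≤ 0<η) 0≤r r-large)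
      lower (inj₂ ≡.refl) = from-lower (begin
        P * (s - b) ^ m - (S * δ + S * δ)
          ≤⟨ ≤-by (+-nonNeg 0≤Sδ 0≤Sδ) (solve 2 (λ a d → a :- (a :- (d :+ d)) := d :+ d) ≈-refl _ (S * δ)) ⟩
        P * (s - b) ^ m
          ≈⟨ ≈-trans (+-congˡ (≈-trans (*-congˡ (𝔼-∑-noise S*)) (zeroʳ _))) (+-identityʳ _) ⟨
        P * (s - b) ^ m + (1# + 1#) * 𝔼 ∑-noise [] S*
          ≤⟨ value-lower m 2≤m N n (P * (s - b) ^ m) (1# + 1#) ∑-noise (tri≤ {n} n²≤2N) pointwise ⟩
        value (K m 2≤m) p S* ∎)
        where
        0≤Sδ = *-nonNeg 0≤S (<⇒≤ 0<δ)
        pointwise : ∀ h → Valid h → length h ≡ N → AllAsked (complete-pairs n) h →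
          P * (s - b) ^ m + (1# + 1#) * ∑-noise h ≤ cl 2 (adj (built h)) everything
        pointwise h valid length≡ all = begin
          P * (s - b) ^ m + (1# + 1#) * ∑-noise h
            ≤⟨ +-mono-≤ (*-monoˡ-≤ (<⇒≤ 0<P) (asked-cliques h all))
                 (≤-reflexive (solve 1 (λ f → con (+ 2) :* f := f :+ f) ≈-refl (∑-noise h))) ⟩
          P * cl 2 (adj (asked h)) everything + (∑-noise h + ∑-noise h)
            ≈⟨ +-congʳ (*-congʳ (*-identityʳ p)) ⟩
          p * cl 2 (adj (asked h)) everything + (∑-noise h + ∑-noise h)
            ≈⟨ cl-2-split h valid length≡ ⟨
          cl 2 (adj (built h)) everything ∎

  -- Choice of the constant and conclusion

  large : ∀ {c x y s n} → 0# < x → 0# < y → 0# < c → 0# ≤ s → s * s ≈ ι n + ι n →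
          (c * c) * (x * y) ⁻¹ * x * y ≤ ι n → c ≤ s
  large {c} {x} {y} {s} {n} 0<x 0<y 0<c 0≤s ss≈ le = square-cancel-≤ 0≤s (begin
    c * c                                ≈⟨ *⁻¹-cancel (c * c) (*-pos 0<x 0<y) ⟨
    (x * y) * ((c * c) * (x * y) ⁻¹)     ≈⟨ solve 3 (λ x y z → (x :* y) :* z := z :* x :* y) ≈-refl x y _ ⟩
    (c * c) * (x * y) ⁻¹ * x * y         ≤⟨ le ⟩
    ι n                                  ≤⟨ x≤x+nonNeg (0≤ι n) ⟩
    ι n + ι n                            ≈⟨ ss≈ ⟨
    s * s                                ∎)

  clique-game : ∀ (m : ℕ) (2≤m : 2 ℕ.≤ m) (p : ℝ) (0<p : 0# < p) (p<1 : p < 1#) (ε : ℝ) → 0# < ε →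
      ∃ λ (c : ℝ) → 0# < c × (∀ (N : ℕ) → 1 ℕ.≤ N →
        c * p ⁻¹ ^ (2 ℕ.* m ∸ 1) * log (p ⁻¹) (1≤x⁻¹ 0<p p<1) ^ 2 ≤ ι N →
        let main = p ^ (m C 2) * sqrt (ι (2 ℕ.* N)) (0≤ι (2 ℕ.* N)) ^ m in
        (1# - ε) * main ≤ t (K m 2≤m) p N × t (K m 2≤m) p N ≤ (1# + ε) * main)
  clique-game (suc zero) (s≤s ())
  clique-game m@(suc (suc m′)) 2≤m p 0<p p<1 ε 0<ε =
    -- The constant may depend on p. Dividing by both p-dependent factors, which needs log(1/p) > 0,
    -- makes the hypothesis read N ≥ `S₀`², whence s ≥ `S₀`.
    (S₀ * S₀) * (x * y) ⁻¹ , *-pos (*-pos 0<S₀ 0<S₀) (⁻¹-pos (*-pos 0<x 0<y)) , λ N _ large-N →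
      let s = sqrt (ι (2 ℕ.* N)) (0≤ι (2 ℕ.* N))
          s²≈2N = ≈-trans (sqrt² (0≤ι (2 ℕ.* N))) (ι-double N)
          S₀≤s = large {n = N} 0<x 0<y 0<S₀ (0≤sqrt (0≤ι (2 ℕ.* N))) s²≈2N large-N
          P≈ = λ c → *-congˡ {c} (*-congʳ {s ^ m} (reflexive (≡.cong (p ^_) (tri≡C2 m))))
          optimum = optimal (K m 2≤m) p N
      in ≤-respˡ-≈ (P≈ (1# - ε)) (≤-trans (lower N s s²≈2N S₀≤s 2≤m (≥2-cases 2≤m)) (proj₂ optimum (query-complete (proj₁ (natural-sqrt (N ℕ.+ N))) N))) ,
         ≤-respʳ-≈ (P≈ (1# + ε)) (upper N s s²≈2N S₀≤s 2≤m (≥2-cases 2≤m) (proj₁ optimum))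
    where
    open Estimates p 0<p p<1 m′ ε 0<ε
    x = p ⁻¹ ^ (2 ℕ.* m ∸ 1)
    y = log (p ⁻¹) (1≤x⁻¹ 0<p p<1) ^ 2
    0<x : 0# < x
    0<x = ^-pos (2 ℕ.* m ∸ 1) (⁻¹-pos 0<p)
    0<y : 0# < y
    0<y = ^-pos 2 (0<log 0<p p<1)

theorem15 : (R : CompleteOrderedField) → let open Game R in
    ∀ (m : ℕ) (2≤m : 2 ℕ.≤ m) (p : ℝ) (0<p : 0# < p) (p<1 : p < 1#) (ε : ℝ) → 0# < ε →
    ∃ λ (c : ℝ) → 0# < c × (∀ (N : ℕ) → 1 ℕ.≤ N →
    c * p ⁻¹ ^ (2 ℕ.* m ∸ 1) * log (p ⁻¹) (1≤x⁻¹ 0<p p<1) ^ 2 ≤ ι N →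
    let main = p ^ (m C 2) * sqrt (ι (2 ℕ.* N)) (0≤ι (2 ℕ.* N)) ^ m in
    (1# - ε) * main ≤ t (K m 2≤m) p N × t (K m 2≤m) p N ≤ (1# + ε) * main)
theorem15 R = CliqueGame.clique-game R
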